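{- Suppose that no algorithm solves every Dictionary Matching instance in $o(n/\sqrt{\log n})$ time. Let $P(n)$ and $Q(n)$ denote the preprocessing time and query time of any data structure for suffix array queries over a binary text of length $n$. Then no such data structure can satisfy $$P(n)+\frac{n(1+\log\log n)}{\log n}\,(Q(n)+1)=o\!\left(\frac{n}{\sqrt{\log n}}\right).$$ In particular, no such data structure can simultaneously have $P(n)=o(n/\sqrt{\log n})$ and query time $Q(n)=o(\sqrt{\log n}/(1+\log\log n))$.
   Context: Logarithms are binary; $[a..b]=\{k\in\mathbb Z:a\le k\le b\}$; strings are indexed from $1$. Dictionary Matching problem: let $n\ge2$ and $k,m\ge1$ be integers with $k=\Theta(n/\log n)$ and $m=\Theta(\log n)$. The input consists of the packed representation of a text $T\in\{0,1\}^n$ and the packed representations of a collection $\mathcal D=\{P_1,\dots,P_k\}\subseteq\{0,1\}^m$ of patterns. The output is YES if some $P_i$ occurs in $T$ as a substring, and NO otherwise. The model is the word RAM with word size $w=c\log n$, $c\ge2$ constant (standard arithmetic and bitwise word operations take $O(1)$ time). For a text $T$ of length $n$, $\mathrm{SA}_T[i]$ is the starting position of the lexicographically $i$th smallest suffix of $T$ (a proper prefix of a string is smaller than the string). A data structure for suffix array queries is built by a preprocessing algorithm from the packed representation of a binary text $T$ of length $n$ in $P(n)$ time and, given $i\in[1..n]$, returns $\mathrm{SA}_T[i]$ in $Q(n)$ time. The packed representation of a binary string with word size $w$ stores $w$ consecutive bits per word (earlier bits in lower-order positions), with unused bits of the last word set to $0$. -}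

module Defs where

open import Data.Bool using (Bool; true; false; _∧_; _∨_; _xor_; if_then_else_)
import Data.Bool as Bool
import Data.Bool.Properties as Bool
open import Data.Integer using (ℤ; +_; -[1+_])
import Data.Integer as ℤ
open import Data.List using (List; []; _∷_; concatMap; drop; filter; foldr;
  length; map; take; upTo)
open import Data.List.Relation.Binary.Infix.Heterogeneous using (Infix)
open import Data.List.Relation.Binary.Lex.Strict using (Lex-<; <-decidable)
open import Data.Nat using (ℕ; zero; suc; NonZero; _+_; _*_; _∸_; _^_; _≤_; _<_;
  _≡ᵇ_; _<ᵇ_)
open import Data.Nat.DivMod using (_/_; _%_)
open import Data.Nat.Properties using (m^n≢0)
open import Data.Product using (Σ-syntax; ∃-syntax; _×_)
open import Data.Rational using (ℚ; 0ℚ; 1ℚ; ↥_; ↧ₙ_; +-*-rawSemiring)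
import Data.Rational as ℚ
open import Data.Sum using (_⊎_)
open import Data.Unit using (⊤)
open import Data.Vec using (Vec; toList)
open import Data.Vec.Relation.Unary.Any using (Any)
open import Algebra.Definitions.RawSemiring +-*-rawSemiring
  using () renaming (_^_ to _^ℚ_)
open import Relation.Binary.PropositionalEquality using (_≡_; _≢_)
open import Relation.Binary using (Decidable)
open import Relation.Nullary using (¬_)

------------------------------------------------------------------------
-- Real numbers

-- A real x is given by the rationals below it (q < x) and above it (x < q).
-- The cut axioms are kept apart, in IsReal, so that the expressions in
-- running times can be written down without carrying proofs.

record Cut : Set₁ where
  field
    Lower : ℚ → Set
    Upper : ℚ → Set

open Cut public

record IsReal (x : Cut) : Set where
  field
    lower-inhabited : ∃[ q ] Lower x q
    upper-inhabited : ∃[ q ] Upper x q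
    lower-down      : ∀ {q r} → q ℚ.≤ r → Lower x r → Lower x q
    upper-up        : ∀ {q r} → q ℚ.≤ r → Upper x q → Upper x r
    lower-open      : ∀ {q} → Lower x q → ∃[ r ] q ℚ.< r × Lower x r
    upper-open      : ∀ {q} → Upper x q → ∃[ r ] r ℚ.< q × Upper x r
    disjoint        : ∀ {q} → ¬ (Lower x q × Upper x q)
    located         : ∀ {q r} → q ℚ.< r → Lower x q ⊎ Upper x r

infix 4 _≤ᴿ_

_≤ᴿ_ : Cut → Cut → Set
x ≤ᴿ y = ∀ q → Lower x q → Lower y q

rational : ℚ → Cut
rational p = record { Lower = λ q → q ℚ.< p ; Upper = λ q → p ℚ.< q }

natural : ℕ → Cut
natural n = rational (+ n ℚ./ 1)

infixl 6 _+ᴿ_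
infixl 7 _*ᴿ_ _/ᴿ_

_+ᴿ_ : Cut → Cut → Cut
x +ᴿ y = record
  { Lower = λ q → ∃[ r ] ∃[ s ] Lower x r × Lower y s × q ℚ.≤ r ℚ.+ s
  ; Upper = λ q → ∃[ r ] ∃[ s ] Upper x r × Upper y s × r ℚ.+ s ℚ.≤ q
  }

-- This is the product only if both reals are nonnegative.
_*ᴿ_ : Cut → Cut → Cut
x *ᴿ y = record
  { Lower = λ q → q ℚ.< 0ℚ ⊎
      (∃[ r ] ∃[ s ] 0ℚ ℚ.≤ r × 0ℚ ℚ.≤ s × Lower x r × Lower y s × q ℚ.≤ r ℚ.* s)
  ; Upper = λ q → ∃[ r ] ∃[ s ] Upper x r × Upper y s × r ℚ.* s ℚ.≤ q
  }

-- The inverse of a positive real.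
inverse : Cut → Cut
inverse x = record
  { Lower = λ q → ∃[ r ] Upper x r × q ℚ.* r ℚ.≤ 1ℚ
  ; Upper = λ q → ∃[ r ] 0ℚ ℚ.< r × Lower x r × 1ℚ ℚ.≤ q ℚ.* r
  }

-- The quotient of a nonnegative real by a positive one.
_/ᴿ_ : Cut → Cut → Cut
x /ᴿ y = x *ᴿ inverse y

-- The square root of a nonnegative real.
√_ : Cut → Cut
√ x = record
  { Lower = λ q → q ℚ.< 0ℚ ⊎ Lower x (q ℚ.* q)
  ; Upper = λ q → 0ℚ ℚ.< q × Upper x (q ℚ.* q)
  }

-- 2 to the power max(p, 0).
2^⁺_ : ℤ → ℚ
2^⁺ (+ p)    = + (2 ^ p) ℚ./ 1
2^⁺ -[1+ p ] = 1ℚ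

-- The binary logarithm of a positive real.  For q = p / d, the comparison
-- of 2^q with r > 0 is that of 2^p with r^d, where 2^p is the quotient of
-- 2^max(p,0) by 2^max(-p,0).
log₂ : Cut → Cut
log₂ x = record
  { Lower = λ q → ∃[ r ] 0ℚ ℚ.≤ r × Lower x r ×
                  2^⁺ (↥ q) ℚ.≤ (r ^ℚ ↧ₙ q) ℚ.* 2^⁺ (ℤ.- ↥ q)
  ; Upper = λ q → ∃[ r ] Upper x r ×
                  (r ^ℚ ↧ₙ q) ℚ.* 2^⁺ (ℤ.- ↥ q) ℚ.≤ 2^⁺ (↥ q)
  }

log loglog : ℕ → Cut
log n    = log₂ (natural n)
loglog n = log₂ (log n)

infix 4 _∈o_

_∈o_ : (f g : ℕ → Cut) → Set
f ∈o g = ∀ ε → 0ℚ ℚ.< ε → ∃[ N ] ∀ n → N ≤ n → f n ≤ᴿ rational ε *ᴿ g n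

-- x and y agree up to the factor a in both directions.
Within : ℕ → Cut → Cut → Set
Within a x y = x ≤ᴿ natural a *ᴿ y × y ≤ᴿ natural a *ᴿ x

------------------------------------------------------------------------
-- Word RAM

-- Words are natural numbers below 2 ^ w.

truncate : ℕ → ℕ → ℕ
truncate w x = _%_ x (2 ^ w) ⦃ m^n≢0 2 w ⦄

bit : Bool → ℕ
bit b = if b then 1 else 0

bitwise : (Bool → Bool → Bool) → ℕ → ℕ → ℕ → ℕ
bitwise f zero    x y = 0
bitwise f (suc w) x y =
  bit (f (x % 2 ≡ᵇ 1) (y % 2 ≡ᵇ 1)) + 2 * bitwise f w (x / 2) (y / 2)

data Op : Set where
  add sub mul div mod and or xor shl shr eq lt : Op

-- Arithmetic is modulo 2 ^ w; division and remainder by 0 give 0.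
⟦_⟧ : Op → ℕ → ℕ → ℕ → ℕ
⟦ add ⟧ w x y       = truncate w (x + y)
⟦ sub ⟧ w x y       = truncate w ((x + 2 ^ w) ∸ y)
⟦ mul ⟧ w x y       = truncate w (x * y)
⟦ div ⟧ w x zero    = 0
⟦ div ⟧ w x (suc y) = x / suc y
⟦ mod ⟧ w x zero    = 0
⟦ mod ⟧ w x (suc y) = x % suc y
⟦ and ⟧ w x y       = bitwise _∧_ w x y
⟦ or  ⟧ w x y       = bitwise _∨_ w x y
⟦ xor ⟧ w x y       = bitwise _xor_ w x y
⟦ shl ⟧ w x y       = truncate w (x * 2 ^ y)
⟦ shr ⟧ w x y       = _/_ x (2 ^ y) ⦃ m^n≢0 2 y ⦄
⟦ eq  ⟧ w x y       = bit (x ≡ᵇ y)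
⟦ lt  ⟧ w x y       = bit (x <ᵇ y)

-- Memory is divided into segments of 2 ^ w words.  The segment is a literal
-- in each load and store instruction, so a program uses O(1) of them; the
-- same holds for registers.

record State : Set where
  constructor ⟨_,_⟩
  field
    reg : ℕ → ℕ
    mem : ℕ → ℕ → ℕ

open State public

_[_↦_] : {A : Set} → (ℕ → A) → ℕ → A → (ℕ → A)
(f [ x ↦ v ]) y = if y ≡ᵇ x then v else f y

setReg : ℕ → ℕ → State → State
setReg r v ⟨ ρ , μ ⟩ = ⟨ ρ [ r ↦ v ] , μ ⟩

setMem : ℕ → ℕ → ℕ → State → State
setMem b a v ⟨ ρ , μ ⟩ = ⟨ ρ , μ [ b ↦ μ b [ a ↦ v ] ] ⟩

infixr 5 _⨾_

data Program : Set where
  skip   : Program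
  const  : (r k : ℕ) → Program                   -- r := k
  op     : Op → (r s t : ℕ) → Program            -- r := s op t
  load   : (r b s : ℕ) → Program                 -- r := segment b [ s ]
  store  : (b s t : ℕ) → Program                 -- segment b [ s ] := t
  _⨾_    : (p q : Program) → Program
  ifnz   : (r : ℕ) → (p q : Program) → Program   -- if r ≠ 0 then p else q
  while  : (r : ℕ) → (p : Program) → Program     -- while r ≠ 0 do p

-- Run w p σ u τ: with word size w, from σ the program p halts in τ after
-- u steps.  Instructions and tests take one step each.
data Run (w : ℕ) : Program → State → ℕ → State → Set where
  skip  : ∀ {σ} → Run w skip σ 0 σ
  const : ∀ {σ r k} → Run w (const r k) σ 1 (setReg r (truncate w k) σ)
  op    : ∀ {σ o r s t} →
          Run w (op o r s t) σ 1 (setReg r (⟦ o ⟧ w (reg σ s) (reg σ t)) σ)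
  load  : ∀ {σ r b s} →
          Run w (load r b s) σ 1 (setReg r (mem σ b (reg σ s)) σ)
  store : ∀ {σ b s t} →
          Run w (store b s t) σ 1 (setMem b (reg σ s) (reg σ t) σ)
  _⨾_   : ∀ {p q σ τ υ u v} → Run w p σ u τ → Run w q τ v υ →
          Run w (p ⨾ q) σ (u + v) υ
  if≢0  : ∀ {r p q σ τ u} → reg σ r ≢ 0 → Run w p σ u τ →
          Run w (ifnz r p q) σ (suc u) τ
  if≡0  : ∀ {r p q σ τ u} → reg σ r ≡ 0 → Run w q σ u τ →
          Run w (ifnz r p q) σ (suc u) τ
  loop  : ∀ {r p σ τ υ u v} → reg σ r ≢ 0 → Run w p σ u τ →
          Run w (while r p) τ v υ → Run w (while r p) σ (suc (u + v)) υ
  exit  : ∀ {r p σ} → reg σ r ≡ 0 → Run w (while r p) σ 1 σ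

HaltsWithin : ℕ → Program → State → ℕ → (State → Set) → Set
HaltsWithin w p σ t Post = ∃[ u ] ∃[ τ ] Run w p σ u τ × u ≤ t × Post τ

-- w n is the least integer that is at least c log n.
IsWordSize : Cut → (ℕ → ℕ) → Set
IsWordSize c w = ∀ n → 2 ≤ n →
  c *ᴿ log n ≤ᴿ natural (w n) ×
  (∀ v → c *ᴿ log n ≤ᴿ natural v → w n ≤ v)

------------------------------------------------------------------------
-- Strings

BitString : ℕ → Set
BitString n = Vec Bool n

Occurs : ∀ {m n} → BitString m → BitString n → Set
Occurs P T = Infix _≡_ (toList P) (toList T)

infix 4 _<ₗ_ _<ₗ?_

_<ₗ_ : List Bool → List Bool → Set
_<ₗ_ = Lex-< _≡_ Bool._<_

_<ₗ?_ : Decidable _<ₗ_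
_<ₗ?_ = <-decidable Bool._≟_ Bool._<?_

-- The suffix starting at position j, for j in [1..n].
suffix : ∀ {n} → BitString n → ℕ → List Bool
suffix T j = drop (j ∸ 1) (toList T)

rank : ∀ {n} → BitString n → ℕ → ℕ
rank {n} T j = suc (length (filter (λ i → suffix T i <ₗ? suffix T j) (map suc (upTo n))))

-- j = SA_T[i]: the suffix starting at position j is the i-th smallest.
IsSA : ∀ {n} → BitString n → ℕ → ℕ → Set
IsSA {n} T i j = 1 ≤ j × j ≤ n × rank T j ≡ i

-- ⌈ x / d ⌉, for d > 0.
⌈_÷_⌉ : ℕ → ℕ → ℕ
⌈ x ÷ zero ⌉  = 0
⌈ x ÷ suc d ⌉ = (x + d) / suc d

-- Earlier bits are less significant; a final incomplete block is padded with 0s.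
fromBits : List Bool → ℕ
fromBits = foldr (λ b x → bit b + 2 * x) 0

packed : ∀ {n} → ℕ → BitString n → List ℕ
packed {n} w T =
  map (λ j → fromBits (take w (drop (j * w) (toList T)))) (upTo ⌈ n ÷ w ⌉)

------------------------------------------------------------------------
-- Inputs

-- Registers and memory outside the input are 0.

contents : List ℕ → ℕ → ℕ
contents []       a       = 0
contents (x ∷ xs) zero    = x
contents (x ∷ xs) (suc a) = contents xs a

textInput : ∀ {n} → ℕ → BitString n → State
textInput {n} w T = ⟨ contents (n ∷ []) , segment ⟩
  where
  segment : ℕ → ℕ → ℕ
  segment 0 = contents (packed w T)
  segment _ = λ _ → 0

-- Each pattern starts at a new word.
matchingInput : ∀ {n k m} → ℕ → BitString n → Vec (BitString m) k → State
matchingInput {n} {k} {m} w T D = ⟨ contents (n ∷ k ∷ m ∷ []) , segment ⟩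
  where
  segment : ℕ → ℕ → ℕ
  segment 0 = contents (packed w T)
  segment 1 = contents (concatMap (packed w) (toList D))
  segment _ = λ _ → 0

------------------------------------------------------------------------
-- Dictionary matching

-- Answers in register 0: 1 for YES, 0 for NO.
CorrectAnswer : ∀ {n k m} → BitString n → Vec (BitString m) k → State → Set
CorrectAnswer T D τ =
  (Any (λ P → Occurs P T) D → reg τ 0 ≡ 1) ×
  (¬ Any (λ P → Occurs P T) D → reg τ 0 ≡ 0)

-- The constant a ranges over the constants hidden in k = Θ(n / log n) and
-- m = Θ(log n): one program has to handle all of them, but the running time
-- may depend on a.  The condition k * m < 2 ^ w n, with which the input is
-- addressable, excludes finitely many n for each a.
SolvesDictionaryMatchingIn-o : (ℕ → ℕ) → Program → (ℕ → Cut) → Set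
SolvesDictionaryMatchingIn-o w A g =
  ∀ a → Σ[ t ∈ (ℕ → ℕ) ] (λ n → natural (t n)) ∈o g ×
    (∀ n k m → 2 ≤ n → 1 ≤ k → 1 ≤ m →
     Within a (natural k) (natural n /ᴿ log n) →
     Within a (natural m) (log n) →
     k * m < 2 ^ w n →
     (T : BitString n) (D : Vec (BitString m) k) →
     HaltsWithin (w n) A (matchingInput (w n) T D) (t n) (CorrectAnswer T D))

------------------------------------------------------------------------
-- Data structures for suffix array queries

record DataStructure : Set where
  field
    preprocess : Program
    query      : Program

open DataStructure public

-- The query argument is passed, and the result returned, in register 0.
-- Queries may modify the data structure, so they are required to be correct
-- in every state that arises from preprocessing by a sequence of queries.
data Reachable (w : ℕ) (S : DataStructure) {n} (T : BitString n) : State → Set where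
  built   : ∀ {u σ} → Run w (preprocess S) (textInput w T) u σ →
            Reachable w S T σ
  queried : ∀ {i u σ τ} → Reachable w S T σ → 1 ≤ i → i ≤ n →
            Run w (query S) (setReg 0 i σ) u τ →
            Reachable w S T τ

AnswersSuffixArrayQueries : (ℕ → ℕ) → DataStructure → (P Q : ℕ → ℕ) → Set
AnswersSuffixArrayQueries w S P Q = ∀ n → 2 ≤ n → (T : BitString n) →
  HaltsWithin (w n) (preprocess S) (textInput (w n) T) (P n) (λ _ → ⊤) ×
  (∀ σ i → Reachable (w n) S T σ → 1 ≤ i → i ≤ n →
   HaltsWithin (w n) (query S) (setReg 0 i σ) (Q n) (λ τ → IsSA T i (reg τ 0)))

{-# OPTIONS --safe #-}

-- Compare the suffixes of T with patterns by their first m bits, padded with 0s.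
-- In suffix array order these keys do not decrease, and among the suffixes whose key
-- is that of a pattern those too short to contain it come first.  Hence a pattern
-- occurs in T exactly if it is a prefix of the last suffix whose key is at most its
-- own.  Radix sort puts the patterns in order in O(n / log n) time.  They are then
-- searched for one after the other, each search starting at the rank where the
-- preceding one ended: it advances in strides of about log n ranks, O(n / log n) of
-- them in total, and then by repeated halving of the stride, with O(1 + log log n)
-- queries per pattern.  A query is followed by a comparison of O(1) words, so that
-- dictionary matching takes O(P(n) + n (1 + log log n) / log n · (Q(n) + 1)) time.
-- The data structure is built for T itself, so the word sizes agree.

module Submission where

open import Defs
open import Data.Bool using (Bool; true; false; if_then_else_; _∨_)
import Data.Bool as Bool
open import Data.Empty using (⊥-elim)
open import Data.Integer using (ℤ; -[1+_])
import Data.Integer as ℤ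
import Data.Integer.Properties as ℤ
open import Data.List using (List; []; _∷_; _++_; _ʳ++_; applyUpTo; concatMap; drop; filter; filterᵇ; length; map; take; upTo)
open import Data.List.Properties using (map-cong; length-++; length-map; length-filter; length-upTo; length-drop)
open import Data.List.Membership.Propositional using (_∈_)
open import Data.List.Membership.Propositional.Properties using (∈-++⁺ˡ; ∈-++⁺ʳ; ∈-map⁺; ∈-upTo⁺)
open import Data.List.Relation.Binary.Infix.Heterogeneous using (Infix; here; there)
open import Data.List.Relation.Binary.Lex.Core using (this; next; base; halt)
open import Data.List.Relation.Binary.Prefix.Heterogeneous using (Prefix; []; _∷_)
open import Data.List.Relation.Unary.All using (All; []; _∷_)
import Data.List.Relation.Unary.All as All
import Data.List.Relation.Unary.All.Properties as All
open import Data.List.Relation.Unary.AllPairs using (AllPairs; []; _∷_)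
import Data.List.Relation.Unary.AllPairs as AllPairs
import Data.List.Relation.Unary.AllPairs.Properties as AllPairs
import Data.List.Relation.Unary.Any as ListAny
open import Data.Nat
open import Data.Nat.Properties
open import Data.Nat.DivMod hiding (_mod_; _div_)
import Data.Nat.Divisibility
open import Data.Nat.Tactic.RingSolver using (solve-∀)
open import Data.Product using (Σ-syntax; ∃-syntax; _×_; _,_; proj₁; proj₂)
open import Data.Rational using (ℚ; 0ℚ; 1ℚ; ½; ↥_; ↧ₙ_; mkℚ)
import Data.Rational as ℚ
import Data.Rational.Properties as ℚ
import Data.Rational.Unnormalised as ℚᵘ
import Data.Rational.Unnormalised.Properties as ℚᵘ
import Data.Rational.Solver
import Algebra.Definitions.RawSemiring as RawSemiring
import Data.Nat.Coprimality as Coprimality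
open import Data.Sum using (_⊎_; inj₁; inj₂)
open import Data.Unit using (⊤; tt)
open import Data.Vec using (Vec; toList; []; _∷_)
import Data.Vec.Properties as Vec
open import Data.Vec.Relation.Unary.Any using (Any; here; there)
open import Function.Base using (_∘_; _$_; case_of_)
open import Relation.Binary.PropositionalEquality
open import Relation.Nullary using (¬_; Dec; yes; no)
open import Relation.Nullary.Decidable using (toWitness)

-- Running programs

-- Searching each pattern in the whole suffix array would take about log n queries, hence order n in
-- total, which is too much: only because the patterns are sorted can the long moves be charged to
-- the array once, leaving to each pattern a search within one stride of about log n ranks. The
-- packed representation puts earlier bits in lower positions, so words have to be reversed before
-- their numerical order means anything, and no single operation does this. A table reverses digits
-- of 1 + ⌊w / 2^(C+2)⌋ bits, where C is a natural above c: these are short enough for a table of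
-- O(n / log n) entries, yet a word has only O(1) of them. The same digits are the radix of the
-- sort. The program is told neither w nor c: C is built into it, and w is found by doubling 1 until
-- it overflows. Real quantities are replaced by naturals, with `lg` and `root` for log n and √log
-- n. Either assumption to be refuted becomes the inequalities `Small`, and these bound the running
-- time.

module _ {w : ℕ} where

  infixr 5 _then_

  _then_ : ∀ {p q σ t u} {Mid Post : State → Set} →
           HaltsWithin w p σ t Mid →
           (∀ τ → Mid τ → HaltsWithin w q τ u Post) →
           HaltsWithin w (p ⨾ q) σ (t + u) Post
  (u₁ , τ₁ , run₁ , le₁ , mid) then k with k τ₁ mid
  ... | u₂ , τ₂ , run₂ , le₂ , post =
    u₁ + u₂ , τ₂ , run₁ ⨾ run₂ , +-mono-≤ le₁ le₂ , post

  weaken : ∀ {p σ t t′} {Post Post′ : State → Set} → t ≤ t′ →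
           (∀ τ → Post τ → Post′ τ) →
           HaltsWithin w p σ t Post → HaltsWithin w p σ t′ Post′
  weaken t≤t′ f (u , τ , run , le , post) =
    u , τ , run , ≤-trans le t≤t′ , f τ post

  within : ∀ {p σ t t′} {Post : State → Set} → t ≤ t′ →
           HaltsWithin w p σ t Post → HaltsWithin w p σ t′ Post
  within t≤t′ = weaken t≤t′ (λ _ x → x)

  finally : ∀ {p σ t} {Post Post′ : State → Set} →
            HaltsWithin w p σ t Post → (∀ τ → Post τ → Post′ τ) →
            HaltsWithin w p σ t Post′
  finally h f = weaken ≤-refl f h

  skipped : ∀ {σ t} {Post : State → Set} → Post σ → HaltsWithin w skip σ t Post
  skipped post = 0 , _ , skip , z≤n , post

  -- The value `v` comes with an equation, so that the state passed on holds an expression chosen by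
  -- the caller and not the machine operation. Later reads of registers then mostly hold by `refl`.
  constStep : ∀ {k r v q σ t} {Post : State → Set} → truncate w k ≡ v →
              HaltsWithin w q (setReg r v σ) t Post →
              HaltsWithin w (const r k ⨾ q) σ (suc t) Post
  constStep refl (u , τ , run , le , post) = suc u , τ , const ⨾ run , s≤s le , post

  opStep : ∀ {o r s t v q σ T} {Post : State → Set} →
           ⟦ o ⟧ w (reg σ s) (reg σ t) ≡ v →
           HaltsWithin w q (setReg r v σ) T Post →
           HaltsWithin w (op o r s t ⨾ q) σ (suc T) Post
  opStep refl (u , τ , run , le , post) = suc u , τ , op ⨾ run , s≤s le , post

  loadStep : ∀ {r b s v q σ T} {Post : State → Set} → mem σ b (reg σ s) ≡ v →
             HaltsWithin w q (setReg r v σ) T Post →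
             HaltsWithin w (load r b s ⨾ q) σ (suc T) Post
  loadStep refl (u , τ , run , le , post) = suc u , τ , load ⨾ run , s≤s le , post

  storeStep : ∀ {b s t a v q σ T} {Post : State → Set} →
              reg σ s ≡ a → reg σ t ≡ v →
              HaltsWithin w q (setMem b a v σ) T Post →
              HaltsWithin w (store b s t ⨾ q) σ (suc T) Post
  storeStep refl refl (u , τ , run , le , post) =
    suc u , τ , store ⨾ run , s≤s le , post

  constLast : ∀ {k r v σ t} {Post : State → Set} → truncate w k ≡ v →
              Post (setReg r v σ) → HaltsWithin w (const r k) σ (suc t) Post
  constLast refl post = 1 , _ , const , s≤s z≤n , post

  opLast : ∀ {o r s t v σ T} {Post : State → Set} →
           ⟦ o ⟧ w (reg σ s) (reg σ t) ≡ v → Post (setReg r v σ) →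
           HaltsWithin w (op o r s t) σ (suc T) Post
  opLast refl post = 1 , _ , op , s≤s z≤n , post

  storeLast : ∀ {b s t a v σ T} {Post : State → Set} →
              reg σ s ≡ a → reg σ t ≡ v → Post (setMem b a v σ) →
              HaltsWithin w (store b s t) σ (suc T) Post
  storeLast refl refl post = 1 , _ , store , s≤s z≤n , post

  ifTrue : ∀ {r p q σ t} {Post : State → Set} → reg σ r ≢ 0 →
           HaltsWithin w p σ t Post → HaltsWithin w (ifnz r p q) σ (suc t) Post
  ifTrue r≢0 (u , τ , run , le , post) = suc u , τ , if≢0 r≢0 run , s≤s le , post

  ifFalse : ∀ {r p q σ t} {Post : State → Set} → reg σ r ≡ 0 →
            HaltsWithin w q σ t Post → HaltsWithin w (ifnz r p q) σ (suc t) Post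
  ifFalse r≡0 (u , τ , run , le , post) = suc u , τ , if≡0 r≡0 run , s≤s le , post

  whileTrue : ∀ {r p σ t u} {Mid Post : State → Set} → reg σ r ≢ 0 →
              HaltsWithin w p σ t Mid →
              (∀ τ → Mid τ → HaltsWithin w (while r p) τ u Post) →
              HaltsWithin w (while r p) σ (suc (t + u)) Post
  whileTrue r≢0 (u₁ , τ₁ , run₁ , le₁ , mid) k with k τ₁ mid
  ... | u₂ , τ₂ , run₂ , le₂ , post =
    suc (u₁ + u₂) , τ₂ , loop r≢0 run₁ run₂ , s≤s (+-mono-≤ le₁ le₂) , post

  whileFalse : ∀ {r p σ t} {Post : State → Set} → reg σ r ≡ 0 → Post σ →
               HaltsWithin w (while r p) σ (suc t) Post
  whileFalse r≡0 post = 1 , _ , exit r≡0 , s≤s z≤n , post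

repeat : ℕ → Program → Program
repeat zero    p = skip
repeat (suc n) p = p ⨾ repeat n p

-- Frame conditions: what a program can write

writesReg : Program → ℕ → Bool
writesReg skip          x = false
writesReg (const r k)   x = x ≡ᵇ r
writesReg (op o r s t)  x = x ≡ᵇ r
writesReg (load r b s)  x = x ≡ᵇ r
writesReg (store b s t) x = false
writesReg (p ⨾ q)       x = writesReg p x ∨ writesReg q x
writesReg (ifnz r p q)  x = writesReg p x ∨ writesReg q x
writesReg (while r p)   x = writesReg p x

writesMem : Program → ℕ → Bool
writesMem skip          x = false
writesMem (const r k)   x = false
writesMem (op o r s t)  x = false
writesMem (load r b s)  x = false
writesMem (store b s t) x = x ≡ᵇ b
writesMem (p ⨾ q)       x = writesMem p x ∨ writesMem q x
writesMem (ifnz r p q)  x = writesMem p x ∨ writesMem q x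
writesMem (while r p)   x = writesMem p x

∨-false : ∀ {a b} → a ∨ b ≡ false → a ≡ false × b ≡ false
∨-false {false} {false} _ = refl , refl

∨-falseⁱ : ∀ {a b} → a ≡ false → b ≡ false → a ∨ b ≡ false
∨-falseⁱ refl refl = refl

updated : ∀ {A : Set} (f : ℕ → A) x v → (f [ x ↦ v ]) x ≡ v
updated f x v with x ≡ᵇ x | ≡⇒≡ᵇ x x refl
... | true | _ = refl

≢⇒≡ᵇ-false : ∀ {x y} → x ≢ y → (x ≡ᵇ y) ≡ false
≢⇒≡ᵇ-false {x} {y} x≢y with x ≡ᵇ y in ≡f
... | false = refl
... | true  = ⊥-elim (x≢y (≡ᵇ⇒≡ x y (subst Bool.T (sym ≡f) tt)))

not-updated : ∀ {A : Set} (f : ℕ → A) {x y} v → y ≢ x → (f [ x ↦ v ]) y ≡ f y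
not-updated f {x} {y} v y≢x rewrite ≢⇒≡ᵇ-false y≢x = refl

-- `writesReg` and `writesMem` are computed from the syntax, so for a concrete program and register
-- the premise is `refl`.
record Unchanged (p : Program) (σ τ : State) : Set where
  field
    regs : ∀ r → writesReg p r ≡ false → reg τ r ≡ reg σ r
    mems : ∀ b → writesMem p b ≡ false → ∀ a → mem τ b a ≡ mem σ b a

open Unchanged

unchanged : ∀ {w p σ u τ} → Run w p σ u τ → Unchanged p σ τ
unchanged run = record { regs = rs run ; mems = ms run }
  where
  rs : ∀ {w p σ u τ} → Run w p σ u τ → ∀ x → writesReg p x ≡ false → reg τ x ≡ reg σ x
  rs skip x _ = refl
  rs const x ≡f rewrite ≡f = refl
  rs op x ≡f rewrite ≡f = refl
  rs load x ≡f rewrite ≡f = refl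
  rs store x ≡f = refl
  rs (run₁ ⨾ run₂) x ≡f =
    trans (rs run₂ x (proj₂ (∨-false ≡f))) (rs run₁ x (proj₁ (∨-false ≡f)))
  rs (if≢0 _ run) x ≡f = rs run x (proj₁ (∨-false ≡f))
  rs (if≡0 _ run) x ≡f = rs run x (proj₂ (∨-false ≡f))
  rs (loop _ run₁ run₂) x ≡f = trans (rs run₂ x ≡f) (rs run₁ x ≡f)
  rs (exit _) x ≡f = refl

  ms : ∀ {w p σ u τ} → Run w p σ u τ → ∀ b → writesMem p b ≡ false →
       ∀ a → mem τ b a ≡ mem σ b a
  ms skip x _ a = refl
  ms const x ≡f a = refl
  ms op x ≡f a = refl
  ms load x ≡f a = refl
  ms store x ≡f a rewrite ≡f = refl
  ms (run₁ ⨾ run₂) x ≡f a =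
    trans (ms run₂ x (proj₂ (∨-false ≡f)) a) (ms run₁ x (proj₁ (∨-false ≡f)) a)
  ms (if≢0 _ run) x ≡f = ms run x (proj₁ (∨-false ≡f))
  ms (if≡0 _ run) x ≡f = ms run x (proj₂ (∨-false ≡f))
  ms (loop _ run₁ run₂) x ≡f a = trans (ms run₂ x ≡f a) (ms run₁ x ≡f a)
  ms (exit _) x ≡f a = refl

framed : ∀ {w p σ t Post} → HaltsWithin w p σ t Post →
         HaltsWithin w p σ t (λ τ → Post τ × Unchanged p σ τ)
framed (u , τ , run , le , post) = u , τ , run , le , post , unchanged run

unchanged-refl : ∀ {p σ} → Unchanged p σ σ
unchanged-refl = record { regs = λ _ _ → refl ; mems = λ _ _ _ → refl }

unchanged-trans : ∀ {p σ τ υ} → Unchanged p σ τ → Unchanged p τ υ → Unchanged p σ υ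
unchanged-trans u v = record
  { regs = λ r ≡f → trans (regs v r ≡f) (regs u r ≡f)
  ; mems = λ b ≡f a → trans (mems v b ≡f a) (mems u b ≡f a) }

-- The frame relation to the state before the loop is threaded through all rounds, so that an
-- invariant has to mention only what the body writes. A round costs its test and the body; the last
-- test is the outer `suc`.
countdown : ∀ {w r p c σ} (Inv : ℕ → State → Set) →
            (∀ i τ → Unchanged p σ τ → reg τ r ≡ suc i → Inv (suc i) τ →
             HaltsWithin w p τ c (λ υ → reg υ r ≡ i × Inv i υ)) →
            ∀ i → reg σ r ≡ i → Inv i σ →
            HaltsWithin w (while r p) σ (suc (i * suc c)) (Inv 0)
countdown {w} {r} {p} {c} {σ} Inv step i = go i σ unchanged-refl
  where
  go : ∀ i τ → Unchanged p σ τ → reg τ r ≡ i → Inv i τ →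
       HaltsWithin w (while r p) τ (suc (i * suc c)) (Inv 0)
  go zero    τ unch r≡0 inv = whileFalse r≡0 inv
  go (suc i) τ unch r≡  inv =
    within (≤-reflexive (cong suc (+-suc c _))) $
    whileTrue (λ r≡0 → case trans (sym r≡) r≡0 of λ ())
      (framed (step i τ unch r≡ inv))
      (λ υ ((r≡i , inv′) , unch′) → go i υ (unchanged-trans unch unch′) r≡i inv′)

-- Registers from 48 and segments from 8 on belong to the data structure, whose
-- programs are relocated there; the reduction itself uses the others.

shift : Program → Program
shift skip          = skip
shift (const r k)   = const (48 + r) k
shift (op o r s t)  = op o (48 + r) (48 + s) (48 + t)
shift (load r b s)  = load (48 + r) (8 + b) (48 + s)
shift (store b s t) = store (8 + b) (48 + s) (48 + t)
shift (p ⨾ q)       = shift p ⨾ shift q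
shift (ifnz r p q)  = ifnz (48 + r) (shift p) (shift q)
shift (while r p)   = while (48 + r) (shift p)

-- Nothing is said of the low registers and segments, so the reduction is free to use them between
-- two queries.
record Simulates (σ σ′ : State) : Set where
  field
    regs : ∀ r → reg σ′ (48 + r) ≡ reg σ r
    mems : ∀ b a → mem σ′ (8 + b) a ≡ mem σ b a

shift-run : ∀ {w p σ u τ σ′} → Run w p σ u τ → Simulates σ σ′ →
            ∃[ τ′ ] Run w (shift p) σ′ u τ′ × Simulates τ τ′
shift-run skip sim = _ , skip , sim
shift-run {w = w} (const {r = r} {k = k}) sim = _ , const , record
  { regs = λ x → cong (if x ≡ᵇ r then truncate w k else_) (Simulates.regs sim x)
  ; mems = Simulates.mems sim }
shift-run {w = w} {σ′ = σ′} (op {σ = σ} {o} {r} {s} {t}) sim = _ , op , record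
  { regs = λ x → cong₂ (λ a b → if x ≡ᵇ r then a else b)
      (cong₂ (⟦ o ⟧ w) (Simulates.regs sim s) (Simulates.regs sim t)) (Simulates.regs sim x)
  ; mems = Simulates.mems sim }
shift-run {σ′ = σ′} (load {σ = σ} {r} {b} {s}) sim = _ , load , record
  { regs = λ x → cong₂ (λ a c → if x ≡ᵇ r then a else c)
      (trans (cong (mem σ′ (8 + b)) (Simulates.regs sim s)) (Simulates.mems sim b _))
      (Simulates.regs sim x)
  ; mems = Simulates.mems sim }
shift-run {σ′ = σ′} (store {σ = σ} {b} {s} {t}) sim = _ , store , record
  { regs = Simulates.regs sim
  ; mems = stored }
  where
  stored : ∀ x a → mem (setMem (8 + b) (reg σ′ (48 + s)) (reg σ′ (48 + t)) σ′) (8 + x) a ≡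
                   mem (setMem b (reg σ s) (reg σ t) σ) x a
  stored x a rewrite Simulates.regs sim s | Simulates.regs sim t with x ≡ᵇ b
  ... | false = Simulates.mems sim x a
  ... | true with a ≡ᵇ reg σ s
  ...   | true  = refl
  ...   | false = Simulates.mems sim b a
shift-run (run₁ ⨾ run₂) sim with shift-run run₁ sim
... | _ , run₁′ , sim₁ with shift-run run₂ sim₁
...   | _ , run₂′ , sim₂ = _ , run₁′ ⨾ run₂′ , sim₂
shift-run (if≢0 {r = r} r≢0 run) sim with shift-run run sim
... | _ , run′ , sim′ = _ , if≢0 (r≢0 ∘ trans (sym (Simulates.regs sim r))) run′ , sim′
shift-run (if≡0 {r = r} r≡0 run) sim with shift-run run sim
... | _ , run′ , sim′ = _ , if≡0 (trans (Simulates.regs sim r) r≡0) run′ , sim′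
shift-run (loop {r = r} r≢0 run₁ run₂) sim with shift-run run₁ sim
... | _ , run₁′ , sim₁ with shift-run run₂ sim₁
...   | _ , run₂′ , sim₂ =
        _ , loop (r≢0 ∘ trans (sym (Simulates.regs sim r))) run₁′ run₂′ , sim₂
shift-run (exit {r = r} r≡0) sim = _ , exit (trans (Simulates.regs sim r) r≡0) , sim

shift-writesReg : ∀ p {x} → x < 48 → writesReg (shift p) x ≡ false
shift-writesReg skip          x< = refl
shift-writesReg (const r k)   x< = ≢⇒≡ᵇ-false (<⇒≢ (<-≤-trans x< (m≤m+n 48 r)))
shift-writesReg (op o r s t)  x< = ≢⇒≡ᵇ-false (<⇒≢ (<-≤-trans x< (m≤m+n 48 r)))
shift-writesReg (load r b s)  x< = ≢⇒≡ᵇ-false (<⇒≢ (<-≤-trans x< (m≤m+n 48 r)))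
shift-writesReg (store b s t) x< = refl
shift-writesReg (p ⨾ q)       x< = ∨-falseⁱ (shift-writesReg p x<) (shift-writesReg q x<)
shift-writesReg (ifnz r p q)  x< = ∨-falseⁱ (shift-writesReg p x<) (shift-writesReg q x<)
shift-writesReg (while r p)   x< = shift-writesReg p x<

shift-writesMem : ∀ p {x} → x < 8 → writesMem (shift p) x ≡ false
shift-writesMem skip          x< = refl
shift-writesMem (const r k)   x< = refl
shift-writesMem (op o r s t)  x< = refl
shift-writesMem (load r b s)  x< = refl
shift-writesMem (store b s t) x< = ≢⇒≡ᵇ-false (<⇒≢ (<-≤-trans x< (m≤m+n 8 b)))
shift-writesMem (p ⨾ q)       x< = ∨-falseⁱ (shift-writesMem p x<) (shift-writesMem q x<)
shift-writesMem (ifnz r p q)  x< = ∨-falseⁱ (shift-writesMem p x<) (shift-writesMem q x<)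
shift-writesMem (while r p)   x< = shift-writesMem p x<

truncate-id : ∀ {w x} → x < 2 ^ w → truncate w x ≡ x
truncate-id {w} x< = m<n⇒m%n≡m ⦃ m^n≢0 2 w ⦄ x<

-- Results of instructions that do not overflow

module Values (w : ℕ) where

  -- A `refl` that names the value: it fixes the implicit arguments of the lemmas below when a
  -- register holds the value by computation.
  is : (x : ℕ) → x ≡ x
  is x = refl

  add-value : ∀ {a b x y} → a ≡ x → b ≡ y → x + y < 2 ^ w → ⟦ add ⟧ w a b ≡ x + y
  add-value refl refl = truncate-id {w}

  sub-value : ∀ {a b x y} → a ≡ x → b ≡ y → y ≤ x → x < 2 ^ w → ⟦ sub ⟧ w a b ≡ x ∸ y
  sub-value {x = x} {y} refl refl y≤x x< = begin
    ((x + 2 ^ w) ∸ y) % 2 ^ w ≡⟨ cong (λ z → (z ∸ y) % 2 ^ w) (+-comm x _) ⟩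
    ((2 ^ w + x) ∸ y) % 2 ^ w ≡⟨ cong (_% 2 ^ w) (+-∸-assoc (2 ^ w) y≤x) ⟩
    (2 ^ w + (x ∸ y)) % 2 ^ w ≡⟨ cong (_% 2 ^ w) (+-comm (2 ^ w) _) ⟩
    ((x ∸ y) + 2 ^ w) % 2 ^ w ≡⟨ [m+n]%n≡m%n (x ∸ y) (2 ^ w) ⟩
    (x ∸ y) % 2 ^ w           ≡⟨ m<n⇒m%n≡m (≤-<-trans (m∸n≤m x y) x<) ⟩
    x ∸ y                     ∎
    where
    open ≡-Reasoning
    instance _ = m^n≢0 2 w

  mul-value : ∀ {a b x y} → a ≡ x → b ≡ y → x * y < 2 ^ w → ⟦ mul ⟧ w a b ≡ x * y
  mul-value refl refl = truncate-id {w}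

  div-value : ∀ {a b x y} .⦃ _ : NonZero y ⦄ → a ≡ x → b ≡ y → ⟦ div ⟧ w a b ≡ x / y
  div-value {y = suc y} refl refl = refl

  mod-value : ∀ {a b x y} .⦃ _ : NonZero y ⦄ → a ≡ x → b ≡ y → ⟦ mod ⟧ w a b ≡ x % y
  mod-value {y = suc y} refl refl = refl

  shl-value : ∀ {a b x y} → a ≡ x → b ≡ y → x * 2 ^ y < 2 ^ w → ⟦ shl ⟧ w a b ≡ x * 2 ^ y
  shl-value refl refl = truncate-id {w}

  shl-truncated : ∀ {a b x y} → a ≡ x → b ≡ y → ⟦ shl ⟧ w a b ≡ truncate w (x * 2 ^ y)
  shl-truncated refl refl = refl

  shr-value : ∀ {a b x y} → a ≡ x → b ≡ y → ⟦ shr ⟧ w a b ≡ _/_ x (2 ^ y) ⦃ m^n≢0 2 y ⦄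
  shr-value refl refl = refl

  eq-value : ∀ {a b x y} → a ≡ x → b ≡ y → ⟦ eq ⟧ w a b ≡ bit (x ≡ᵇ y)
  eq-value refl refl = refl

  lt-value : ∀ {a b x y} → a ≡ x → b ≡ y → ⟦ lt ⟧ w a b ≡ bit (x <ᵇ y)
  lt-value refl refl = refl

-- Words and bit reversal

2^≢0 : ∀ n → NonZero (2 ^ n)
2^≢0 n = m^n≢0 2 n

infixl 8 _>>_

_>>_ : ℕ → ℕ → ℕ
x >> n = _/_ x (2 ^ n) ⦃ 2^≢0 n ⦄

1≤2^ : ∀ n → 1 ≤ 2 ^ n
1≤2^ n = >-nonZero⁻¹ (2 ^ n) ⦃ 2^≢0 n ⦄

n<2^n : ∀ n → n < 2 ^ n
n<2^n zero    = s≤s z≤n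
n<2^n (suc n) = begin-strict
  suc n         <⟨ s≤s (n<2^n n) ⟩
  suc (2 ^ n)   ≤⟨ +-monoˡ-≤ (2 ^ n) (1≤2^ n) ⟩
  2 ^ n + 2 ^ n ≡⟨ sym (cong (λ z → 2 ^ n + z) (+-identityʳ _)) ⟩
  2 ^ suc n     ∎
  where open ≤-Reasoning

0>> : ∀ n → 0 >> n ≡ 0
0>> n = 0/n≡0 (2 ^ n) ⦃ 2^≢0 n ⦄

>>0 : ∀ x → x >> 0 ≡ x
>>0 = n/1≡n

/-cong-≡ : ∀ {x y m n} .⦃ _ : NonZero m ⦄ .⦃ _ : NonZero n ⦄ → x ≡ y → m ≡ n → x / m ≡ y / n
/-cong-≡ refl refl = refl

%-cong-≡ : ∀ {x y m n} .⦃ _ : NonZero m ⦄ .⦃ _ : NonZero n ⦄ → x ≡ y → m ≡ n → x % m ≡ y % n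
%-cong-≡ refl refl = refl

>>-+ : ∀ x a b → x >> (a + b) ≡ x >> a >> b
>>-+ x a b = trans (/-cong-≡ {m = 2 ^ (a + b)} {2 ^ a * 2 ^ b} refl (^-distribˡ-+-* 2 a b))
                   (sym (m/n/o≡m/[n*o] x (2 ^ a) (2 ^ b)))
  where
  instance
    _ = 2^≢0 a
    _ = 2^≢0 b
    _ = 2^≢0 (a + b)
    _ = m*n≢0 (2 ^ a) (2 ^ b)

>>-suc : ∀ x a → x >> suc a ≡ (x / 2) >> a
>>-suc x a = >>-+ x 1 a

<2^⇒>>≡0 : ∀ {x n} → x < 2 ^ n → x >> n ≡ 0
<2^⇒>>≡0 {n = n} = m<n⇒m/n≡0 ⦃ 2^≢0 n ⦄

>>-≤ : ∀ x n → x >> n ≤ x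
>>-≤ x n = m/n≤m x (2 ^ n) ⦃ 2^≢0 n ⦄

-- This is the side condition of `+-distrib-/` when the second summand is a multiple of `d`.
no-carry : ∀ x y d .⦃ _ : NonZero d ⦄ → x % d + y * d % d < d
no-carry x y d = subst (λ z → x % d + z < d) (sym (m*n%n≡0 y d))
  (subst (_< d) (sym (+-identityʳ _)) (m%n<n x d))

%-split : ∀ x a b .⦃ _ : NonZero a ⦄ .⦃ _ : NonZero b ⦄ .⦃ _ : NonZero (a * b) ⦄ →
          x % (a * b) ≡ x % a + a * (x / a % b)
%-split x a b = begin
  x % (a * b)                                             ≡⟨ cong (_% (a * b)) x≡ ⟩
  (x % a + a * (x / a % b) + x / a / b * (a * b)) % (a * b)
    ≡⟨ [m+kn]%n≡m%n (x % a + a * (x / a % b)) (x / a / b) (a * b) ⟩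
  (x % a + a * (x / a % b)) % (a * b)                     ≡⟨ m<n⇒m%n≡m bound ⟩
  x % a + a * (x / a % b)                                 ∎
  where
  open ≡-Reasoning
  regroup : ∀ r s t a b → r + (s + t * b) * a ≡ r + a * s + t * (a * b)
  regroup = solve-∀
  x≡ : x ≡ x % a + a * (x / a % b) + x / a / b * (a * b)
  x≡ = trans (m≡m%n+[m/n]*n x a)
      (trans (cong (λ z → x % a + z * a) (m≡m%n+[m/n]*n (x / a) b))
             (regroup (x % a) (x / a % b) (x / a / b) a b))
  bound : x % a + a * (x / a % b) < a * b
  bound = <-≤-trans (+-monoˡ-< (a * (x / a % b)) (m%n<n x a))
            (≤-trans (≤-reflexive (sym (*-suc a (x / a % b)))) (*-monoʳ-≤ a (m%n<n (x / a) b)))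

truncate-+ : ∀ v o x → truncate (v + o) x ≡ truncate v x + 2 ^ v * truncate o (x >> v)
truncate-+ v o x = trans (%-cong-≡ {m = 2 ^ (v + o)} {2 ^ v * 2 ^ o} refl (^-distribˡ-+-* 2 v o))
                         (%-split x (2 ^ v) (2 ^ o))
  where
  instance
    _ = 2^≢0 v
    _ = 2^≢0 o
    _ = 2^≢0 (v + o)
    _ = m*n≢0 (2 ^ v) (2 ^ o)

truncate-< : ∀ w x → truncate w x < 2 ^ w
truncate-< w x = m%n<n x (2 ^ w) ⦃ 2^≢0 w ⦄

truncate-low : ∀ {v w} x → v ≤ w → truncate v (truncate w x) ≡ truncate v x
truncate-low {v} {w} x v≤w rewrite sym (m+[n∸m]≡n v≤w) = begin
  truncate v (truncate (v + o) x)                        ≡⟨ cong (truncate v) (truncate-+ v o x) ⟩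
  truncate v (truncate v x + 2 ^ v * truncate o (x >> v))
    ≡⟨ cong (λ z → truncate v (truncate v x + z)) (*-comm (2 ^ v) _) ⟩
  truncate v (truncate v x + truncate o (x >> v) * 2 ^ v)
    ≡⟨ [m+kn]%n≡m%n (truncate v x) (truncate o (x >> v)) (2 ^ v) ⟩
  truncate v (truncate v x)                              ≡⟨ m%n%n≡m%n x (2 ^ v) ⟩
  truncate v x                                           ∎
  where
  open ≡-Reasoning
  o = w ∸ v
  instance _ = 2^≢0 v

truncate->> : ∀ o v x → truncate (o + v) x >> o ≡ truncate v (x >> o)
truncate->> o v x = begin
  truncate (o + v) x >> o ≡⟨ cong (_>> o) (truncate-+ o v x) ⟩
  (truncate o x + 2 ^ o * truncate v (x >> o)) >> o
    ≡⟨ cong (λ z → (truncate o x + z) >> o) (*-comm (2 ^ o) _) ⟩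
  (truncate o x + truncate v (x >> o) * 2 ^ o) >> o
    ≡⟨ +-distrib-/ (truncate o x) (truncate v (x >> o) * 2 ^ o) (no-carry (truncate o x) (truncate v (x >> o)) (2 ^ o)) ⟩
  truncate o x >> o + (truncate v (x >> o) * 2 ^ o) >> o
    ≡⟨ cong₂ _+_ (<2^⇒>>≡0 {n = o} (truncate-< o x)) (m*n/n≡m (truncate v (x >> o)) (2 ^ o)) ⟩
  truncate v (x >> o) ∎
  where
  open ≡-Reasoning
  instance _ = 2^≢0 o

-- A word that straddles two consecutive words of x.
straddle : ∀ {w} o → o < w → ∀ x →
           truncate w x >> o + truncate w (truncate w (x >> w) * 2 ^ (w ∸ o)) ≡
           truncate w (x >> o)
straddle {w} o o<w x = begin
  truncate w x >> o + truncate w (truncate w (x >> w) * 2 ^ v) ≡⟨ cong₂ _+_ first second ⟩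
  truncate v (x >> o) + 2 ^ v * truncate o (x >> o >> v)       ≡⟨ sym (truncate-+ v o (x >> o)) ⟩
  truncate (v + o) (x >> o)                                    ≡⟨ cong (λ z → truncate z (x >> o)) (m∸n+n≡m (<⇒≤ o<w)) ⟩
  truncate w (x >> o)                                          ∎
  where
  open ≡-Reasoning
  v = w ∸ o
  o+v : o + v ≡ w
  o+v = m+[n∸m]≡n (<⇒≤ o<w)
  first : truncate w x >> o ≡ truncate v (x >> o)
  first = trans (cong (λ z → truncate z x >> o) (sym o+v)) (truncate->> o v x)
  instance
    _ = 2^≢0 o
    _ = 2^≢0 v
    _ = 2^≢0 w
    _ = m*n≢0 (2 ^ o) (2 ^ v)
  y = truncate w (x >> w)
  -- Shifting left by `v` modulo `2 ^ w` keeps exactly the `o` lowest bits of the next word. For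
  -- `o ≡ 0` it keeps none, so the aligned case is included.
  second : truncate w (y * 2 ^ v) ≡ 2 ^ v * truncate o (x >> o >> v)
  second = begin
    truncate w (y * 2 ^ v)
      ≡⟨ %-cong-≡ {m = 2 ^ w} {2 ^ o * 2 ^ v} refl (trans (cong (2 ^_) (sym o+v)) (^-distribˡ-+-* 2 o v)) ⟩
    (y * 2 ^ v) % (2 ^ o * 2 ^ v) ≡⟨ sym (m%n*o≡m*o%[n*o] y (2 ^ o) (2 ^ v)) ⟩
    truncate o y * 2 ^ v          ≡⟨ cong (_* 2 ^ v) (truncate-low (x >> w) (<⇒≤ o<w)) ⟩
    truncate o (x >> w) * 2 ^ v   ≡⟨ *-comm _ (2 ^ v) ⟩
    2 ^ v * truncate o (x >> w)   ≡⟨ cong (λ z → 2 ^ v * truncate o (x >> z)) (sym o+v) ⟩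
    2 ^ v * truncate o (x >> (o + v)) ≡⟨ cong (λ z → 2 ^ v * truncate o z) (>>-+ x o v) ⟩
    2 ^ v * truncate o (x >> o >> v) ∎

-- As the earlier bits of a string are less significant, reversing the w low bits
-- turns lexicographic into numerical order.
rev : ℕ → ℕ → ℕ
rev zero    x = 0
rev (suc w) x = x % 2 * 2 ^ w + rev w (x / 2)

rev-< : ∀ w x → rev w x < 2 ^ w
rev-< zero    x = s≤s z≤n
rev-< (suc w) x = begin-strict
  x % 2 * 2 ^ w + rev w (x / 2) <⟨ +-mono-≤-< (*-monoˡ-≤ (2 ^ w) (s≤s⁻¹ (m%n<n x 2))) (rev-< w (x / 2)) ⟩
  1 * 2 ^ w + 2 ^ w             ≡⟨ cong₂ _+_ (*-identityˡ (2 ^ w)) (sym (+-identityʳ (2 ^ w))) ⟩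
  2 ^ suc w                     ∎
  where open ≤-Reasoning

rev-0 : ∀ w → rev w 0 ≡ 0
rev-0 zero    = refl
rev-0 (suc w) = rev-0 w

rev-+ : ∀ a b x → rev (a + b) x ≡ rev a x * 2 ^ b + rev b (x >> a)
rev-+ zero    b x = cong (rev b) (sym (>>0 x))
rev-+ (suc a) b x = begin
  x % 2 * 2 ^ (a + b) + rev (a + b) (x / 2)
    ≡⟨ cong₂ (λ y z → x % 2 * y + z) (^-distribˡ-+-* 2 a b) (rev-+ a b (x / 2)) ⟩
  x % 2 * (2 ^ a * 2 ^ b) + (rev a (x / 2) * 2 ^ b + rev b ((x / 2) >> a))
    ≡⟨ regroup (x % 2) (2 ^ a) (2 ^ b) (rev a (x / 2)) _ ⟩
  (x % 2 * 2 ^ a + rev a (x / 2)) * 2 ^ b + rev b ((x / 2) >> a)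
    ≡⟨ cong (λ z → (x % 2 * 2 ^ a + rev a (x / 2)) * 2 ^ b + rev b z) (sym (>>-suc x a)) ⟩
  rev (suc a) x * 2 ^ b + rev b (x >> suc a) ∎
  where
  open ≡-Reasoning
  regroup : ∀ d p q r s → d * (p * q) + (r * q + s) ≡ (d * p + r) * q + s
  regroup = solve-∀

rev-truncate : ∀ {v w} x → v ≤ w → rev v (truncate w x) ≡ rev v x
rev-truncate {zero}          x _         = refl
rev-truncate {suc v} {suc w} x (s≤s v≤w) = cong₂ (λ y z → y * 2 ^ v + z)
  (truncate-low {1} {suc w} x (s≤s z≤n))
  (trans (cong (rev v) (truncate->> 1 w x)) (rev-truncate (x / 2) v≤w))

-- The `v` lowest bits of `x` lead after the reversal, and dropping the last `w ∸ v` bits leaves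
-- just these.
rev->> : ∀ {w} v x → v ≤ w → rev w x >> (w ∸ v) ≡ rev v x
rev->> {w} v x v≤w = begin
  rev w x >> u                            ≡⟨ cong (λ z → rev z x >> u) (sym (m+[n∸m]≡n v≤w)) ⟩
  rev (v + u) x >> u                      ≡⟨ cong (_>> u) (trans (rev-+ v u x) (+-comm _ (rev u (x >> v)))) ⟩
  (rev u (x >> v) + rev v x * 2 ^ u) >> u ≡⟨ +-distrib-/ (rev u (x >> v)) _ (no-carry (rev u (x >> v)) (rev v x) (2 ^ u)) ⟩
  rev u (x >> v) >> u + (rev v x * 2 ^ u) >> u
    ≡⟨ cong₂ _+_ (<2^⇒>>≡0 {n = u} (rev-< u _)) (m*n/n≡m (rev v x) (2 ^ u)) ⟩
  rev v x                                 ∎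
  where
  open ≡-Reasoning
  u = w ∸ v
  instance _ = 2^≢0 u

-- The recurrence behind `reverseDigit`: the lowest digit becomes the leading one, and the reversed
-- other digits move down by `b` places to make room for it.
rev-horner : ∀ {w b x} → b ≤ w → x < 2 ^ w →
             rev w x ≡ rev b (truncate b x) * 2 ^ (w ∸ b) + rev w (x >> b) >> b
rev-horner {w} {b} {x} b≤w x< = begin
  rev w x                                  ≡⟨ cong (λ z → rev z x) (sym b+v) ⟩
  rev (b + v) x                            ≡⟨ rev-+ b v x ⟩
  rev b x * 2 ^ v + rev v (x >> b)         ≡⟨ cong₂ (λ y z → y * 2 ^ v + z) (sym (rev-truncate {b} {b} x ≤-refl)) (sym low) ⟩
  rev b (truncate b x) * 2 ^ v + rev w (x >> b) >> b ∎
  where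
  open ≡-Reasoning
  v = w ∸ b
  b+v : b + v ≡ w
  b+v = m+[n∸m]≡n b≤w
  low : rev w (x >> b) >> b ≡ rev v (x >> b)
  low = trans (cong (rev w (x >> b) >>_) (trans (sym (m+n∸n≡m b v)) (cong (_∸ v) b+v)))
              (rev->> v (x >> b) (≤-trans (m≤n+m v b) (≤-reflexive b+v)))

-- The recurrence by which `tableStep` fills the table: the entry at `x` is obtained from the
-- earlier one at `x / 2`.
rev-half : ∀ b x → x < 2 ^ suc b →
           rev (suc b) x ≡ x % 2 * 2 ^ b + rev (suc b) (x / 2) / 2
rev-half b x x< = trans (rev-horner {suc b} {1} (s≤s z≤n) x<)
  (cong (λ z → z * 2 ^ b + rev (suc b) (x / 2) / 2)
    (trans (cong (λ z → z * 1 + 0) (m%n%n≡m%n x 2)) (trans (+-identityʳ (x % 2 * 1)) (*-identityʳ (x % 2)))))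

bit-+2*-% : ∀ c x → (bit c + 2 * x) % 2 ≡ bit c
bit-+2*-% false x = trans (cong (_% 2) (*-comm 2 x)) (m*n%n≡0 x 2)
bit-+2*-% true  x = trans (cong (λ z → (1 + z) % 2) (*-comm 2 x)) ([m+kn]%n≡m%n 1 x 2)

bit-+2*-/ : ∀ c x → (bit c + 2 * x) / 2 ≡ x
bit-+2*-/ false x = trans (cong (_/ 2) (*-comm 2 x)) (m*n/n≡m x 2)
bit-+2*-/ true  x = trans (cong (λ z → (1 + z) / 2) (*-comm 2 x))
  (trans (+-distrib-/ 1 (x * 2) (no-carry 1 x 2)) (m*n/n≡m x 2))

fromBits-drop : ∀ j xs → fromBits (drop j xs) ≡ fromBits xs >> j
fromBits-drop zero    xs       = sym (>>0 _)
fromBits-drop (suc j) []       = sym (0>> (suc j))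
fromBits-drop (suc j) (c ∷ xs) = begin
  fromBits (drop j xs)                ≡⟨ fromBits-drop j xs ⟩
  fromBits xs >> j                    ≡⟨ cong (_>> j) (sym (bit-+2*-/ c (fromBits xs))) ⟩
  ((bit c + 2 * fromBits xs) / 2) >> j ≡⟨ sym (>>-suc _ j) ⟩
  (bit c + 2 * fromBits xs) >> suc j  ∎
  where open ≡-Reasoning

fromBits-take : ∀ v xs → fromBits (take v xs) ≡ truncate v (fromBits xs)
fromBits-take zero    xs       = sym (n%1≡0 (fromBits xs))
fromBits-take (suc v) []       = sym (m<n⇒m%n≡m ⦃ 2^≢0 (suc v) ⦄ (1≤2^ (suc v)))
fromBits-take (suc v) (c ∷ xs) = begin
  bit c + 2 * fromBits (take v xs) ≡⟨ cong₂ (λ y z → y + 2 * z) (sym (bit-+2*-% c x)) (fromBits-take v xs) ⟩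
  (bit c + 2 * x) % 2 + 2 * truncate v x
    ≡⟨ cong (λ z → (bit c + 2 * x) % 2 + 2 * truncate v z) (sym (bit-+2*-/ c x)) ⟩
  (bit c + 2 * x) % 2 + 2 * truncate v ((bit c + 2 * x) / 2) ≡⟨ sym (truncate-+ 1 v (bit c + 2 * x)) ⟩
  truncate (suc v) (bit c + 2 * x) ∎
  where
  open ≡-Reasoning
  x = fromBits xs

fromBits-< : ∀ xs → fromBits xs < 2 ^ length xs
fromBits-< []           = s≤s z≤n
fromBits-< (c ∷ xs) = begin-strict
  bit c + 2 * fromBits xs <⟨ s≤s (+-monoˡ-≤ _ (bit≤1 c)) ⟩
  2 + 2 * fromBits xs     ≡⟨ sym (*-suc 2 (fromBits xs)) ⟩
  2 * suc (fromBits xs)   ≤⟨ *-monoʳ-≤ 2 (fromBits-< xs) ⟩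
  2 ^ suc (length xs)     ∎
  where
  open ≤-Reasoning
  bit≤1 : ∀ c → bit c ≤ 1
  bit≤1 false = z≤n
  bit≤1 true  = ≤-refl

-- The first m bits of a string, padded with 0s, as a binary numeral.
key : ℕ → List Bool → ℕ
key m xs = rev m (fromBits xs)

key-∷ : ∀ m c xs → key (suc m) (c ∷ xs) ≡ bit c * 2 ^ m + key m xs
key-∷ m c xs = cong₂ (λ y z → y * 2 ^ m + rev m z) (bit-+2*-% c (fromBits xs)) (bit-+2*-/ c (fromBits xs))

key-< : ∀ m xs → key m xs < 2 ^ m
key-< m xs = rev-< m (fromBits xs)

key-lead : ∀ m xs ys → key (suc m) (false ∷ xs) < key (suc m) (true ∷ ys)
key-lead m xs ys rewrite key-∷ m false xs | key-∷ m true ys | +-identityʳ (2 ^ m) =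
  <-≤-trans (key-< m xs) (m≤m+n _ _)

-- Padding can identify two strings but cannot reverse their order: a string that has ended
-- contributes 0s from there on, and it is also the lexicographically smaller one.
key-reflects-< : ∀ m xs ys → key m ys < key m xs → ys <ₗ xs
key-reflects-< zero    xs       ys       ()
key-reflects-< (suc m) []       ys       k< rewrite rev-0 (suc m) = ⊥-elim (n≮0 k<)
key-reflects-< (suc m) (c ∷ xs) []       k< = halt
key-reflects-< (suc m) (false ∷ xs) (true ∷ ys) k< = ⊥-elim (<-asym k< (key-lead m xs ys))
key-reflects-< (suc m) (true ∷ xs) (false ∷ ys) k< = this Bool.f<t
key-reflects-< (suc m) (false ∷ xs) (false ∷ ys) k<
  rewrite key-∷ m false xs | key-∷ m false ys = next refl (key-reflects-< m xs ys k<)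
key-reflects-< (suc m) (true ∷ xs) (true ∷ ys) k<
  rewrite key-∷ m true xs | key-∷ m true ys =
  next refl (key-reflects-< m xs ys (+-cancelˡ-< (1 * 2 ^ m) _ _ k<))

key-tail : ∀ m c xs d ys → key (suc m) (c ∷ xs) ≡ key (suc m) (d ∷ ys) → c ≡ d × key m xs ≡ key m ys
key-tail m false xs false ys k≡ rewrite key-∷ m false xs | key-∷ m false ys = refl , k≡
key-tail m true  xs true  ys k≡ rewrite key-∷ m true xs | key-∷ m true ys =
  refl , +-cancelˡ-≡ (1 * 2 ^ m) _ _ k≡
key-tail m false xs true  ys k≡ = ⊥-elim (<⇒≢ (key-lead m xs ys) k≡)
key-tail m true  xs false ys k≡ = ⊥-elim (<⇒≢ (key-lead m ys xs) (sym k≡))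

-- Equal keys force `ys` to agree with `xs` as far as it reaches, which is less than `m` bits; so
-- `ys` is a proper prefix of `xs`.
shorter-< : ∀ m xs ys → length ys < m → m ≤ length xs → key m xs ≡ key m ys → ys <ₗ xs
shorter-< (suc m) (c ∷ xs) []       _         _         _  = halt
shorter-< (suc m) (c ∷ xs) (d ∷ ys) (s≤s ys<) (s≤s ≤xs) k≡ with key-tail m c xs d ys k≡
... | refl , k≡′ = next refl (shorter-< m xs ys ys< ≤xs k≡′)

prefix⇒key : ∀ xs ys → Prefix _≡_ xs ys → key (length xs) xs ≡ key (length xs) ys × length xs ≤ length ys
prefix⇒key []       ys       []           = refl , z≤n
prefix⇒key (c ∷ xs) (_ ∷ ys) (refl ∷ pre) with prefix⇒key xs ys pre
... | k≡ , ≤ys rewrite key-∷ (length xs) c xs | key-∷ (length xs) c ys = cong (_ +_) k≡ , s≤s ≤ys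

key⇒prefix : ∀ xs ys → length xs ≤ length ys → key (length xs) xs ≡ key (length xs) ys → Prefix _≡_ xs ys
key⇒prefix []       ys       _         _  = []
key⇒prefix (c ∷ xs) (d ∷ ys) (s≤s ≤ys) k≡ with key-tail (length xs) c xs d ys k≡
... | refl , k≡′ = refl ∷ key⇒prefix xs ys ≤ys k≡′

-- The condition on lengths rules out suffixes that agree with the pattern only thanks to the
-- padding.
MatchAt : List Bool → List Bool → ℕ → Set
MatchAt xs ys j = j + length xs ≤ length ys × key (length xs) (drop j ys) ≡ key (length xs) xs

infix⇒match : ∀ {xs ys} → Infix _≡_ xs ys → ∃[ j ] MatchAt xs ys j
infix⇒match {xs} {ys} (here pre) with prefix⇒key xs ys pre
... | k≡ , ≤ys = 0 , ≤ys , sym k≡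
infix⇒match (there inf) with infix⇒match inf
... | j , ≤ys , k≡ = suc j , s≤s ≤ys , k≡

match⇒infix : ∀ {xs ys} j → MatchAt xs ys j → Infix _≡_ xs ys
match⇒infix {xs} {ys}     zero    (≤ys , k≡)     = here (key⇒prefix xs ys ≤ys (sym k≡))
match⇒infix {xs} {c ∷ ys} (suc j) (s≤s ≤ys , k≡) = there (match⇒infix j (≤ys , k≡))

-- Lexicographic order and ranks

<ₗ-irrefl : ∀ xs → ¬ (xs <ₗ xs)
<ₗ-irrefl (false ∷ xs) (this ())
<ₗ-irrefl (true ∷ xs)  (this ())
<ₗ-irrefl (c ∷ xs)     (next _ xs<xs) = <ₗ-irrefl xs xs<xs
<ₗ-irrefl []           (base ())

<ₗ-trans : ∀ {xs ys zs} → xs <ₗ ys → ys <ₗ zs → xs <ₗ zs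
<ₗ-trans halt           (this _)       = halt
<ₗ-trans halt           (next _ _)     = halt
<ₗ-trans (this Bool.f<t) (this ())
<ₗ-trans (this p)       (next refl _)  = this p
<ₗ-trans (next refl _)  (this q)       = this q
<ₗ-trans (next refl p)  (next refl q)  = next refl (<ₗ-trans p q)
<ₗ-trans (base ())      _

length-filter-< : ∀ {A : Set} {P Q : A → Set} (P? : ∀ x → Dec (P x)) (Q? : ∀ x → Dec (Q x)) →
                  (∀ {x} → P x → Q x) → ∀ {z} xs → z ∈ xs → Q z → ¬ P z →
                  length (filter P? xs) < length (filter Q? xs)
length-filter-< {P = P} {Q} P? Q? P⇒Q = strict
  where
  weak : ∀ xs → length (filter P? xs) ≤ length (filter Q? xs)
  weak []       = z≤n
  weak (x ∷ xs) with P? x | Q? x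
  ... | yes p | yes q = s≤s (weak xs)
  ... | yes p | no ¬q = ⊥-elim (¬q (P⇒Q p))
  ... | no ¬p | yes q = m≤n⇒m≤1+n (weak xs)
  ... | no ¬p | no ¬q = weak xs
  strict : ∀ {z} xs → z ∈ xs → Q z → ¬ P z → length (filter P? xs) < length (filter Q? xs)
  strict (x ∷ xs) z∈ qz ¬pz with P? x | Q? x
  strict (x ∷ xs) (ListAny.here refl) qz ¬pz | yes p | _     = ⊥-elim (¬pz p)
  strict (x ∷ xs) (ListAny.here refl) qz ¬pz | no ¬p | yes q = s≤s (weak xs)
  strict (x ∷ xs) (ListAny.here refl) qz ¬pz | no ¬p | no ¬q = ⊥-elim (¬q qz)
  strict (x ∷ xs) (ListAny.there z∈) qz ¬pz | yes p | yes q = s≤s (strict xs z∈ qz ¬pz)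
  strict (x ∷ xs) (ListAny.there z∈) qz ¬pz | yes p | no ¬q = ⊥-elim (¬q (P⇒Q p))
  strict (x ∷ xs) (ListAny.there z∈) qz ¬pz | no ¬p | yes q = m≤n⇒m≤1+n (strict xs z∈ qz ¬pz)
  strict (x ∷ xs) (ListAny.there z∈) qz ¬pz | no ¬p | no ¬q = strict xs z∈ qz ¬pz

module _ {n} (T : BitString n) where

  private
    positions : List ℕ
    positions = map suc (upTo n)

    position : ∀ {j} → 1 ≤ j → j ≤ n → j ∈ positions
    position {suc j} _ j≤n = ∈-map⁺ suc (∈-upTo⁺ j≤n)

  -- Whatever is below suffix `i` is below suffix `j`, and suffix `i` itself is counted for `j`
  -- only.
  rank-mono-< : ∀ {i j} → 1 ≤ i → i ≤ n → suffix T i <ₗ suffix T j → rank T i < rank T j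
  rank-mono-< {i} {j} 1≤i i≤n i<j =
    s≤s (length-filter-< (λ x → suffix T x <ₗ? suffix T i) (λ x → suffix T x <ₗ? suffix T j)
      (λ x<i → <ₗ-trans x<i i<j) positions (position 1≤i i≤n) i<j (<ₗ-irrefl _))

  rank-≤ : ∀ {j} → 1 ≤ j → j ≤ n → rank T j ≤ n
  rank-≤ {j} 1≤j j≤n = begin
    rank T j ≤⟨ length-filter-< (λ x → suffix T x <ₗ? suffix T j) (λ _ → yes tt) (λ _ → tt)
                  positions (position 1≤j j≤n) tt (<ₗ-irrefl _) ⟩
    length (filter (λ _ → yes tt) positions) ≤⟨ length-filter (λ _ → yes tt) positions ⟩
    length positions ≡⟨ trans (length-map suc (upTo n)) (length-upTo n) ⟩
    n ∎
    where open ≤-Reasoning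

  rank-key-mono : ∀ m {i j} → 1 ≤ j → j ≤ n → rank T i ≤ rank T j →
                  key m (suffix T i) ≤ key m (suffix T j)
  rank-key-mono m {i} {j} 1≤j j≤n r≤ =
    ≮⇒≥ (λ k< → <⇒≱ (rank-mono-< {j} {i} 1≤j j≤n (key-reflects-< m (suffix T i) (suffix T j) k<)) r≤)

-- Reading the input

contents-beyond : ∀ xs {q} → length xs ≤ q → contents xs q ≡ 0
contents-beyond []       _         = refl
contents-beyond (x ∷ xs) (s≤s xs≤) = contents-beyond xs xs≤

contents-map-upTo : ∀ f n {q} → q < n → contents (map f (upTo n)) q ≡ f q
contents-map-upTo f n q< = go (λ x → x) n q<
  where
  go : ∀ g n {q} → q < n → contents (map f (applyUpTo g n)) q ≡ f (g q)
  go g (suc n) {zero}  _        = refl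
  go g (suc n) {suc q} (s≤s q<) = go (g ∘ suc) n q<

contents-map : ∀ {A : Set} (g : A → ℕ) (f : ℕ → ℕ) → f 0 ≡ 0 → ∀ xs i →
               contents (map (f ∘ g) xs) i ≡ f (contents (map g xs) i)
contents-map g f f0 []       i       = sym f0
contents-map g f f0 (x ∷ xs) zero    = refl
contents-map g f f0 (x ∷ xs) (suc i) = contents-map g f f0 xs i

contents-++ˡ : ∀ xs ys {i} → i < length xs → contents (xs ++ ys) i ≡ contents xs i
contents-++ˡ (x ∷ xs) ys {zero}  _        = refl
contents-++ˡ (x ∷ xs) ys {suc i} (s≤s i<) = contents-++ˡ xs ys i<

contents-++ʳ : ∀ xs ys i → contents (xs ++ ys) (length xs + i) ≡ contents ys i
contents-++ʳ []       ys i = refl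
contents-++ʳ (x ∷ xs) ys i = contents-++ʳ xs ys i

contents-concatMap : ∀ {A : Set} (f : A → List ℕ) {l} → (∀ x → length (f x) ≡ l) →
                     ∀ xs i {t} → t < l →
                     contents (concatMap f xs) (i * l + t) ≡
                     contents (map (λ x → contents (f x) t) xs) i
contents-concatMap f {l} len []       i       t< = refl
contents-concatMap f {l} len (x ∷ xs) zero    {t} t< =
  contents-++ˡ (f x) _ (<-≤-trans t< (≤-reflexive (sym (len x))))
contents-concatMap f {l} len (x ∷ xs) (suc i) {t} t< = begin
  contents (f x ++ concatMap f xs) (l + i * l + t)
    ≡⟨ cong (contents (f x ++ concatMap f xs)) (trans (+-assoc l (i * l) t) (cong (_+ (i * l + t)) (sym (len x)))) ⟩
  contents (f x ++ concatMap f xs) (length (f x) + (i * l + t))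
    ≡⟨ contents-++ʳ (f x) _ _ ⟩
  contents (concatMap f xs) (i * l + t)
    ≡⟨ contents-concatMap f len xs i t< ⟩
  contents (map (λ x → contents (f x) t) xs) i ∎
  where open ≡-Reasoning

value : ∀ {n} → BitString n → ℕ
value T = fromBits (toList T)

value-< : ∀ {n} (T : BitString n) → value T < 2 ^ n
value-< T = subst (λ l → value T < 2 ^ l) (Vec.length-toList T) (fromBits-< (toList T))

≤⌈÷⌉* : ∀ n v → n ≤ ⌈ n ÷ suc v ⌉ * suc v
≤⌈÷⌉* n v = +-cancelˡ-≤ v n _ (begin
  v + n                                             ≡⟨ +-comm v n ⟩
  n + v                                             ≡⟨ m≡m%n+[m/n]*n (n + v) (suc v) ⟩
  (n + v) % suc v + ⌈ n ÷ suc v ⌉ * suc v ≤⟨ +-monoˡ-≤ _ (s≤s⁻¹ (m%n<n (n + v) (suc v))) ⟩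
  v + ⌈ n ÷ suc v ⌉ * suc v                         ∎)
  where open ≤-Reasoning

length-packed : ∀ {n} w (T : BitString n) → length (packed w T) ≡ ⌈ n ÷ w ⌉
length-packed {n} w T = trans (length-map _ (upTo ⌈ n ÷ w ⌉)) (length-upTo _)

-- There is no bound on `q`: beyond the text both sides are 0. This is what allows `textWord` to
-- read a word past the end of the text.
packed-contents : ∀ {n} v (T : BitString n) q →
                  contents (packed (suc v) T) q ≡ truncate (suc v) (value T >> (q * suc v))
packed-contents {n} v T q with q <? ⌈ n ÷ suc v ⌉
... | yes q< = begin
  contents (packed w T) q ≡⟨ contents-map-upTo _ ⌈ n ÷ w ⌉ q< ⟩
  fromBits (take w (drop (q * w) (toList T))) ≡⟨ fromBits-take w (drop (q * w) (toList T)) ⟩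
  truncate w (fromBits (drop (q * w) (toList T))) ≡⟨ cong (truncate w) (fromBits-drop (q * w) _) ⟩
  truncate w (value T >> (q * w)) ∎
  where
  open ≡-Reasoning
  w = suc v
... | no q≮ = begin
  contents (packed w T) q ≡⟨ contents-beyond (packed w T) (≤-trans (≤-reflexive (length-packed w T)) (≮⇒≥ q≮)) ⟩
  0                       ≡⟨ sym (m<n⇒m%n≡m ⦃ 2^≢0 w ⦄ (1≤2^ w)) ⟩
  truncate w 0            ≡⟨ cong (truncate w) (sym (<2^⇒>>≡0 {n = q * w} small)) ⟩
  truncate w (value T >> (q * w)) ∎
  where
  open ≡-Reasoning
  w = suc v
  small : value T < 2 ^ (q * w)
  small = <-≤-trans (value-< T) (^-monoʳ-≤ 2 (≤-trans (≤⌈÷⌉* n v) (*-monoˡ-≤ w (≮⇒≥ q≮))))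

pattern′ : ∀ {k m} → Vec (BitString m) k → ℕ → ℕ
pattern′ D = contents (map value (toList D))

pattern-< : ∀ {k m} (D : Vec (BitString m) k) i → pattern′ D i < 2 ^ m
pattern-< {m = m} []      i       = 1≤2^ m
pattern-< (P ∷ D) zero    = value-< P
pattern-< (P ∷ D) (suc i) = pattern-< D i

patterns-contents : ∀ {k m} v (D : Vec (BitString m) k) i {t} → t < ⌈ m ÷ suc v ⌉ →
                    contents (concatMap (packed (suc v)) (toList D)) (i * ⌈ m ÷ suc v ⌉ + t) ≡
                    truncate (suc v) (pattern′ D i >> (t * suc v))
patterns-contents {m = m} v D i {t} t< = begin
  contents (concatMap (packed w) (toList D)) (i * ⌈ m ÷ w ⌉ + t)
    ≡⟨ contents-concatMap (packed w) (length-packed w) (toList D) i t< ⟩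
  contents (map (λ P → contents (packed w P) t) (toList D)) i
    ≡⟨ cong (λ xs → contents xs i) (map-cong (λ P → packed-contents v P t) (toList D)) ⟩
  contents (map (λ P → truncate w (value P >> (t * w))) (toList D)) i
    ≡⟨ contents-map value (λ x → truncate w (x >> (t * w)))
         (trans (cong (truncate w) (0>> (t * w))) (m<n⇒m%n≡m ⦃ 2^≢0 w ⦄ (1≤2^ w))) (toList D) i ⟩
  truncate w (pattern′ D i >> (t * w)) ∎
  where
  open ≡-Reasoning
  w = suc v

-- Occurrences and suffix ranks

-- Here `j` is an offset counted from 0, one less than the position of the suffix.
Match : ∀ {n k m} → BitString n → Vec (BitString m) k → ℕ → ℕ → Set
Match {n} {k} {m} T D i j = j + m ≤ n × rev m (value T >> j) ≡ rev m (pattern′ D i)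

match-head : ∀ {n k m} (T : BitString n) (P : BitString m) (D : Vec (BitString m) k) {j} →
             MatchAt (toList P) (toList T) j → Match T (P ∷ D) 0 j
match-head T P D {j} (j≤ , k≡)
  rewrite Vec.length-toList P | Vec.length-toList T | fromBits-drop j (toList T) = j≤ , k≡

head-match : ∀ {n k m} (T : BitString n) (P : BitString m) (D : Vec (BitString m) k) {j} →
             Match T (P ∷ D) 0 j → MatchAt (toList P) (toList T) j
head-match T P D {j} (j≤ , k≡)
  rewrite Vec.length-toList P | Vec.length-toList T | fromBits-drop j (toList T) = j≤ , k≡

any⇒match : ∀ {n k m} (T : BitString n) (D : Vec (BitString m) k) →
            Any (λ P → Occurs P T) D → ∃[ i ] i < k × ∃[ j ] Match T D i j
any⇒match T (P ∷ D) (here occ) with infix⇒match occ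
... | j , match = 0 , s≤s z≤n , j , match-head T P D match
any⇒match T (P ∷ D) (there any) with any⇒match T D any
... | i , i< , j , match = suc i , s≤s i< , j , match

match⇒any : ∀ {n k m} (T : BitString n) (D : Vec (BitString m) k) →
            ∀ {i j} → i < k → Match T D i j → Any (λ P → Occurs P T) D
match⇒any T (P ∷ D) {zero}  _        match = here (match⇒infix _ (head-match T P D match))
match⇒any T (P ∷ D) {suc i} (s≤s i<) match = there (match⇒any T D i< match)

suffixKey : ∀ {n} → ℕ → BitString n → ℕ → ℕ
suffixKey m T j = rev m (value T >> (j ∸ 1))

suffixKey-key : ∀ {n} m (T : BitString n) j → suffixKey m T j ≡ key m (suffix T j)
suffixKey-key m T j = cong (rev m) (sym (fromBits-drop (j ∸ 1) (toList T)))

suffixKey-mono : ∀ {n} m (T : BitString n) {i j} → 1 ≤ j → j ≤ n → rank T i ≤ rank T j →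
                 suffixKey m T i ≤ suffixKey m T j
suffixKey-mono m T {i} {j} 1≤j j≤n r≤ =
  subst₂ _≤_ (sym (suffixKey-key m T i)) (sym (suffixKey-key m T j)) (rank-key-mono T m {i} {j} 1≤j j≤n r≤)

-- Among the suffixes that agree with a pattern after padding, those too short
-- to contain it have the lowest ranks.
full-suffix : ∀ {n} m (T : BitString n) {i j} → 1 ≤ j → j ≤ n → rank T i ≤ rank T j →
              suffixKey m T i ≡ suffixKey m T j → (i ∸ 1) + m ≤ n → (j ∸ 1) + m ≤ n
full-suffix {n} m T {i} {j} 1≤j j≤n r≤ k≡ i≤ = ≮⇒≥ λ n< →
  <⇒≱ (rank-mono-< T {j} {i} 1≤j j≤n (shorter-< m (suffix T i) (suffix T j)
        (subst (_< m) (sym (len j)) (+-cancelˡ-< (j ∸ 1) _ _ (subst (_< (j ∸ 1) + m) (sym (m+[n∸m]≡n (≤-trans (m∸n≤m j 1) j≤n))) n<)))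
        (subst (m ≤_) (sym (len i)) (≤-trans (≤-reflexive (sym (m+n∸m≡n (i ∸ 1) m))) (∸-monoˡ-≤ (i ∸ 1) i≤)))
        (trans (sym (suffixKey-key m T i)) (trans k≡ (suffixKey-key m T j))))) r≤
  where
  len : ∀ x → length (suffix T x) ≡ n ∸ (x ∸ 1)
  len x = trans (length-drop (x ∸ 1) (toList T)) (cong (_∸ (x ∸ 1)) (Vec.length-toList T))

-- Comparing a pattern with a suffix

record Instance : Set where
  field
    v n k m b E : ℕ
    T    : BitString n
    D    : Vec (BitString m) k
    1≤v  : 1 ≤ v
    n<   : n < 2 ^ suc v
    1≤m  : 1 ≤ m
    m≤n  : m ≤ n
    1≤b  : 1 ≤ b
    b<w  : b < suc v
    2^E≤w : 2 ^ E ≤ suc v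
    fits : k * suc ((m ∸ 1) / suc v) < 2 ^ suc v

  w : ℕ
  w = suc v

  words pad digits : ℕ
  words  = suc ((m ∸ 1) / w)
  pad    = v ∸ (m ∸ 1) % w
  digits = suc (_/_ w b ⦃ >-nonZero 1≤b ⦄)

  key-of : ℕ → ℕ
  key-of i = rev m (pattern′ D i)

rN rK rM rOne rW rB rBase rLen rPad rStride rTop rLo rCount rPos rRank rPat : ℕ
rLe rEq rAt rWord rX rR rTmp rI rOff rDrop rT rU rV rStep rZero rDigits rFound rCo : ℕ
rN      = 0
rK      = 1
rM      = 2
rOne    = 3
rW      = 4
rB      = 5
rBase   = 6
rLen    = 7
rPad    = 8
rStride = 9
rTop    = 10
rLo     = 11
rCount  = 12
rPos    = 13
rRank   = 14
rPat    = 15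
rLe     = 16
rEq     = 17
rAt     = 18
rWord   = 19
rX      = 20
rR      = 21
rTmp    = 22
rI      = 23
rOff    = 24
rDrop   = 25
rT      = 26
rU      = 27
rV      = 28
rStep   = 29
rZero   = 30
rDigits = 31
rFound  = 32
rCo     = 33

-- Segments 0 and 1 keep the input and 2 a table of reversed digits.  The sorted
-- order of the patterns is in 3; the buckets of a sorting pass are linked lists
-- with values in 4, links in 5 and heads in 6.

-- These are the parameters, which the setup computes once: `rN` to `rTop`, `rZero` and `rDigits`.
protectedReg : ℕ → Bool
protectedReg r = (r ≤ᵇ 10) ∨ ((r ≡ᵇ 30) ∨ (r ≡ᵇ 31))

protectedMem : ℕ → Bool
protectedMem b = b ≤ᵇ 2

-- Frame conditions for whole sets of registers and segments. A program that contains the query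
-- program, which is a variable, does not reduce to `true` here by itself; `avoids-shift` supplies
-- that part.
avoids : (f g : ℕ → Bool) → Program → Bool
avoids f g skip          = true
avoids f g (const r k)   = Bool.not (f r)
avoids f g (op o r s t)  = Bool.not (f r)
avoids f g (load r b s)  = Bool.not (f r)
avoids f g (store b s t) = Bool.not (g b)
avoids f g (p ⨾ q)       = avoids f g p Bool.∧ avoids f g q
avoids f g (ifnz r p q)  = avoids f g p Bool.∧ avoids f g q
avoids f g (while r p)   = avoids f g p

∧-true : ∀ {a b} → a Bool.∧ b ≡ true → a ≡ true × b ≡ true
∧-true {true} {true} _ = refl , refl

record Fixed (f g : ℕ → Bool) (σ τ : State) : Set where
  constructor fixes
  field
    fixedReg : ∀ r → f r ≡ true → reg τ r ≡ reg σ r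
    fixedMem : ∀ b → g b ≡ true → ∀ a → mem τ b a ≡ mem σ b a

open Fixed public

module _ {f g : ℕ → Bool} where

  private
    distinct : ∀ (f : ℕ → Bool) x y → Bool.not (f y) ≡ true → f x ≡ true → (x ≡ᵇ y) ≡ false
    distinct f x y ¬fy fx = ≢⇒≡ᵇ-false {x} {y} λ { refl → case trans (sym ¬fy) (cong Bool.not fx) of λ () }

  avoids-regs : ∀ p {x} → avoids f g p ≡ true → f x ≡ true → writesReg p x ≡ false
  avoids-regs skip          s fx = refl
  avoids-regs (const r k) {x} s fx = distinct f x r s fx
  avoids-regs (op o r _ t) {x} s fx = distinct f x r s fx
  avoids-regs (load r b _) {x} s fx = distinct f x r s fx
  avoids-regs (store b _ t) s fx = refl
  avoids-regs (p ⨾ q)       s fx = ∨-falseⁱ (avoids-regs p (proj₁ (∧-true s)) fx) (avoids-regs q (proj₂ (∧-true s)) fx)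
  avoids-regs (ifnz r p q)  s fx = ∨-falseⁱ (avoids-regs p (proj₁ (∧-true s)) fx) (avoids-regs q (proj₂ (∧-true s)) fx)
  avoids-regs (while r p)   s fx = avoids-regs p s fx

  avoids-mems : ∀ p {x} → avoids f g p ≡ true → g x ≡ true → writesMem p x ≡ false
  avoids-mems skip          s gx = refl
  avoids-mems (const r k)   s gx = refl
  avoids-mems (op o r _ t)  s gx = refl
  avoids-mems (load r b _)  s gx = refl
  avoids-mems (store b _ t) {x} s gx = distinct g x b s gx
  avoids-mems (p ⨾ q)       s gx = ∨-falseⁱ (avoids-mems p (proj₁ (∧-true s)) gx) (avoids-mems q (proj₂ (∧-true s)) gx)
  avoids-mems (ifnz r p q)  s gx = ∨-falseⁱ (avoids-mems p (proj₁ (∧-true s)) gx) (avoids-mems q (proj₂ (∧-true s)) gx)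
  avoids-mems (while r p)   s gx = avoids-mems p s gx

  avoids-shift : (∀ r → f (48 + r) ≡ false) → (∀ b → g (8 + b) ≡ false) → ∀ p → avoids f g (shift p) ≡ true
  avoids-shift nf ng skip          = refl
  avoids-shift nf ng (const r k)   = cong Bool.not (nf r)
  avoids-shift nf ng (op o r s t)  = cong Bool.not (nf r)
  avoids-shift nf ng (load r b s)  = cong Bool.not (nf r)
  avoids-shift nf ng (store b s t) = cong Bool.not (ng b)
  avoids-shift nf ng (p ⨾ q)      rewrite avoids-shift nf ng p = avoids-shift nf ng q
  avoids-shift nf ng (ifnz r p q) rewrite avoids-shift nf ng p = avoids-shift nf ng q
  avoids-shift nf ng (while r p)   = avoids-shift nf ng p

  fixed : ∀ {σ τ} p → avoids f g p ≡ true → Unchanged p σ τ → Fixed f g σ τ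
  fixed p s u = fixes (λ r fr → Unchanged.regs u r (avoids-regs p s fr)) (λ b gb → Unchanged.mems u b (avoids-mems p s gb))

  fixed-trans : ∀ {σ τ υ} → Fixed f g σ τ → Fixed f g τ υ → Fixed f g σ υ
  fixed-trans u u′ = fixes (λ r fr → trans (fixedReg u′ r fr) (fixedReg u r fr))
    (λ b gb a → trans (fixedMem u′ b gb a) (fixedMem u b gb a))

  fixed-setReg : ∀ {σ r x} → Bool.not (f r) ≡ true → Fixed f g σ (setReg r x σ)
  fixed-setReg {σ} {r} {x} nf = fixes (λ y fy → same y (distinct f y r nf fy)) (λ _ _ _ → refl)
    where
    same : ∀ y → (y ≡ᵇ r) ≡ false → reg (setReg r x σ) y ≡ reg σ y
    same y y≢r rewrite y≢r = refl

  fixed-setMem : ∀ {σ c a x} → Bool.not (g c) ≡ true → Fixed f g σ (setMem c a x σ)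
  fixed-setMem {σ} {c} {a} {x} ng = fixes (λ _ _ → refl) (λ y gy → same y (distinct g y c ng gy))
    where
    same : ∀ y → (y ≡ᵇ c) ≡ false → ∀ z → mem (setMem c a x σ) y z ≡ mem σ y z
    same y y≢c z rewrite y≢c = refl

fixed-mono : ∀ {f g f′ g′ σ τ} → (∀ r → f′ r ≡ true → f r ≡ true) → (∀ b → g′ b ≡ true → g b ≡ true) →
             Fixed f g σ τ → Fixed f′ g′ σ τ
fixed-mono ff gg u = fixes (λ r fr → fixedReg u r (ff r fr)) (λ b gb → fixedMem u b (gg b gb))

-- Words are compared from the last to the first, so that a difference in a more significant word
-- overrides the flags `rLe` and `rEq` found so far, while equal words leave them alone. `rDrop`
-- shifts out the bits of the last word that are beyond the pattern, where the text may go on with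
-- any bits; for all other words it is 0.
reverseDigit reverseWord patternWord textWord compareWord compareKeys : Program

reverseDigit =
  op sub rI rI rOne ⨾
  op mul rTmp rI rB ⨾
  op shr rTmp rX rTmp ⨾
  op mod rTmp rTmp rBase ⨾
  load rTmp 2 rTmp ⨾
  op shl rTmp rTmp rTop ⨾
  op shr rR rR rB ⨾
  op add rR rR rTmp

reverseWord =
  const rR 0 ⨾
  op add rI rDigits rZero ⨾
  while rI reverseDigit

patternWord =
  op mul rX rPat rLen ⨾
  op add rX rX rT ⨾
  load rX 1 rX ⨾
  reverseWord

textWord =
  op add rX rWord rT ⨾
  load rV 0 rX ⨾
  op shr rV rV rOff ⨾
  op add rX rX rOne ⨾
  load rX 0 rX ⨾
  op shl rX rX rCo ⨾
  op add rX rV rX ⨾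
  reverseWord

compareWord =
  op sub rT rT rOne ⨾
  patternWord ⨾
  op shr rU rR rDrop ⨾
  textWord ⨾
  op shr rV rR rDrop ⨾
  op eq rTmp rV rU ⨾
  ifnz rTmp skip (op lt rLe rV rU ⨾ const rEq 0) ⨾
  const rDrop 0

compareKeys =
  op sub rTmp rAt rOne ⨾
  op div rWord rTmp rW ⨾
  op mod rOff rTmp rW ⨾
  op sub rCo rW rOff ⨾
  op add rDrop rPad rZero ⨾
  const rLe 1 ⨾
  const rEq 1 ⨾
  op add rT rLen rZero ⨾
  while rT compareWord

Decides : ℕ → Set → Set
Decides f P = (f ≡ 1 × P) ⊎ (f ≡ 0 × ¬ P)

decides-map : ∀ {f P P′} → (P → P′) → (P′ → P) → Decides f P → Decides f P′
decides-map to from (inj₁ (f≡ , p)) = inj₁ (f≡ , to p)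
decides-map to from (inj₂ (f≡ , p)) = inj₂ (f≡ , p ∘ from)

bit-≡ᵇ : ∀ x y → Decides (bit (x ≡ᵇ y)) (x ≡ y)
bit-≡ᵇ x y with x ≡ᵇ y in ≡b
... | true  = inj₁ (refl , ≡ᵇ⇒≡ x y (subst Bool.T (sym ≡b) tt))
... | false = inj₂ (refl , λ { x≡y → subst Bool.T ≡b (≡⇒≡ᵇ x y x≡y) })

bit-<ᵇ : ∀ x y → Decides (bit (x <ᵇ y)) (x < y)
bit-<ᵇ x y with x <ᵇ y in ≡b
... | true  = inj₁ (refl , <ᵇ⇒< x y (subst Bool.T (sym ≡b) tt))
... | false = inj₂ (refl , λ x<y → subst Bool.T ≡b (<⇒<ᵇ x<y))

digit-< : ∀ {x y p a c} → x < y → a < p → x * p + a < y * p + c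
digit-< {x} {y} {p} {a} {c} x<y a<p = begin-strict
  x * p + a <⟨ +-monoʳ-< (x * p) a<p ⟩
  x * p + p ≡⟨ +-comm (x * p) p ⟩
  suc x * p ≤⟨ *-monoˡ-≤ p x<y ⟩
  y * p     ≤⟨ m≤m+n (y * p) c ⟩
  y * p + c ∎
  where open ≤-Reasoning

module _ (I : Instance) where
  open Instance I
  open Values w

  private
    instance
      _ = >-nonZero 1≤b
      _ = 2^≢0 b

  w<2^w : w < 2 ^ w
  w<2^w = n<2^n w

  record Ready (σ : State) : Set where
    field
      n≡      : reg σ rN ≡ n
      k≡      : reg σ rK ≡ k
      m≡      : reg σ rM ≡ m
      one≡    : reg σ rOne ≡ 1
      w≡      : reg σ rW ≡ w
      b≡      : reg σ rB ≡ b
      base≡   : reg σ rBase ≡ 2 ^ b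
      words≡  : reg σ rLen ≡ words
      pad≡    : reg σ rPad ≡ pad
      stride≡ : reg σ rStride ≡ 2 ^ E
      top≡    : reg σ rTop ≡ w ∸ b
      zero≡   : reg σ rZero ≡ 0
      digits≡ : reg σ rDigits ≡ digits
      text≡   : ∀ q → mem σ 0 q ≡ truncate w (value T >> (q * w))
      pats≡   : ∀ i t → t < words → mem σ 1 (i * words + t) ≡ truncate w (pattern′ D i >> (t * w))
      table≡  : ∀ x → x < 2 ^ b → mem σ 2 x ≡ rev b x

  open Ready

  keepFixed : ∀ {σ τ} → Fixed protectedReg protectedMem σ τ → Ready σ → Ready τ
  keepFixed {σ} {τ} u ready = record
    { n≡ = reg≡ 0 refl (n≡ ready) ; k≡ = reg≡ 1 refl (k≡ ready) ; m≡ = reg≡ 2 refl (m≡ ready)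
    ; one≡ = reg≡ 3 refl (one≡ ready) ; w≡ = reg≡ 4 refl (w≡ ready) ; b≡ = reg≡ 5 refl (b≡ ready)
    ; base≡ = reg≡ 6 refl (base≡ ready) ; words≡ = reg≡ 7 refl (words≡ ready)
    ; pad≡ = reg≡ 8 refl (pad≡ ready) ; stride≡ = reg≡ 9 refl (stride≡ ready)
    ; top≡ = reg≡ 10 refl (top≡ ready)
    ; zero≡ = reg≡ 30 refl (zero≡ ready) ; digits≡ = reg≡ 31 refl (digits≡ ready)
    ; text≡ = λ q → mem≡ 0 refl (text≡ ready q)
    ; pats≡ = λ i t t< → mem≡ 1 refl (pats≡ ready i t t<)
    ; table≡ = λ x x< → mem≡ 2 refl (table≡ ready x x<) }
    where
    reg≡ : ∀ r {x} → protectedReg r ≡ true → reg σ r ≡ x → reg τ r ≡ x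
    reg≡ r pr = trans (fixedReg u r pr)
    mem≡ : ∀ c {a x} → protectedMem c ≡ true → mem σ c a ≡ x → mem τ c a ≡ x
    mem≡ c pc = trans (fixedMem u c pc _)

  keep : ∀ {σ τ} p → avoids protectedReg protectedMem p ≡ true → Unchanged p σ τ → Ready σ → Ready τ
  keep p s u = keepFixed (fixed p s u)

  keep-setReg : ∀ {σ r x} → Bool.not (protectedReg r) ≡ true → Ready σ → Ready (setReg r x σ)
  keep-setReg pr = keepFixed (fixed-setReg pr)

  keep-setMem : ∀ {σ c a x} → Bool.not (protectedMem c) ≡ true → Ready σ → Ready (setMem c a x σ)
  keep-setMem pr = keepFixed (fixed-setMem pr)

  1+w<2^w : suc w < 2 ^ w
  1+w<2^w = begin-strict
    2 + v             <⟨ s≤s (≤-reflexive (+-comm 2 v)) ⟩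
    suc (v + 2)       ≤⟨ +-monoˡ-≤ (v + 2) 1≤v ⟩
    v + (v + 2)       ≡⟨ regroup v ⟩
    2 * suc v         ≤⟨ *-monoʳ-≤ 2 (n<2^n v) ⟩
    2 ^ w             ∎
    where
    open ≤-Reasoning
    regroup : ∀ v → v + (v + 2) ≡ 2 * suc v
    regroup = solve-∀

  w<digits*b : w < digits * b
  w<digits*b = begin-strict
    w                 ≡⟨ m≡m%n+[m/n]*n w b ⟩
    w % b + w / b * b <⟨ +-monoˡ-< (w / b * b) (m%n<n w b) ⟩
    b + w / b * b     ∎
    where open ≤-Reasoning

  revCost : ℕ
  revCost = 3 + digits * 9

  reverseWord-spec : ∀ {σ x} → Ready σ → reg σ rX ≡ x → x < 2 ^ w →
                     HaltsWithin w reverseWord σ revCost (λ τ → reg τ rR ≡ rev w x)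
  reverseWord-spec {σ} {x} ready x≡ x< =
    constStep (truncate-id {w} (1≤2^ w)) $
    opStep (trans (add-value (digits≡ ready) (zero≡ ready) digits<) (+-identityʳ digits)) $
    finally (countdown Inv step digits refl (≤-refl , initially))
      (λ τ (_ , done) → trans done (cong (rev w) (>>0 x)))
    where
    Inv : ℕ → State → Set
    Inv i τ = i ≤ digits × reg τ rR ≡ rev w (x >> (i * b))
    digits< : digits + 0 < 2 ^ w
    digits< rewrite +-identityʳ digits = ≤-<-trans (s≤s (m/n≤m w b)) 1+w<2^w
    -- `digits * b` exceeds `w`, so nothing of `x` is left above the top digit and the accumulator
    -- may start at 0.
    initially : 0 ≡ rev w (x >> (digits * b))
    initially = sym (trans (cong (rev w) (<2^⇒>>≡0 {n = digits * b} (<-≤-trans x< (^-monoʳ-≤ 2 (<⇒≤ w<digits*b))))) (rev-0 w))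
    step : ∀ i τ → Unchanged reverseDigit _ τ → reg τ rI ≡ suc i → Inv (suc i) τ →
           HaltsWithin w reverseDigit τ 8 (λ υ → reg υ rI ≡ i × Inv i υ)
    step i τ unch i≡ (s≤s i≤ , r≡) =
      opStep (sub-value i≡ (one≡ ready′) (s≤s z≤n) i<) $
      opStep (mul-value (is i) (b≡ ready′) ib<) $
      opStep (shr-value (trans (Unchanged.regs unch rX refl) x≡) (is (i * b))) $
      opStep (mod-value (is y) (base≡ ready′)) $
      loadStep (table≡ ready′ _ (truncate-< b (x >> (i * b)))) $
      opStep (shl-value (is d) (top≡ ready′) digit<) $
      opStep (shr-value r≡ (b≡ ready′)) $
      opLast (add-value (is (rev w (x >> (suc i * b)) >> b)) (is (d * 2 ^ (w ∸ b))) sum<) (refl , m≤n⇒m≤1+n i≤ , sum≡)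
      where
      ready′ = keep reverseDigit refl unch (keep-setReg refl (keep-setReg refl ready))
      y = x >> (i * b)
      d = rev b (truncate b y)
      i< : suc i < 2 ^ w
      i< = ≤-<-trans (s≤s (≤-trans i≤ (m/n≤m w b))) 1+w<2^w
      ib< : i * b < 2 ^ w
      ib< = ≤-<-trans (≤-trans (*-monoˡ-≤ b i≤) (m/n*n≤m w b)) w<2^w
      digit< : d * 2 ^ (w ∸ b) < 2 ^ w
      digit< = <-≤-trans (*-monoˡ-< (2 ^ (w ∸ b)) ⦃ 2^≢0 (w ∸ b) ⦄ (rev-< b _))
        (≤-reflexive (trans (sym (^-distribˡ-+-* 2 b (w ∸ b))) (cong (2 ^_) (m+[n∸m]≡n (<⇒≤ b<w)))))
      sum≡ : rev w (x >> (suc i * b)) >> b + d * 2 ^ (w ∸ b) ≡ rev w y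
      sum≡ = begin
        rev w (x >> (b + i * b)) >> b + d * 2 ^ (w ∸ b)
          ≡⟨ cong (λ z → rev w (x >> z) >> b + d * 2 ^ (w ∸ b)) (+-comm b (i * b)) ⟩
        rev w (x >> (i * b + b)) >> b + d * 2 ^ (w ∸ b)
          ≡⟨ cong (λ z → rev w z >> b + d * 2 ^ (w ∸ b)) (>>-+ x (i * b) b) ⟩
        rev w (y >> b) >> b + d * 2 ^ (w ∸ b) ≡⟨ +-comm (rev w (y >> b) >> b) _ ⟩
        d * 2 ^ (w ∸ b) + rev w (y >> b) >> b ≡⟨ sym (rev-horner {w} {b} (<⇒≤ b<w) (≤-<-trans (>>-≤ x (i * b)) x<)) ⟩
        rev w y ∎
        where open ≡-Reasoning
      sum< : rev w (x >> (suc i * b)) >> b + d * 2 ^ (w ∸ b) < 2 ^ w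
      sum< = subst (_< 2 ^ w) (sym sum≡) (rev-< w y)

  words*w : words * w ≡ m + pad
  words*w = begin
    w + q * w                   ≡⟨ cong (λ z → suc z + q * w) (sym (m+[n∸m]≡n (s≤s⁻¹ (m%n<n (m ∸ 1) w)))) ⟩
    suc (r + pad) + q * w       ≡⟨ regroup r pad (q * w) ⟩
    suc (r + q * w) + pad       ≡⟨ cong (λ z → suc z + pad) (sym (m≡m%n+[m/n]*n (m ∸ 1) w)) ⟩
    suc (m ∸ 1) + pad           ≡⟨ cong (_+ pad) (m+[n∸m]≡n 1≤m) ⟩
    m + pad                     ∎
    where
    open ≡-Reasoning
    q = (m ∸ 1) / w
    r = (m ∸ 1) % w
    regroup : ∀ r p q → suc (r + p) + q ≡ suc (r + q) + p
    regroup = solve-∀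

  pat-address : ∀ {i t} → i < k → t < words → i * words + t < 2 ^ w
  pat-address {i} {t} i< t< = begin-strict
    i * words + t     <⟨ +-monoʳ-< (i * words) t< ⟩
    i * words + words ≡⟨ +-comm (i * words) words ⟩
    suc i * words     ≤⟨ *-monoˡ-≤ words i< ⟩
    k * words         <⟨ fits ⟩
    2 ^ w             ∎
    where open ≤-Reasoning

  patternWord-spec : ∀ {σ i t} → Ready σ → reg σ rPat ≡ i → reg σ rT ≡ t → i < k → t < words →
                     HaltsWithin w patternWord σ (3 + revCost) (λ τ → reg τ rR ≡ rev w (pattern′ D i >> (t * w)))
  patternWord-spec {σ} {i} {t} ready i≡ t≡ i< t< =
    opStep (mul-value i≡ (words≡ ready) (≤-<-trans (m≤m+n _ t) (pat-address i< t<))) $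
    opStep (add-value (is (i * words)) t≡ (pat-address i< t<)) $
    loadStep (pats≡ ready i t t<) $
    finally (reverseWord-spec (keep-setReg refl (keep-setReg refl (keep-setReg refl ready))) refl (truncate-< w y))
      (λ _ r≡ → trans r≡ (rev-truncate {w} {w} y ≤-refl))
    where y = pattern′ D i >> (t * w)

  textWord-spec : ∀ {σ x t} → Ready σ → reg σ rWord ≡ x / w → reg σ rOff ≡ x % w → reg σ rCo ≡ w ∸ x % w →
                  reg σ rT ≡ t → x < n → t < words →
                  HaltsWithin w textWord σ (7 + revCost) (λ τ → reg τ rR ≡ rev w (value T >> x >> (t * w)))
  textWord-spec {σ} {x} {t} ready word≡ off≡ co≡ t≡ x< t< =
    opStep (add-value word≡ t≡ (<-trans (m<m+n a (s≤s z≤n)) a+1<)) $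
    loadStep (text≡ ready a) $
    opStep (shr-value (is (truncate w A)) off≡) $
    opStep (add-value (is a) (one≡ ready) a+1<) $
    loadStep (text≡ ready (a + 1)) $
    opStep (shl-truncated {x = truncate w (value T >> ((a + 1) * w))} (is _) co≡) $
    opStep (add-value (is (truncate w A >> o))
                      (is (truncate w (truncate w (value T >> ((a + 1) * w)) * 2 ^ (w ∸ o)))) sum<) $
    finally (reverseWord-spec
        (keep-setReg refl (keep-setReg refl (keep-setReg refl (keep-setReg refl
          (keep-setReg refl (keep-setReg refl (keep-setReg refl ready))))))) refl sum<)
      (λ _ r≡ → trans r≡ (trans (cong (rev w) sum≡) (rev-truncate {w} {w} _ ≤-refl)))
    where
    a = x / w + t
    o = x % w
    A = value T >> (a * w)
    -- Both `x / w` and `t` are at most `(n ∸ 1) / w`, and twice that is at most `n ∸ 1` because `w`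
    -- is at least 2.
    a+1< : a + 1 < 2 ^ w
    a+1< = ≤-<-trans (begin
      x / w + t + 1                   ≤⟨ +-monoˡ-≤ 1 (+-mono-≤ (/-monoˡ-≤ w (≤-pred x<′)) (≤-trans (s≤s⁻¹ t<) (/-monoˡ-≤ w (∸-monoˡ-≤ 1 m≤n)))) ⟩
      (n ∸ 1) / w + (n ∸ 1) / w + 1   ≡⟨ cong (_+ 1) (double ((n ∸ 1) / w)) ⟩
      (n ∸ 1) / w * 2 + 1             ≤⟨ +-monoˡ-≤ 1 (≤-trans (*-monoʳ-≤ ((n ∸ 1) / w) (s≤s 1≤v)) (m/n*n≤m (n ∸ 1) w)) ⟩
      n ∸ 1 + 1                       ≡⟨ m∸n+n≡m (≤-trans (s≤s z≤n) x<) ⟩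
      n                               ∎) n<
      where
      open ≤-Reasoning
      double : ∀ y → y + y ≡ y * 2
      double = solve-∀
      x<′ : suc x ≤ suc (n ∸ 1)
      x<′ = ≤-trans x< (≤-reflexive (sym (m+[n∸m]≡n {1} (≤-trans (s≤s z≤n) x<))))
    next-word : value T >> ((a + 1) * w) ≡ A >> w
    next-word = trans (cong (value T >>_) (trans (*-distribʳ-+ w a 1) (cong (a * w +_) (*-identityˡ w))))
                      (>>-+ (value T) (a * w) w)
    aligned : A >> o ≡ value T >> x >> (t * w)
    aligned = begin
      value T >> (a * w) >> o   ≡⟨ sym (>>-+ (value T) (a * w) o) ⟩
      value T >> (a * w + o)    ≡⟨ cong (value T >>_) position ⟩
      value T >> (x + t * w)    ≡⟨ >>-+ (value T) x (t * w) ⟩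
      value T >> x >> (t * w)   ∎
      where
      open ≡-Reasoning
      regroup : ∀ q t w o → (q + t) * w + o ≡ o + q * w + t * w
      regroup = solve-∀
      position : a * w + o ≡ x + t * w
      position = trans (regroup (x / w) t w o) (cong (_+ t * w) (sym (m≡m%n+[m/n]*n x w)))
    sum≡ : truncate w A >> o + truncate w (truncate w (value T >> ((a + 1) * w)) * 2 ^ (w ∸ o)) ≡
           truncate w (value T >> x >> (t * w))
    sum≡ = trans (cong (λ z → truncate w A >> o + truncate w (truncate w z * 2 ^ (w ∸ o))) next-word)
                 (trans (straddle {w} o (m%n<n x w) A) (cong (truncate w) aligned))
    sum< : truncate w A >> o + truncate w (truncate w (value T >> ((a + 1) * w)) * 2 ^ (w ∸ o)) < 2 ^ w
    sum< = subst (_< 2 ^ w) (sym sum≡) (truncate-< w _)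

lex-≡-≤ : ∀ {x y p a c} → x ≡ y → (x * p + a ≤ y * p + c → a ≤ c) × (a ≤ c → x * p + a ≤ y * p + c)
lex-≡-≤ {x} {p = p} refl = +-cancelˡ-≤ (x * p) _ _ , +-monoʳ-≤ (x * p)

lex-≢ : ∀ {x y p a c} → x ≢ y → a < p → c < p →
        (x * p + a ≤ y * p + c → x < y) × (x < y → x * p + a ≤ y * p + c) × x * p + a ≢ y * p + c
lex-≢ {x} {y} {p} {a} {c} x≢y a<p c<p =
  (λ le → ≤∧≢⇒< (≮⇒≥ λ y<x → <⇒≱ (digit-< {c = a} y<x c<p) le) x≢y) ,
  (λ x<y → <⇒≤ (digit-< x<y a<p)) ,
  (λ ≡s → x≢y (≤-antisym (≮⇒≥ λ y<x → <⇒≢ (digit-< {c = a} y<x c<p) (sym ≡s))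
                         (≮⇒≥ λ x<y → <⇒≢ (digit-< {c = c} x<y a<p) ≡s)))

module _ (I : Instance) where
  open Instance I
  open Values w
  open Ready

  DropAt : ℕ → ℕ → Set
  DropAt t d = (t ≡ words × d ≡ pad) ⊎ (t < words × d ≡ 0)

  -- The share of the key that comes from the words from `t` on. Truncated subtraction makes it 0 at
  -- `t ≡ words`, where the comparison starts with a tie.
  rest : ℕ → ℕ → ℕ
  rest x t = rev (m ∸ t * w) (x >> (t * w))

  rest-words : ∀ x → rest x words ≡ 0
  rest-words x = cong (λ z → rev z (x >> (words * w)))
    (trans (cong (m ∸_) (words*w I)) (m≤n⇒m∸n≡0 (m≤m+n m pad)))

  -- Of the last word only `w ∸ pad` bits belong to the key, and shifting the reversed word right by
  -- `pad` keeps exactly these. Any other word contributes all its bits, in front of those of the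
  -- later words.
  rest-split : ∀ {t d} → DropAt (suc t) d → ∀ x →
               rest x t ≡ (rev w (x >> (t * w)) >> d) * 2 ^ (m ∸ suc t * w) + rest x (suc t)
  rest-split {t} (inj₁ (refl , refl)) x = begin
    rev (m ∸ t * w) y                     ≡⟨ cong (λ z → rev z y) width ⟩
    rev (w ∸ pad) y                       ≡⟨ sym (rev->> {w} (w ∸ pad) y (m∸n≤m w pad)) ⟩
    rev w y >> (w ∸ (w ∸ pad))            ≡⟨ cong (rev w y >>_) (m∸[m∸n]≡n (m≤n⇒m≤1+n pad≤v)) ⟩
    rev w y >> pad                        ≡⟨ sym (trans (+-identityʳ _) (*-identityʳ _)) ⟩
    (rev w y >> pad) * 2 ^ 0 + 0
      ≡⟨ sym (cong₂ (λ a c → (rev w y >> pad) * 2 ^ a + c) none (rest-words x)) ⟩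
    (rev w y >> pad) * 2 ^ (m ∸ words * w) + rest x words ∎
    where
    open ≡-Reasoning
    y = x >> (t * w)
    pad≤v : pad ≤ v
    pad≤v = m∸n≤m v ((m ∸ 1) % w)
    none : m ∸ words * w ≡ 0
    none = trans (cong (m ∸_) (words*w I)) (m≤n⇒m∸n≡0 (m≤m+n m pad))
    width : m ∸ t * w ≡ w ∸ pad
    width = begin
      m ∸ t * w                   ≡⟨ cong (_∸ t * w) (sym (m+n∸n≡m m pad)) ⟩
      m + pad ∸ pad ∸ t * w       ≡⟨ cong (λ z → z ∸ pad ∸ t * w) (sym (words*w I)) ⟩
      w + t * w ∸ pad ∸ t * w     ≡⟨ ∸-+-assoc (w + t * w) pad (t * w) ⟩
      w + t * w ∸ (pad + t * w)   ≡⟨ [m+n]∸[o+n]≡m∸o w pad (t * w) ⟩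
      w ∸ pad                     ∎
      where
      [m+n]∸[o+n]≡m∸o : ∀ a c d → a + d ∸ (c + d) ≡ a ∸ c
      [m+n]∸[o+n]≡m∸o a c d rewrite +-comm a d | +-comm c d = [m+n]∸[m+o]≡n∸o d a c
  rest-split {t} (inj₂ (t< , refl)) x = begin
    rev (m ∸ t * w) y                       ≡⟨ cong (λ z → rev z y) width ⟩
    rev (w + (m ∸ suc t * w)) y             ≡⟨ rev-+ w (m ∸ suc t * w) y ⟩
    rev w y * 2 ^ (m ∸ suc t * w) + rev (m ∸ suc t * w) (y >> w)
      ≡⟨ cong₂ (λ a c → a * 2 ^ (m ∸ suc t * w) + rev (m ∸ suc t * w) c) (sym (>>0 (rev w y)))
           (trans (sym (>>-+ x (t * w) w)) (cong (x >>_) (+-comm (t * w) w))) ⟩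
    (rev w y >> 0) * 2 ^ (m ∸ suc t * w) + rest x (suc t) ∎
    where
    open ≡-Reasoning
    y = x >> (t * w)
    t*w≤m : suc t * w ≤ m
    t*w≤m = ≤-trans (*-monoˡ-≤ w (s≤s⁻¹ t<)) (≤-trans (m/n*n≤m (m ∸ 1) w) (m∸n≤m m 1))
    width : m ∸ t * w ≡ w + (m ∸ suc t * w)
    width = begin
      m ∸ t * w                           ≡⟨ cong (_∸ t * w) (sym (m+[n∸m]≡n t*w≤m)) ⟩
      suc t * w + (m ∸ suc t * w) ∸ t * w ≡⟨ cong (_∸ t * w) (regroup w (t * w) _) ⟩
      t * w + (w + (m ∸ suc t * w)) ∸ t * w ≡⟨ m+n∸m≡n (t * w) _ ⟩
      w + (m ∸ suc t * w)                 ∎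
      where
      regroup : ∀ a c d → a + c + d ≡ c + (a + d)
      regroup = solve-∀

  cmpCost : ℕ
  cmpCost = 9 + words * (19 + (revCost I + revCost I))

  compareKeys-spec : ∀ {σ i j} → Ready I σ → reg σ rPat ≡ i → reg σ rAt ≡ j → i < k → 1 ≤ j → j ≤ n →
                     HaltsWithin w compareKeys σ cmpCost (λ τ →
                       Decides (reg τ rLe) (suffixKey m T j ≤ key-of i) ×
                       Decides (reg τ rEq) (suffixKey m T j ≡ key-of i))
  compareKeys-spec {σ} {i} {j} ready i≡ j≡ i< 1≤j j≤n =
    opStep (sub-value j≡ (one≡ ready) 1≤j (≤-<-trans j≤n n<)) $
    opStep (div-value (is x) (w≡ ready)) $
    opStep (mod-value (is x) (w≡ ready)) $
    opStep (sub-value (w≡ ready) (is o) (<⇒≤ (m%n<n x w)) (w<2^w I)) $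
    opStep (trans (add-value (pad≡ ready) (zero≡ ready) pad<) (+-identityʳ pad)) $
    constStep (truncate-id {w} 1<2^w) $
    constStep (truncate-id {w} 1<2^w) $
    opStep (trans (add-value (words≡ ready) (zero≡ ready) words<) (+-identityʳ words)) $
    finally (countdown Inv step words refl
        (≤-refl , inj₁ (refl , refl) , inj₁ (refl , ≤-reflexive level) , inj₁ (refl , level)))
      λ { τ (_ , _ , le , ≡d) → subst₂ (λ a c → Decides (reg τ rLe) (a ≤ c)) (whole Y) (whole p) le
                             , subst₂ (λ a c → Decides (reg τ rEq) (a ≡ c)) (whole Y) (whole p) ≡d }
    where
    x = j ∸ 1
    o = x % w
    Y = value T >> x
    p = pattern′ D i
    1<2^w : 1 < 2 ^ w
    1<2^w = <-trans (s≤s 1≤v) (w<2^w I)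
    pad< : pad + 0 < 2 ^ w
    pad< rewrite +-identityʳ pad = <-trans (s≤s (m∸n≤m v ((m ∸ 1) % w))) (w<2^w I)
    words≤n : words ≤ n
    words≤n = ≤-trans (s≤s (m/n≤m (m ∸ 1) w)) (≤-trans (≤-reflexive (m+[n∸m]≡n 1≤m)) m≤n)
    words< : words + 0 < 2 ^ w
    words< rewrite +-identityʳ words = ≤-<-trans words≤n n<
    whole : ∀ z → rest z 0 ≡ rev m z
    whole z = cong (rev m) (>>0 z)
    level : rest Y words ≡ rest p words
    level = trans (rest-words Y) (sym (rest-words p))
    Inv : ℕ → State → Set
    Inv t τ = t ≤ words × DropAt t (reg τ rDrop) ×
              Decides (reg τ rLe) (rest Y t ≤ rest p t) × Decides (reg τ rEq) (rest Y t ≡ rest p t)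
    step : ∀ t τ → Unchanged compareWord _ τ → reg τ rT ≡ suc t → Inv (suc t) τ →
           HaltsWithin w compareWord τ (18 + (revCost I + revCost I)) (λ υ → reg υ rT ≡ t × Inv t υ)
    step t τ unch t≡ (t< , drop , le , ≡d) =
      within (≤-reflexive (regroup (revCost I))) $
      opStep (sub-value t≡ (one≡ ready′) (s≤s z≤n) (≤-<-trans (≤-trans t< words≤n) n<)) $
      framed (patternWord-spec I (keep-setReg I refl ready′) (trans (Unchanged.regs unch rPat refl) i≡) (is t) i< t<)
      then λ τ₁ (r≡₁ , u₁) →
      let ready₁ = keep I patternWord refl u₁ (keep-setReg I refl ready′) in
      opStep (shr-value r≡₁ (Unchanged.regs u₁ rDrop refl)) $
      framed (textWord-spec I (keep-setReg I refl ready₁)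
        (trans (Unchanged.regs u₁ rWord refl) (Unchanged.regs unch rWord refl))
        (trans (Unchanged.regs u₁ rOff refl) (Unchanged.regs unch rOff refl))
        (trans (Unchanged.regs u₁ rCo refl) (Unchanged.regs unch rCo refl))
        (Unchanged.regs u₁ rT refl) (subst (_≤ n) (sym (m+[n∸m]≡n 1≤j)) j≤n) t<)
      then λ τ₂ (r≡₂ , u₂) →
      opStep (shr-value r≡₂ (trans (Unchanged.regs u₂ rDrop refl) (Unchanged.regs u₁ rDrop refl))) $
      opStep (eq-value (is α) (Unchanged.regs u₂ rU refl)) $
      branch (trans (Unchanged.regs u₂ rT refl) (Unchanged.regs u₁ rT refl))
        (subst (λ f → Decides f (rest Y (suc t) ≤ rest p (suc t)))
          (sym (trans (Unchanged.regs u₂ rLe refl) (Unchanged.regs u₁ rLe refl))) le)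
        (subst (λ f → Decides f (rest Y (suc t) ≡ rest p (suc t)))
          (sym (trans (Unchanged.regs u₂ rEq refl) (Unchanged.regs u₁ rEq refl))) ≡d)
        (Unchanged.regs u₂ rU refl)
        (bit-≡ᵇ α β)
      where
      ready′ = keep I compareWord refl unch (keep-setReg I refl (keep-setReg I refl (keep-setReg I refl (keep-setReg I refl
        (keep-setReg I refl (keep-setReg I refl (keep-setReg I refl (keep-setReg I refl ready))))))))
      d = reg τ rDrop
      α = rev w (Y >> (t * w)) >> d
      β = rev w (p >> (t * w)) >> d
      P = 2 ^ (m ∸ suc t * w)
      regroup : ∀ c → 1 + ((3 + c) + (1 + ((7 + c) + (1 + (1 + (3 + 1)))))) ≡ 18 + (c + c)
      regroup = solve-∀
      Post : State → Set
      Post υ = reg υ rT ≡ t × Inv t υ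
      branch : ∀ {υ} →
               reg υ rT ≡ t →
               Decides (reg υ rLe) (rest Y (suc t) ≤ rest p (suc t)) →
               Decides (reg υ rEq) (rest Y (suc t) ≡ rest p (suc t)) →
               reg υ rU ≡ β → Decides (bit (α ≡ᵇ β)) (α ≡ β) →
               HaltsWithin w (ifnz rTmp skip (op lt rLe rV rU ⨾ const rEq 0) ⨾ const rDrop 0)
                 (setReg rTmp (bit (α ≡ᵇ β)) (setReg rV α υ)) (3 + 1) Post
      branch {υ} t≡ le ≡d U≡ (inj₁ (f≡1 , α≡β)) =
        ifTrue {t = 2} {Post = _≡ setReg rTmp (bit (α ≡ᵇ β)) (setReg rV α υ)} (λ f≡0 → case trans (sym f≡1) f≡0 of λ ()) (skipped refl)
        then λ { _ refl → constLast (truncate-id {w} (1≤2^ w))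
          ( t≡ , ≤-trans (n≤1+n t) t< , inj₂ (t< , refl)
          , decides-map (subst₂ _≤_ (sym SY) (sym Sp) ∘ proj₂ (lex-≡-≤ {p = P} α≡β))
                        (proj₁ (lex-≡-≤ {p = P} α≡β) ∘ subst₂ _≤_ SY Sp) le
          , decides-map (λ e → trans SY (trans (cong₂ (λ a c → a * P + c) α≡β e) (sym Sp)))
                        (λ e → +-cancelˡ-≡ (α * P) _ _
                          (trans (sym SY) (trans e (trans Sp (cong (λ a → a * P + rest p (suc t)) (sym α≡β)))))) ≡d ) }
        where
        SY = rest-split drop Y
        Sp = rest-split drop p
      branch {υ} t≡ le ≡d U≡ (inj₂ (f≡0 , α≢β)) =
        ifFalse {t = 2} f≡0
          (opStep (lt-value (is α) U≡) $
           constLast {Post = _≡ setReg rEq 0 (setReg rLe (bit (α <ᵇ β)) (setReg rTmp (bit (α ≡ᵇ β)) (setReg rV α υ)))}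
             (truncate-id {w} (1≤2^ w)) refl)
        then λ { _ refl → constLast (truncate-id {w} (1≤2^ w))
          ( t≡ , ≤-trans (n≤1+n t) t< , inj₂ (t< , refl)
          , decides-map (subst₂ _≤_ (sym SY) (sym Sp) ∘ proj₁ (proj₂ lex))
                        (proj₁ lex ∘ subst₂ _≤_ SY Sp) (bit-<ᵇ α β)
          , inj₂ (refl , λ e → proj₂ (proj₂ lex) (trans (sym SY) (trans e Sp))) ) }
        where
        SY = rest-split drop Y
        Sp = rest-split drop p
        lex = lex-≢ {p = P} α≢β (rev-< (m ∸ suc t * w) (Y >> (suc t * w))) (rev-< (m ∸ suc t * w) (p >> (suc t * w)))

-- Searching the suffix array

-- `rLo` is the last rank known to be low enough, and 0 stands for none. `test` asks about the rank
-- `rLo + rStep`; it compares `rStep` with the difference of `rN` and `rLo`, which cannot overflow,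
-- and answers 0 without a query if the rank would exceed n.
locate test gallop halve check searchOne : Program → Program

locate p =
  op add 48 rRank rZero ⨾
  shift p ⨾
  op add rAt 48 rZero ⨾
  compareKeys

test p =
  op sub rTmp rN rLo ⨾
  op lt rLe rTmp rStep ⨾
  ifnz rLe (const rLe 0) (op add rRank rLo rStep ⨾ locate p)

gallop p = while rLe (op add rLo rLo rStep ⨾ test p)

halve p = while rStep (
  test p ⨾
  ifnz rLe (op add rLo rLo rStep) skip ⨾
  op shr rStep rStep rOne)

check p =
  ifnz rLo (
    op add rRank rLo rZero ⨾
    locate p ⨾
    ifnz rEq (
      op sub rTmp rAt rOne ⨾
      op sub rTmp rN rTmp ⨾
      op lt rTmp rTmp rM ⨾
      ifnz rTmp skip (const rFound 1))
    skip)
  skip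

searchOne p =
  load rPat 3 rPos ⨾
  op add rStep rStride rZero ⨾
  test p ⨾
  gallop p ⨾
  op shr rStep rStep rOne ⨾
  halve p ⨾
  check p ⨾
  op add rPos rPos rOne ⨾
  op sub rCount rCount rOne

-- The levels of the search keep smaller and smaller sets: `testReg` for one test, `loopReg` for
-- `gallop` and `halve`, which move `rLo` or `rStep`, and `bodyReg` for `check`, which may set
-- `rFound`. `highReg` and `highMem` describe the part of the data structure.
bodyReg loopReg testReg highReg ownMem highMem : ℕ → Bool
bodyReg r = protectedReg r ∨ ((r ≡ᵇ rCount) ∨ (r ≡ᵇ rPos))
loopReg r = bodyReg r ∨ ((r ≡ᵇ rPat) ∨ (r ≡ᵇ rFound))
testReg r = loopReg r ∨ ((r ≡ᵇ rLo) ∨ (r ≡ᵇ rStep))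
highReg r = 48 ≤ᵇ r
ownMem b  = b <ᵇ 8
highMem b = 8 ≤ᵇ b

∨-left : ∀ {a} b → a ≡ true → a ∨ b ≡ true
∨-left b refl = refl

protected⇒own : ∀ b → protectedMem b ≡ true → ownMem b ≡ true
protected⇒own 0 _ = refl
protected⇒own 1 _ = refl
protected⇒own 2 _ = refl

body⇒protected : ∀ {σ τ} → Fixed bodyReg ownMem σ τ → Fixed protectedReg protectedMem σ τ
body⇒protected = fixed-mono (λ r → ∨-left _) protected⇒own

loop⇒body : ∀ {σ τ} → Fixed loopReg ownMem σ τ → Fixed bodyReg ownMem σ τ
loop⇒body = fixed-mono (λ r → ∨-left _) (λ b o → o)

test⇒loop : ∀ {σ τ} → Fixed testReg ownMem σ τ → Fixed loopReg ownMem σ τ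
test⇒loop = fixed-mono (λ r → ∨-left _) (λ b o → o)

-- The number `a` of strides depends on the state in which the first program halts. As it stands in
-- front of the run of the whole, the state is fixed first, by taking `_≡ τ₁` as the intermediate
-- condition.
amortize : ∀ {w p q σ t} {u : ℕ → ℕ} {Mid : State → Set} {Post : ℕ → State → Set} →
           HaltsWithin w p σ t Mid →
           (∀ τ → Mid τ → ∃[ a ] HaltsWithin w q τ (u a) (Post a)) →
           ∃[ a ] HaltsWithin w (p ⨾ q) σ (t + u a) (Post a)
amortize (u₁ , τ₁ , run₁ , le₁ , mid) f with f τ₁ mid
... | a , rest′ = a , _then_ {Mid = _≡ τ₁} (u₁ , τ₁ , run₁ , le₁ , refl) (λ { _ refl → rest′ })

module _ (I : Instance) (S : DataStructure) (q : ℕ)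
         (answers : ∀ σ i → Reachable (Instance.w I) S (Instance.T I) σ → 1 ≤ i → i ≤ Instance.n I →
                    HaltsWithin (Instance.w I) (query S) (setReg 0 i σ) q (λ τ → IsSA (Instance.T I) i (reg τ 0)))
         where
  open Instance I
  open Values w
  open Ready

  private Q = query S

  avoids-locate : avoids testReg ownMem (locate Q) ≡ true
  avoids-locate rewrite avoids-shift {testReg} {ownMem} (λ _ → refl) (λ _ → refl) Q = refl

  avoids-test : avoids testReg ownMem (test Q) ≡ true
  avoids-test rewrite avoids-shift {testReg} {ownMem} (λ _ → refl) (λ _ → refl) Q = refl

  avoids-gallop : avoids loopReg ownMem (gallop Q) ≡ true
  avoids-gallop rewrite avoids-shift {loopReg} {ownMem} (λ _ → refl) (λ _ → refl) Q = refl

  avoids-halve : avoids loopReg ownMem (halve Q) ≡ true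
  avoids-halve rewrite avoids-shift {loopReg} {ownMem} (λ _ → refl) (λ _ → refl) Q = refl

  avoids-check : avoids bodyReg ownMem (check Q) ≡ true
  avoids-check rewrite avoids-shift {bodyReg} {ownMem} (λ _ → refl) (λ _ → refl) Q = refl

  avoids-searchOne : avoids protectedReg ownMem (searchOne Q) ≡ true
  avoids-searchOne rewrite avoids-shift {protectedReg} {ownMem} (λ _ → refl) (λ _ → refl) Q = refl

  -- A query may change the data structure, so all that is kept is that its part of the memory
  -- simulates some reachable state. Each query leads to another one.
  Live : State → Set
  Live σ = ∃[ σ₀ ] Reachable w S T σ₀ × Simulates σ₀ σ

  live : ∀ {σ τ} → Fixed highReg highMem σ τ → Live σ → Live τ
  live u (σ₀ , reach , sim) = σ₀ , reach , record
    { regs = λ r → trans (fixedReg u (48 + r) refl) (Simulates.regs sim r)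
    ; mems = λ b a → trans (fixedMem u (8 + b) refl a) (Simulates.mems sim b a) }

  live-run : ∀ {σ τ} p → avoids highReg highMem p ≡ true → Unchanged p σ τ → Live σ → Live τ
  live-run p a u = live (fixed p a u)

  live-setReg : ∀ {σ x} r → Bool.not (highReg r) ≡ true → Live σ → Live (setReg r x σ)
  live-setReg r nr = live (fixed-setReg nr)

  Valid : ℕ → Set
  Valid j = 1 ≤ j × j ≤ n

  V : ℕ → ℕ
  V = suffixKey m T

  -- Quantifying over suffixes, instead of speaking of the one at rank `r`, makes `Below` vacuous at
  -- rank 0 and `Above` vacuous beyond `n`, so that the ends of the array need no sentinels.
  Below Above : ℕ → ℕ → Set
  Below r i = ∀ j → Valid j → rank T j ≤ r → V j ≤ key-of i
  Above r i = ∀ j → Valid j → r ≤ rank T j → key-of i < V j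

  locateCost testCost checkCost : ℕ
  locateCost = 1 + (q + (1 + cmpCost I))
  testCost   = 2 + (1 + (1 + locateCost))
  checkCost  = 1 + (1 + (locateCost + (1 + (3 + (1 + 1)))))

  locate-spec : ∀ {σ r i} → Ready I σ → Live σ → reg σ rRank ≡ r → 1 ≤ r → r ≤ n → reg σ rPat ≡ i → i < k →
                HaltsWithin w (locate Q) σ locateCost (λ τ →
                  Live τ × Valid (reg τ rAt) × rank T (reg τ rAt) ≡ r ×
                  Decides (reg τ rLe) (V (reg τ rAt) ≤ key-of i) ×
                  Decides (reg τ rEq) (V (reg τ rAt) ≡ key-of i))
  locate-spec {σ} {r} {i} ready (σ₀ , reach , sim) r≡ 1≤r r≤n i≡ i< =
    opStep (trans (add-value r≡ (zero≡ ready) (subst (_< 2 ^ w) (sym (+-identityʳ r)) (≤-<-trans r≤n n<))) (+-identityʳ r)) $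
    framed queried′ then λ τ₁ ((τ₀ , reach₁ , sim₁ , 1≤j , j≤n , rank≡) , u₁) →
    let ready₁ = keepFixed I (fixed (shift Q) (avoids-shift (λ _ → refl) (λ _ → refl) Q) u₁) (keep-setReg I refl ready) in
    opStep (trans (add-value (Simulates.regs sim₁ 0) (zero≡ ready₁)
                    (subst (_< 2 ^ w) (sym (+-identityʳ _)) (≤-<-trans j≤n n<))) (+-identityʳ (reg τ₀ 0))) $
    finally (framed (compareKeys-spec I (keep-setReg I refl ready₁)
                      (trans (Unchanged.regs u₁ rPat (shift-writesReg Q (<ᵇ⇒< rPat 48 tt))) i≡) (is (reg τ₀ 0)) i< 1≤j j≤n))
      λ τ₂ ((le , ≡d) , u₂) →
        let at≡ = Unchanged.regs u₂ rAt refl in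
        live-run compareKeys refl u₂ (live-setReg rAt refl (τ₀ , reach₁ , sim₁)) ,
        subst Valid (sym at≡) (1≤j , j≤n) , trans (cong (rank T) at≡) rank≡ ,
        subst (λ j → Decides (reg τ₂ rLe) (V j ≤ key-of i)) (sym at≡) le ,
        subst (λ j → Decides (reg τ₂ rEq) (V j ≡ key-of i)) (sym at≡) ≡d
    where
    queried′ : HaltsWithin w (shift Q) (setReg 48 r σ) q
                 (λ τ → ∃[ τ₀ ] Reachable w S T τ₀ × Simulates τ₀ τ × IsSA T r (reg τ₀ 0))
    queried′ with answers σ₀ r reach 1≤r r≤n
    ... | u , τ₀ , run , le , sa with shift-run {σ′ = setReg 48 r σ} run (record
            { regs = λ x → cong (if x ≡ᵇ 0 then r else_) (Simulates.regs sim x) ; mems = Simulates.mems sim })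
    ...   | τ , run′ , sim′ = u , τ , run′ , le , τ₀ , queried reach 1≤r r≤n run , sim′ , sa

  below-at : ∀ {r i j} → Valid j → rank T j ≡ r → V j ≤ key-of i → Below r i
  below-at {j = j} (1≤j , j≤n) refl V≤ p _ p≤ = ≤-trans (suffixKey-mono m T {p} {j} 1≤j j≤n p≤) V≤

  above-at : ∀ {r i j} → rank T j ≡ r → key-of i < V j → Above r i
  above-at {j = j} refl <V p (1≤p , p≤n) ≤p = <-≤-trans <V (suffixKey-mono m T {j} {p} 1≤p p≤n ≤p)

  Outcome : ℕ → ℕ → ℕ → State → Set
  Outcome lo d i τ = (reg τ rLe ≡ 1 × lo + d ≤ n × Below (lo + d) i) ⊎ (reg τ rLe ≡ 0 × Above (lo + d) i)

  test-spec : ∀ {σ lo d i} → Ready I σ → Live σ → reg σ rLo ≡ lo → lo ≤ n → reg σ rStep ≡ d → 1 ≤ d →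
              reg σ rPat ≡ i → i < k →
              HaltsWithin w (test Q) σ testCost (λ τ → Live τ × Outcome lo d i τ)
  test-spec {σ} {lo} {d} {i} ready lv lo≡ lo≤ d≡ 1≤d i≡ i< =
    opStep (sub-value (n≡ ready) lo≡ lo≤ n<) $
    opStep (lt-value (is (n ∸ lo)) d≡) $
    branch (bit-<ᵇ (n ∸ lo) d)
    where
    branch : ∀ {f} → Decides f (n ∸ lo < d) →
             HaltsWithin w (ifnz rLe (const rLe 0) (op add rRank rLo rStep ⨾ locate Q))
               (setReg rLe f (setReg rTmp (n ∸ lo) σ)) (1 + (1 + locateCost)) (λ τ → Live τ × Outcome lo d i τ)
    branch (inj₁ (f≡1 , n<lo+d)) =
      ifTrue (λ f≡0 → case trans (sym f≡1) f≡0 of λ ()) $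
      constLast (truncate-id {w} (1≤2^ w))
        (live-setReg rLe refl (live-setReg rLe refl (live-setReg rTmp refl lv)) , inj₂ (refl , λ j (1≤j , j≤n) lo+d≤ →
          ⊥-elim (<⇒≱ n<lo+d (≤-trans (≤-reflexive (sym (m+n∸m≡n lo d))) (∸-monoˡ-≤ lo (≤-trans lo+d≤ (rank-≤ T 1≤j j≤n)))))))
    branch (inj₂ (f≡0 , n≮lo+d)) =
      ifFalse f≡0 $
      opStep (add-value lo≡ d≡ (≤-<-trans lo+d≤n n<)) $
      finally (locate-spec (keep-setReg I refl (keep-setReg I refl (keep-setReg I refl ready)))
                 (live-setReg rRank refl (live-setReg rLe refl (live-setReg rTmp refl lv))) (is (lo + d)) (≤-trans 1≤d (m≤n+m d lo)) lo+d≤n i≡ i<)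
        λ { τ (lv′ , valid , rank≡ , inj₁ (le≡ , V≤) , _) → lv′ , inj₁ (le≡ , lo+d≤n , below-at valid rank≡ V≤)
          ; τ (lv′ , valid , rank≡ , inj₂ (le≡ , V≰) , _) → lv′ , inj₂ (le≡ , above-at {j = reg τ rAt} rank≡ (≰⇒> V≰)) }
      where
      lo+d≤n : lo + d ≤ n
      lo+d≤n = ≤-trans (+-monoʳ-≤ lo (≮⇒≥ n≮lo+d)) (≤-reflexive (m+[n∸m]≡n lo≤))

  -- `f` is fuel: each round raises `lo` by at least 1, and `lo` never exceeds `n`. That
  -- `lo + a * d ≤ lo′` is kept for the amortization over all patterns: every round has moved by a
  -- full stride.
  gallop-spec : ∀ f {σ lo d i} → n < lo + f → Ready I σ → Live σ → reg σ rLo ≡ lo → lo ≤ n → reg σ rStep ≡ d → 1 ≤ d →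
                reg σ rPat ≡ i → i < k → Below lo i → Outcome lo d i σ →
                ∃[ a ] HaltsWithin w (gallop Q) σ (1 + a * (2 + testCost)) (λ τ → Live τ ×
                  (∃[ lo′ ] reg τ rLo ≡ lo′ × lo + a * d ≤ lo′ × lo′ ≤ n × Below lo′ i × Above (lo′ + d) i) × reg τ rStep ≡ d)
  gallop-spec f {lo = lo} n<lo+f ready lv lo≡ lo≤ d≡ 1≤d i≡ i< below (inj₂ (le≡0 , above)) =
    0 , whileFalse le≡0 (lv , (lo , lo≡ , ≤-reflexive (+-identityʳ lo) , lo≤ , below , above) , d≡)
  gallop-spec zero {lo = lo} n<lo+f ready lv lo≡ lo≤ d≡ 1≤d i≡ i< below (inj₁ _) =
    ⊥-elim (<⇒≱ n<lo+f (≤-trans (≤-reflexive (+-identityʳ lo)) lo≤))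
  gallop-spec (suc f) {σ} {lo} {d} {i} n<lo+f ready lv lo≡ lo≤ d≡ 1≤d i≡ i< below (inj₁ (le≡1 , lo+d≤n , below′)) =
    continue (opStep (add-value lo≡ d≡ (≤-<-trans lo+d≤n n<)) $
              framed (test-spec (keep-setReg I refl ready) (live-setReg rLo refl lv)
                        (is (lo + d)) lo+d≤n d≡ 1≤d i≡ i<))
    where
    σ₁ = setReg rLo (lo + d) σ
    fuel : n < lo + d + f
    fuel = <-≤-trans n<lo+f (≤-trans (≤-reflexive (+-suc lo f))
      (+-monoˡ-≤ f (≤-trans (≤-reflexive (+-comm 1 lo)) (+-monoʳ-≤ lo 1≤d))))
    continue : HaltsWithin w (op add rLo rLo rStep ⨾ test Q) σ (1 + testCost)
                 (λ τ → (Live τ × Outcome (lo + d) d i τ) × Unchanged (test Q) σ₁ τ) → _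
    continue (u , τ , run , le , (lv₁ , outcome) , unch) =
      let fx  = fixed {testReg} {ownMem} (test Q) avoids-test unch
          ready₁ = keepFixed I (body⇒protected (loop⇒body (test⇒loop fx))) (keep-setReg I refl ready)
          a , h = gallop-spec f fuel ready₁ lv₁ (fixedReg fx rLo refl) lo+d≤n (trans (fixedReg fx rStep refl) d≡) 1≤d
                    (trans (fixedReg fx rPat refl) i≡) i< below′ outcome
      in suc a , weaken (≤-reflexive (regroup testCost (a * (2 + testCost))))
           (λ { τ (lv′ , (lo′ , lo′≡ , lo′≥ , more) , d≡′) →
                lv′ , (lo′ , lo′≡ , ≤-trans (≤-reflexive (sym (+-assoc lo d (a * d)))) lo′≥ , more) , d≡′ })
           (whileTrue {Mid = _≡ τ} (λ le≡0 → case trans (sym le≡1) le≡0 of λ ()) (u , τ , run , le , refl) (λ { _ refl → h }))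
      where
      regroup : ∀ c x → 1 + ((1 + c) + (1 + x)) ≡ 1 + ((2 + c) + x)
      regroup = solve-∀

  -- The boundary lies within `2 ^ e` ranks above `lo`, and one test in the middle halves this
  -- window. The step is half the window, so that `2 ^ 0 / 2 ≡ 0` ends the loop just when a single
  -- rank is left.
  halve-spec : ∀ e {σ lo i} → Ready I σ → Live σ → reg σ rLo ≡ lo → lo ≤ n → reg σ rStep ≡ 2 ^ e / 2 →
               reg σ rPat ≡ i → i < k → Below lo i → Above (lo + 2 ^ e) i →
               HaltsWithin w (halve Q) σ (1 + e * (4 + testCost)) (λ τ → Live τ ×
                 (∃[ lo′ ] reg τ rLo ≡ lo′ × lo ≤ lo′ × lo′ ≤ n × Below lo′ i × Above (lo′ + 1) i))
  halve-spec zero {lo = lo} ready lv lo≡ lo≤ d≡ i≡ i< below above =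
    whileFalse d≡ (lv , lo , lo≡ , ≤-refl , lo≤ , below , above)
  halve-spec (suc e) {σ} {lo} {i} ready lv lo≡ lo≤ d≡ i≡ i< below above =
    within (≤-reflexive (regroup testCost (e * (4 + testCost)))) $
    whileTrue (λ d≡0 → <⇒≢ (1≤2^ e) (trans (sym d≡0) d≡′))
      (framed (test-spec ready lv lo≡ lo≤ d≡′ (1≤2^ e) i≡ i<) then λ τ₁ ((lv₁ , outcome) , u₁) →
       let fx = fixed {testReg} {ownMem} (test Q) avoids-test u₁ in
       branch (trans (fixedReg fx rLo refl) lo≡) (trans (fixedReg fx rStep refl) d≡′) lv₁
           (keepFixed I (body⇒protected (loop⇒body (test⇒loop fx))) ready) (trans (fixedReg fx rPat refl) i≡) outcome)
      λ { τ (ready′ , lv′ , step≡ , i≡′ , lo′ , lo′≡ , lo≤lo′ , lo′≤ , below′ , above′) →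
          finally (halve-spec e ready′ lv′ lo′≡ lo′≤ step≡ i≡′ i< below′ above′)
            λ { _ (lv″ , lo″ , lo″≡ , lo′≤lo″ , more) → lv″ , lo″ , lo″≡ , ≤-trans lo≤lo′ lo′≤lo″ , more } }
    where
    half : 2 ^ suc e / 2 ≡ 2 ^ e
    half = trans (cong (_/ 2) (*-comm 2 (2 ^ e))) (m*n/n≡m (2 ^ e) 2)
    d≡′ : reg σ rStep ≡ 2 ^ e
    d≡′ = trans d≡ half
    regroup : ∀ c x → 1 + ((c + ((1 + 1) + 1)) + (1 + x)) ≡ 1 + ((4 + c) + x)
    regroup = solve-∀
    Post : State → Set
    Post τ = Ready I τ × Live τ × reg τ rStep ≡ 2 ^ e / 2 × reg τ rPat ≡ i ×
             (∃[ lo′ ] reg τ rLo ≡ lo′ × lo ≤ lo′ × lo′ ≤ n × Below lo′ i × Above (lo′ + 2 ^ e) i)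
    branch : ∀ {τ} → reg τ rLo ≡ lo → reg τ rStep ≡ 2 ^ e → Live τ → Ready I τ → reg τ rPat ≡ i →
             Outcome lo (2 ^ e) i τ →
             HaltsWithin w (ifnz rLe (op add rLo rLo rStep) skip ⨾ op shr rStep rStep rOne) τ ((1 + 1) + 1) Post
    branch {τ} lo≡ d≡ lv ready i≡ (inj₁ (le≡ , lo+d≤n , below′)) =
      ifTrue {t = 1} (λ le≡0 → case trans (sym le≡) le≡0 of λ ())
        (opLast {Post = _≡ setReg rLo (lo + 2 ^ e) τ} (add-value lo≡ d≡ (≤-<-trans lo+d≤n n<)) refl)
      then λ { _ refl → opLast (shr-value d≡ (one≡ ready))
        ( keep-setReg I refl (keep-setReg I refl ready)
        , live-setReg rStep refl (live-setReg rLo refl lv) , refl , i≡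
        , lo + 2 ^ e , refl , m≤m+n lo _ , lo+d≤n , below′
        , subst (λ r → Above r i) (trans (cong (λ z → lo + (2 ^ e + z)) (+-identityʳ (2 ^ e))) (sym (+-assoc lo _ _))) above ) }
    branch {τ} lo≡ d≡ lv ready i≡ (inj₂ (le≡ , above′)) =
      ifFalse {t = 1} le≡ (skipped {Post = _≡ τ} refl)
      then λ { _ refl → opLast (shr-value d≡ (one≡ ready))
        ( keep-setReg I refl ready , live-setReg rStep refl lv , refl , i≡
        , lo , lo≡ , ≤-refl , lo≤ , below , above′ ) }

  Found : ℕ → Set
  Found i = ∃[ j ] Match T D i j

  CheckPost : ℕ → ℕ → State → Set
  CheckPost i f τ = Live τ × ((reg τ rFound ≡ 1 × Found i) ⊎ (reg τ rFound ≡ f × ¬ Found i))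

  found⇒valid : ∀ {i j} → Match T D i j → Valid (suc j) × V (suc j) ≡ key-of i
  found⇒valid {j = j} (j+m≤n , k≡) =
    (s≤s z≤n , ≤-trans (≤-trans (≤-reflexive (+-comm 1 j)) (+-monoʳ-≤ j 1≤m)) j+m≤n) , k≡

  check-spec : ∀ {σ lo i} → Ready I σ → Live σ → reg σ rLo ≡ lo → lo ≤ n → reg σ rPat ≡ i → i < k →
               Below lo i → Above (lo + 1) i →
               HaltsWithin w (check Q) σ checkCost (λ τ → CheckPost i (reg σ rFound) τ × reg τ rLo ≡ lo)
  check-spec {σ} {zero} {i} ready lv lo≡ lo≤ i≡ i< below above =
    ifFalse lo≡ (skipped ((lv , inj₂ (refl , none)) , lo≡))
    where
    none : ¬ Found i
    none (j , match) with found⇒valid match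
    ... | valid , V≡ = <⇒≢ (above (suc j) valid (s≤s z≤n)) (sym V≡)
  check-spec {σ} {lo@(suc _)} {i} ready lv lo≡ lo≤ i≡ i< below above =
    ifTrue (λ lo≡0 → case trans (sym lo≡) lo≡0 of λ ()) $
    opStep (trans (add-value lo≡ (zero≡ ready) (subst (_< 2 ^ w) (sym (+-identityʳ lo)) (≤-<-trans lo≤ n<))) (+-identityʳ lo)) $
    framed (locate-spec (keep-setReg I refl ready) (live-setReg rRank refl lv) (is lo) (s≤s z≤n) lo≤ i≡ i<)
    then λ τ (info , u) →
    let fx = fixed {testReg} {ownMem} (locate Q) avoids-locate u in
    branch (fixedReg fx rFound refl) (trans (fixedReg fx rLo refl) lo≡)
      (keepFixed I (body⇒protected (loop⇒body (test⇒loop fx))) (keep-setReg I refl ready)) info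
    where
    -- A match has the key of the pattern, so its rank is at most `lo`. By monotonicity the key at
    -- rank `lo` is at least that of the match, and by `Below` at most that of the pattern.
    located-key : ∀ {j j₀} → Valid j → rank T j ≡ lo → Match T D i j₀ →
                  V j ≡ key-of i × rank T (suc j₀) ≤ rank T j × V (suc j₀) ≡ V j
    located-key {j} {j₀} (1≤j , j≤n) rank≡ match with found⇒valid match
    ... | valid , V≡ = V≡U , r≤ , trans V≡ (sym V≡U)
      where
      r≤ : rank T (suc j₀) ≤ rank T j
      r≤ = ≮⇒≥ λ r< → <⇒≢ (above (suc j₀) valid
        (≤-trans (≤-reflexive (+-comm lo 1)) (≤-trans (≤-reflexive (cong suc (sym rank≡))) r<))) (sym V≡)
      V≡U : V j ≡ key-of i
      V≡U = ≤-antisym (below j (1≤j , j≤n) (≤-reflexive rank≡))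
        (≤-trans (≤-reflexive (sym V≡)) (suffixKey-mono m T {suc j₀} {j} 1≤j j≤n r≤))
    Post : State → Set
    Post τ = CheckPost i (reg σ rFound) τ × reg τ rLo ≡ lo
    branch : ∀ {τ} → reg τ rFound ≡ reg σ rFound → reg τ rLo ≡ lo → Ready I τ →
             Live τ × Valid (reg τ rAt) × rank T (reg τ rAt) ≡ lo ×
             Decides (reg τ rLe) (V (reg τ rAt) ≤ key-of i) × Decides (reg τ rEq) (V (reg τ rAt) ≡ key-of i) →
             HaltsWithin w (ifnz rEq (op sub rTmp rAt rOne ⨾ op sub rTmp rN rTmp ⨾ op lt rTmp rTmp rM ⨾
                                      ifnz rTmp skip (const rFound 1)) skip) τ (1 + (3 + (1 + 1))) Post
    branch {τ} f≡ lo≡ ready (lv , valid , rank≡ , _ , inj₂ (eq≡0 , V≢)) =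
      ifFalse eq≡0 (skipped ((lv , inj₂ (f≡ , λ (j₀ , match) → V≢ (proj₁ (located-key valid rank≡ match)))) , lo≡))
    branch {τ} f≡ lo≡ ready (lv , valid@(1≤j , j≤n) , rank≡ , _ , inj₁ (eq≡1 , V≡)) =
      ifTrue (λ eq≡0 → case trans (sym eq≡1) eq≡0 of λ ()) $
      opStep (sub-value (is j) (one≡ ready) 1≤j (≤-<-trans j≤n n<)) $
      opStep (sub-value (n≡ ready) (is (j ∸ 1)) j∸1≤n n<) $
      opStep (lt-value (is (n ∸ (j ∸ 1))) (m≡ ready)) $
      last-branch (bit-<ᵇ (n ∸ (j ∸ 1)) m)
      where
      j = reg τ rAt
      j∸1≤n : j ∸ 1 ≤ n
      j∸1≤n = ≤-trans (m∸n≤m j 1) j≤n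
      σ₂ = setReg rTmp (n ∸ (j ∸ 1)) (setReg rTmp (j ∸ 1) τ)
      last-branch : ∀ {f} → Decides f (n ∸ (j ∸ 1) < m) →
                    HaltsWithin w (ifnz rTmp skip (const rFound 1)) (setReg rTmp f σ₂) (1 + 1) Post
      last-branch (inj₁ (f≡1 , short)) =
        ifTrue (λ f≡0 → case trans (sym f≡1) f≡0 of λ ())
          (skipped ((live-setReg rTmp refl (live-setReg rTmp refl (live-setReg rTmp refl lv)) , inj₂ (f≡ , none)) , lo≡))
        where
        -- A match would be a suffix with the same key and no higher rank that is long enough; by
        -- `full-suffix` the one at rank `lo` would be long enough too.
        none : ¬ Found i
        none (j₀ , match) with located-key valid rank≡ match
        ... | _ , r≤ , V≡V = <⇒≱ short
          (≤-trans (≤-reflexive (sym (m+n∸m≡n (j ∸ 1) m)))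
            (∸-monoˡ-≤ (j ∸ 1) (full-suffix m T {suc j₀} {j} 1≤j j≤n r≤ V≡V (proj₁ match))))
      last-branch (inj₂ (f≡0 , long)) =
        ifFalse f≡0 (constLast (truncate-id {w} (<-trans (s≤s 1≤v) (w<2^w I)))
          ((live-setReg rFound refl (live-setReg rTmp refl (live-setReg rTmp refl (live-setReg rTmp refl lv))) ,
            inj₁ (refl , j ∸ 1 , ≤-trans (+-monoʳ-≤ (j ∸ 1) (≮⇒≥ long)) (≤-reflexive (m+[n∸m]≡n j∸1≤n)) , V≡)) , lo≡))

  oneCost : ℕ
  oneCost = 2 + (testCost + (1 + (1 + ((1 + E * (4 + testCost)) + (checkCost + 2)))))

  OnePost : ℕ → ℕ → ℕ → ℕ → State → Set
  OnePost i f lo a τ = Live τ × (∃[ lo′ ] reg τ rLo ≡ lo′ × lo + a * 2 ^ E ≤ lo′ × lo′ ≤ n × Below lo′ i) ×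
                       ((reg τ rFound ≡ 1 × Found i) ⊎ (reg τ rFound ≡ f × ¬ Found i))

  k<2^w : k < 2 ^ w
  k<2^w = ≤-<-trans (m≤m*n k words) fits

  searchOne-spec : ∀ {σ pos c lo i} → Ready I σ → Live σ → reg σ rPos ≡ pos → pos < k → mem σ 3 pos ≡ i → i < k →
                   reg σ rCount ≡ suc c → suc c ≤ k →
                   reg σ rLo ≡ lo → lo ≤ n → Below lo i →
                   ∃[ a ] HaltsWithin w (searchOne Q) σ (oneCost + a * (2 + testCost))
                     (λ τ → (reg τ rPos ≡ suc pos × reg τ rCount ≡ c) × OnePost i (reg σ rFound) lo a τ)
  searchOne-spec {σ} {pos} {c} {lo} {i} ready lv pos≡ pos< i≡ i< c≡ c≤ lo≡ lo≤ below =
    begun main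
    where
    regroup : ∀ t x e c → 2 + (t + ((1 + x) + (1 + ((1 + e) + (c + 2))))) ≡
                          2 + (t + (1 + (1 + ((1 + e) + (c + 2))))) + x
    regroup = solve-∀
    begun : ∃[ a ] HaltsWithin w (test Q ⨾ gallop Q ⨾ op shr rStep rStep rOne ⨾ halve Q ⨾ check Q ⨾
                                  op add rPos rPos rOne ⨾ op sub rCount rCount rOne) (setReg rStep (2 ^ E) (setReg rPat i σ))
              (testCost + ((1 + a * (2 + testCost)) + (1 + ((1 + E * (4 + testCost)) + (checkCost + 2)))))
              (λ τ → (reg τ rPos ≡ suc pos × reg τ rCount ≡ c) × OnePost i (reg σ rFound) lo a τ) → _
    begun (a , h) =
      a , within (≤-reflexive (regroup testCost (a * (2 + testCost)) (E * (4 + testCost)) checkCost))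
      (loadStep (trans (cong (mem σ 3) pos≡) i≡)
        (opStep (trans (add-value (stride≡ ready) (zero≡ ready)
            (subst (_< 2 ^ w) (sym (+-identityʳ (2 ^ E))) (≤-<-trans 2^E≤w (w<2^w I)))) (+-identityʳ (2 ^ E))) h))
    σ₂ = setReg rStep (2 ^ E) (setReg rPat i σ)
    ready₂ = keep-setReg I {r = rStep} {x = 2 ^ E} refl (keep-setReg I {r = rPat} {x = i} refl ready)
    Post : ℕ → State → Set
    Post a τ = (reg τ rPos ≡ suc pos × reg τ rCount ≡ c) × OnePost i (reg σ rFound) lo a τ
    step₄ : ∀ {a lo₃ τ₃ τ₄} → lo + a * 2 ^ E ≤ lo₃ → lo₃ ≤ n → Below lo₃ i →
            reg τ₃ rFound ≡ reg σ rFound → Fixed bodyReg ownMem σ₂ τ₄ →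
            CheckPost i (reg τ₃ rFound) τ₄ → reg τ₄ rLo ≡ lo₃ →
            HaltsWithin w (op add rPos rPos rOne ⨾ op sub rCount rCount rOne) τ₄ 2 (Post a)
    step₄ {a} {lo₃} {τ₃} {τ₄} lo₃≥ lo₃≤ below₃ f≡ fx (lv₄ , found) lo₄≡ =
      opStep (trans (add-value (trans (fixedReg fx rPos refl) pos≡) (one≡ ready₄)
                (≤-<-trans (≤-trans (≤-reflexive (+-comm pos 1)) pos<) k<2^w)) (+-comm pos 1)) $
      opLast (sub-value (trans (fixedReg fx rCount refl) c≡) (one≡ ready₄) (s≤s z≤n) (≤-<-trans c≤ k<2^w))
        ( (refl , refl)
        , live-setReg rCount refl (live-setReg rPos refl lv₄)
        , (lo₃ , lo₄≡ , lo₃≥ , lo₃≤ , below₃)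
        , subst (λ f → (reg τ₄ rFound ≡ 1 × Found i) ⊎ (reg τ₄ rFound ≡ f × ¬ Found i)) f≡ found )
      where
      ready₄ : Ready I τ₄
      ready₄ = keepFixed I (body⇒protected fx) ready₂
    step₃ : ∀ {a lo₃ τ₃} → lo + a * 2 ^ E ≤ lo₃ → lo₃ ≤ n → Below lo₃ i → Above (lo₃ + 1) i → Live τ₃ →
            reg τ₃ rLo ≡ lo₃ → Fixed loopReg ownMem σ₂ τ₃ →
            HaltsWithin w (check Q ⨾ op add rPos rPos rOne ⨾ op sub rCount rCount rOne) τ₃ (checkCost + 2) (Post a)
    step₃ {a} {lo₃} {τ₃} lo₃≥ lo₃≤ below₃ above₃ lv₃ lo₃≡ fx =
      framed (check-spec (keepFixed I (body⇒protected (loop⇒body fx)) ready₂) lv₃ lo₃≡ lo₃≤ (fixedReg fx rPat refl) i< below₃ above₃)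
      then λ { τ₄ ((checked , lo₄≡) , u₄) →
        step₄ {a} {lo₃} {τ₃} {τ₄} lo₃≥ lo₃≤ below₃ (fixedReg fx rFound refl)
          (fixed-trans (loop⇒body fx) (fixed {bodyReg} {ownMem} (check Q) avoids-check u₄)) checked lo₄≡ }
    step₂ : ∀ {a lo₂ τ₂} → lo + a * 2 ^ E ≤ lo₂ → lo₂ ≤ n → Below lo₂ i → Above (lo₂ + 2 ^ E) i → Live τ₂ →
            reg τ₂ rLo ≡ lo₂ → reg τ₂ rStep ≡ 2 ^ E → Fixed loopReg ownMem σ₂ τ₂ →
            HaltsWithin w (op shr rStep rStep rOne ⨾ halve Q ⨾ check Q ⨾ op add rPos rPos rOne ⨾ op sub rCount rCount rOne) τ₂
              (1 + ((1 + E * (4 + testCost)) + (checkCost + 2))) (Post a)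
    step₂ {a} {τ₂ = τ₂} lo₂≥ lo₂≤ below₂ above₂ lv₂ lo₂≡ step≡ fx =
      opStep (shr-value step≡ (one≡ ready₂′)) $
      framed (halve-spec E (keep-setReg I refl ready₂′) (live-setReg rStep refl lv₂) lo₂≡ lo₂≤ refl
                (fixedReg fx rPat refl) i< below₂ above₂)
      then λ { τ₃ ((lv₃ , lo₃ , lo₃≡ , lo₂≤lo₃ , lo₃≤ , below₃ , above₃) , u₃) →
        step₃ {a} {lo₃} {τ₃} (≤-trans lo₂≥ lo₂≤lo₃) lo₃≤ below₃ above₃ lv₃ lo₃≡
          (fixed-trans fx (fixed-trans (fixed-setReg {r = rStep} refl)
            (fixed {loopReg} {ownMem} (halve Q) avoids-halve u₃))) }
      where
      ready₂′ : Ready I τ₂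
      ready₂′ = keepFixed I (body⇒protected (loop⇒body fx)) ready₂
    step₁ : ∀ τ₁ → Live τ₁ → Outcome lo (2 ^ E) i τ₁ → Fixed testReg ownMem σ₂ τ₁ →
            ∃[ a ] HaltsWithin w (gallop Q ⨾ op shr rStep rStep rOne ⨾ halve Q ⨾ check Q ⨾
                                  op add rPos rPos rOne ⨾ op sub rCount rCount rOne) τ₁
              ((1 + a * (2 + testCost)) + (1 + ((1 + E * (4 + testCost)) + (checkCost + 2)))) (Post a)
    step₁ τ₁ lv₁ outcome fx
      with gallop-spec (suc n) (m≤n+m (suc n) lo) (keepFixed I (body⇒protected (loop⇒body (test⇒loop fx))) ready₂) lv₁
             (trans (fixedReg fx rLo refl) lo≡) lo≤ (fixedReg fx rStep refl) (1≤2^ E) (fixedReg fx rPat refl) i< below outcome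
    ... | a , h = a , (framed h then λ { τ₂ ((lv₂ , (lo₂ , lo₂≡ , lo₂≥ , lo₂≤ , below₂ , above₂) , step≡) , u₂) →
        step₂ {a} {lo₂} {τ₂} lo₂≥ lo₂≤ below₂ above₂ lv₂ lo₂≡ step≡
          (fixed-trans (test⇒loop fx) (fixed {loopReg} {ownMem} (gallop Q) avoids-gallop u₂)) })
    main : ∃[ a ] HaltsWithin w (test Q ⨾ gallop Q ⨾ op shr rStep rStep rOne ⨾ halve Q ⨾ check Q ⨾
                                 op add rPos rPos rOne ⨾ op sub rCount rCount rOne) σ₂
             (testCost + ((1 + a * (2 + testCost)) + (1 + ((1 + E * (4 + testCost)) + (checkCost + 2))))) (Post a)
    main = amortize (framed (test-spec ready₂ (live-setReg rStep refl (live-setReg rPat refl lv)) lo≡ lo≤ refl (1≤2^ E) refl i<))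
      λ { τ₁ ((lv₁ , outcome) , u₁) → step₁ τ₁ lv₁ outcome (fixed {testReg} {ownMem} (test Q) avoids-test u₁) }

  module _ (A : ℕ → ℕ) (A< : ∀ p → p < k → A p < k)
           (sorted : ∀ p p′ → p ≤ p′ → p′ < k → key-of (A p) ≤ key-of (A p′)) where

    FoundBefore : ℕ → ℕ → Set
    FoundBefore f pos = (f ≡ 1 × ∃[ i ] i < k × Found i) ⊎ (f ≡ 0 × (∀ p → p < pos → ¬ Found (A p)))

    -- `lo` is never reset: since keys do not decrease along `A`, `Below lo` passes on to all later
    -- patterns. The strides of all searches therefore add up within one traversal of the array,
    -- whence `lo + a * 2 ^ E ≤ n` for their total number.
    searchAll-spec : ∀ c {σ pos lo} → pos + c ≡ k → Ready I σ → Live σ → reg σ rPos ≡ pos → reg σ rCount ≡ c →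
                     (∀ p → p < k → mem σ 3 p ≡ A p) → reg σ rLo ≡ lo → lo ≤ n →
                     (∀ p → pos ≤ p → p < k → Below lo (A p)) → FoundBefore (reg σ rFound) pos →
                     ∃[ a ] HaltsWithin w (while rCount (searchOne Q)) σ (1 + (c * suc oneCost + a * (2 + testCost)))
                       (λ τ → FoundBefore (reg τ rFound) k × lo + a * 2 ^ E ≤ n)
    searchAll-spec zero {lo = lo} pos+c ready lv pos≡ c≡ A≡ lo≡ lo≤ below found =
      0 , whileFalse c≡ (subst (FoundBefore _) (trans (sym (+-identityʳ _)) pos+c) found , ≤-trans (≤-reflexive (+-identityʳ lo)) lo≤)
    searchAll-spec (suc c) {σ} {pos} {lo} pos+c ready lv pos≡ c≡ A≡ lo≡ lo≤ below found =
      continue (searchOne-spec ready lv pos≡ pos<k (A≡ pos pos<k) (A< pos pos<k) c≡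
        (≤-trans (m≤n+m (suc c) pos) (≤-reflexive pos+c)) lo≡ lo≤ (below pos ≤-refl pos<k))
      where
      pos<k : pos < k
      pos<k = ≤-trans (m<m+n pos (s≤s z≤n)) (≤-reflexive pos+c)
      regroup : ∀ o b a a′ x → 1 + ((o + a * b) + (1 + (x + a′ * b))) ≡ 1 + (((1 + o) + x) + (a + a′) * b)
      regroup = solve-∀
      bound : ∀ a a′ {lo′} → lo + a * 2 ^ E ≤ lo′ → lo + (a + a′) * 2 ^ E ≤ lo′ + a′ * 2 ^ E
      bound a a′ le = ≤-trans (≤-reflexive (regroup′ lo a a′ (2 ^ E))) (+-monoˡ-≤ (a′ * 2 ^ E) le)
        where
        regroup′ : ∀ l a a′ x → l + (a + a′) * x ≡ l + a * x + a′ * x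
        regroup′ = solve-∀
      merge : ∀ {f f′} → FoundBefore f pos → (f′ ≡ 1 × Found (A pos)) ⊎ (f′ ≡ f × ¬ Found (A pos)) → FoundBefore f′ (suc pos)
      merge _                  (inj₁ (refl , yes!))  = inj₁ (refl , A pos , A< pos pos<k , yes!)
      merge (inj₁ (refl , is!)) (inj₂ (refl , _))    = inj₁ (refl , is!)
      merge (inj₂ (refl , no!)) (inj₂ (refl , no!′)) = inj₂ (refl , λ p p< → case m≤n⇒m<n∨m≡n (s≤s⁻¹ p<) of λ
        { (inj₁ p<pos) → no! p p<pos ; (inj₂ refl) → no!′ })
      Post : ℕ → State → Set
      Post a τ = FoundBefore (reg τ rFound) k × lo + a * 2 ^ E ≤ n
      onward : ∀ {a τ} → (reg τ rPos ≡ suc pos × reg τ rCount ≡ c) × OnePost (A pos) (reg σ rFound) lo a τ →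
               Fixed protectedReg ownMem σ τ →
               ∃[ a′ ] HaltsWithin w (while rCount (searchOne Q)) τ (1 + (c * suc oneCost + a′ * (2 + testCost))) (Post (a + a′))
      onward {a} {τ} ((pos≡′ , c≡′) , lv′ , (lo′ , lo′≡ , lo′≥ , lo′≤ , below′) , found′) fx =
        rephrase (searchAll-spec c (trans (sym (+-suc pos c)) pos+c)
          (keepFixed I (fixed-mono (λ _ p → p) protected⇒own fx) ready)
          lv′ pos≡′ c≡′ (λ p p< → trans (fixedMem fx 3 refl p) (A≡ p p<)) lo′≡ lo′≤
          (λ p pos< p< j valid r≤ → ≤-trans (below′ j valid r≤) (sorted pos p (<⇒≤ pos<) p<))
          (merge found found′))
        where
        rephrase : ∃[ a′ ] HaltsWithin w (while rCount (searchOne Q)) τ (1 + (c * suc oneCost + a′ * (2 + testCost))) (λ υ → FoundBefore (reg υ rFound) k × lo′ + a′ * 2 ^ E ≤ n) →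
                   ∃[ a′ ] HaltsWithin w (while rCount (searchOne Q)) τ (1 + (c * suc oneCost + a′ * (2 + testCost))) (Post (a + a′))
        rephrase (a′ , h) = a′ , finally h λ υ (found″ , lo″≤) → found″ , ≤-trans (bound a a′ lo′≥) lo″≤
      continue : ∃[ a ] HaltsWithin w (searchOne Q) σ (oneCost + a * (2 + testCost))
                   (λ τ → (reg τ rPos ≡ suc pos × reg τ rCount ≡ c) × OnePost (A pos) (reg σ rFound) lo a τ) →
                 ∃[ a ] HaltsWithin w (while rCount (searchOne Q)) σ (1 + (suc c * suc oneCost + a * (2 + testCost))) (Post a)
      continue (a , u , τ , run , le , post) =
        total (onward {a} {τ} post (fixed {protectedReg} {ownMem} (searchOne Q) avoids-searchOne (unchanged run)))
        where
        total : ∃[ a′ ] HaltsWithin w (while rCount (searchOne Q)) τ (1 + (c * suc oneCost + a′ * (2 + testCost))) (Post (a + a′)) →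
                ∃[ a ] HaltsWithin w (while rCount (searchOne Q)) σ (1 + (suc c * suc oneCost + a * (2 + testCost))) (Post a)
        total (a′ , h) = a + a′ , within (≤-reflexive (regroup oneCost (2 + testCost) a a′ (c * suc oneCost)))
          (whileTrue {Mid = _≡ τ} (λ c≡0 → case trans (sym c≡) c≡0 of λ ()) (u , τ , run , le , refl) λ { _ refl → h })

-- Radix sort: one pass on lists

AllPairs-universal : ∀ {A : Set} {R : A → A → Set} → (∀ x y → R x y) → ∀ xs → AllPairs R xs
AllPairs-universal r []       = []
AllPairs-universal r (x ∷ xs) = All.universal (r x) xs ∷ AllPairs-universal r xs

module Pass (g : ℕ → ℕ) where

  bucket : ℕ → List ℕ → List ℕ
  bucket v = filterᵇ (λ i → g i ≡ᵇ v)

  -- A bucket as the linked list holds it: entries are pushed at its head, hence in reverse.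
  stack : ℕ → List ℕ → List ℕ → List ℕ
  stack v []      a = a
  stack v (i ∷ L) a = stack v L (if g i ≡ᵇ v then i ∷ a else a)

  -- Popping a stack while the output is written from its end reverses it a second time. This is why
  -- the pass is stable.
  stack-ʳ++ : ∀ v L a acc → stack v L a ʳ++ acc ≡ a ʳ++ (bucket v L ++ acc)
  stack-ʳ++ v []      a acc = refl
  stack-ʳ++ v (i ∷ L) a acc with g i ≡ᵇ v
  ... | true  = stack-ʳ++ v L (i ∷ a) acc
  ... | false = stack-ʳ++ v L a acc

  length-stack : ∀ v L a → length (stack v L a) ≡ length (bucket v L) + length a
  length-stack v []      a = refl
  length-stack v (i ∷ L) a with g i ≡ᵇ v
  ... | true  = trans (length-stack v L (i ∷ a)) (+-suc _ _)
  ... | false = length-stack v L a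

  gather : ℕ → List ℕ → List ℕ → List ℕ
  gather zero    L acc = acc
  gather (suc v) L acc = gather v L (bucket v L ++ acc)

  count : ℕ → List ℕ → ℕ
  count zero    L = 0
  count (suc v) L = length (bucket v L) + count v L

  length-gather : ∀ v L acc → length (gather v L acc) ≡ count v L + length acc
  length-gather zero    L acc = refl
  length-gather (suc v) L acc = begin
    length (gather v L (bucket v L ++ acc))            ≡⟨ length-gather v L _ ⟩
    count v L + length (bucket v L ++ acc)             ≡⟨ cong (count v L +_) (length-++ (bucket v L)) ⟩
    count v L + (length (bucket v L) + length acc)     ≡⟨ regroup (count v L) (length (bucket v L)) (length acc) ⟩
    length (bucket v L) + count v L + length acc       ∎
    where
    open ≡-Reasoning
    regroup : ∀ a c d → a + (c + d) ≡ c + a + d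
    regroup = solve-∀

  count-[] : ∀ v → count v [] ≡ 0
  count-[] zero    = refl
  count-[] (suc v) = count-[] v

  count-∷-≥ : ∀ v i L → v ≤ g i → count v (i ∷ L) ≡ count v L
  count-∷-≥ zero    i L _  = refl
  count-∷-≥ (suc v) i L v< rewrite ≢⇒≡ᵇ-false {g i} {v} (λ e → <⇒≢ v< (sym e)) =
    cong (length (bucket v L) +_) (count-∷-≥ v i L (<⇒≤ v<))

  count-∷-< : ∀ v i L → g i < v → count v (i ∷ L) ≡ suc (count v L)
  count-∷-< (suc v) i L (s≤s g≤) with bit-≡ᵇ (g i) v | m≤n⇒m<n∨m≡n g≤
  ... | _ | inj₁ g< rewrite ≢⇒≡ᵇ-false {g i} {v} (<⇒≢ g<) =
    trans (cong (length (bucket v L) +_) (count-∷-< v i L g<)) (+-suc _ _)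
  ... | d | inj₂ refl with g i ≡ᵇ g i | d
  ...   | true  | _              = cong (λ z → suc (length (bucket (g i) L) + z)) (count-∷-≥ (g i) i L ≤-refl)
  ...   | false | inj₂ (_ , neq) = ⊥-elim (neq refl)

  count-all : ∀ {v} L → All (λ i → g i < v) L → count v L ≡ length L
  count-all {v} []      []       = count-[] v
  count-all {v} (i ∷ L) (g< ∷ L<) = trans (count-∷-< v i L g<) (cong suc (count-all L L<))

  bucket-All : ∀ {P : ℕ → Set} v {L} → All P L → All P (bucket v L)
  bucket-All v {[]}    []       = []
  bucket-All v {i ∷ L} (p ∷ ps) with g i ≡ᵇ v
  ... | true  = p ∷ bucket-All v ps
  ... | false = bucket-All v ps

  bucket-digit : ∀ v L → All (λ i → g i ≡ v) (bucket v L)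
  bucket-digit v []      = []
  bucket-digit v (i ∷ L) with bit-≡ᵇ (g i) v
  ... | d with g i ≡ᵇ v | d
  ...   | true  | inj₁ (_ , g≡) = g≡ ∷ bucket-digit v L
  ...   | false | _             = bucket-digit v L

  bucket-∈ : ∀ {i} {L} → i ∈ L → i ∈ bucket (g i) L
  bucket-∈ {i} {j ∷ L} (ListAny.here refl) with bit-≡ᵇ (g i) (g i)
  ... | d with g i ≡ᵇ g i | d
  ...   | true  | _              = ListAny.here refl
  ...   | false | inj₂ (_ , neq) = ⊥-elim (neq refl)
  bucket-∈ {i} {j ∷ L} (ListAny.there i∈) with g j ≡ᵇ g i
  ... | true  = ListAny.there (bucket-∈ i∈)
  ... | false = bucket-∈ i∈

  gather-All : ∀ {P : ℕ → Set} v {L acc} → All P L → All P acc → All P (gather v L acc)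
  gather-All zero    pL pa = pa
  gather-All (suc v) pL pa = gather-All v pL (All.++⁺ (bucket-All v pL) pa)

  gather-acc : ∀ v {L acc i} → i ∈ acc → i ∈ gather v L acc
  gather-acc zero    i∈ = i∈
  gather-acc (suc v) i∈ = gather-acc v (∈-++⁺ʳ _ i∈)

  gather-∈ : ∀ v {L acc i} → i ∈ L → g i < v → i ∈ gather v L acc
  gather-∈ (suc v) {L} i∈ (s≤s g≤) with m≤n⇒m<n∨m≡n g≤
  ... | inj₁ g<   = gather-∈ v i∈ g<
  ... | inj₂ refl = gather-acc v (∈-++⁺ˡ (bucket-∈ i∈))

  module _ (R : ℕ → ℕ → Set) where

    Refined : ℕ → ℕ → Set
    Refined i j = g i < g j ⊎ (g i ≡ g j × R i j)

    bucket-sorted : ∀ v {L} → AllPairs R L → AllPairs Refined (bucket v L)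
    bucket-sorted v {[]}    []       = []
    bucket-sorted v {i ∷ L} (r ∷ rs) with bit-≡ᵇ (g i) v
    ... | d with g i ≡ᵇ v | d
    ...   | true  | inj₁ (_ , g≡) =
      All.zipWith (λ (g≡′ , rij) → inj₂ (trans g≡ (sym g≡′) , rij)) (bucket-digit v L , bucket-All v r) ∷ bucket-sorted v rs
    ...   | false | _             = bucket-sorted v rs

    -- Within a bucket the old order `R` survives by stability. What has been collected before has
    -- larger digits only, so that a bucket may be put in front of it.
    gather-sorted : ∀ v {L acc} → AllPairs R L → AllPairs Refined acc → All (λ i → v ≤ g i) acc →
                    AllPairs Refined (gather v L acc)
    gather-sorted zero    sL sa ≥a = sa
    gather-sorted (suc v) {L} sL sa ≥a = gather-sorted v sL
      (AllPairs.++⁺ (bucket-sorted v sL) sa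
        (All.map (λ { refl → All.map inj₁ ≥a }) (bucket-digit v L)))
      (All.++⁺ (All.map (λ { refl → ≤-refl }) (bucket-digit v L)) (All.map <⇒≤ ≥a))

-- Lists in memory: as array segments, and as linked lists of the cells up to N
-- with the values in μ and the links in ν, where 0 is the empty list.

Seg : (ℕ → ℕ) → ℕ → List ℕ → Set
Seg μ s []      = ⊤
Seg μ s (i ∷ L) = μ s ≡ i × Seg μ (suc s) L

seg-cong : ∀ {μ μ′} L {s} → (∀ p → s ≤ p → μ′ p ≡ μ p) → Seg μ s L → Seg μ′ s L
seg-cong []      eqs seg = tt
seg-cong (i ∷ L) eqs (μs≡ , seg) = trans (eqs _ ≤-refl) μs≡ , seg-cong L (λ p s< → eqs p (<⇒≤ s<)) seg

seg-All : ∀ {μ} {P : ℕ → Set} L s → Seg μ s L → All P L → ∀ p → p < length L → P (μ (s + p))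
seg-All {μ} {P} (i ∷ L) s (refl , seg) (pi ∷ ps) zero    _        = subst (P ∘ μ) (sym (+-identityʳ s)) pi
seg-All {μ} {P} (i ∷ L) s (refl , seg) (pi ∷ ps) (suc p) (s≤s p<) =
  subst (P ∘ μ) (sym (+-suc s p)) (seg-All L (suc s) seg ps p p<)

seg-∈ : ∀ {μ i} L s → Seg μ s L → i ∈ L → ∃[ p ] p < length L × μ (s + p) ≡ i
seg-∈ {μ} (_ ∷ L) s (μs≡ , seg) (ListAny.here refl) = 0 , s≤s z≤n , trans (cong μ (+-identityʳ s)) μs≡
seg-∈ {μ} (_ ∷ L) s (μs≡ , seg) (ListAny.there i∈) with seg-∈ L (suc s) seg i∈
... | p , p< , ≡i = suc p , s≤s p< , trans (cong μ (+-suc s p)) ≡i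

seg-pairs : ∀ {μ} {R : ℕ → ℕ → Set} L s → Seg μ s L → AllPairs R L →
            ∀ p p′ → p < p′ → p′ < length L → R (μ (s + p)) (μ (s + p′))
seg-pairs {μ} {R} (i ∷ L) s (refl , seg) (r ∷ rs) zero    (suc p′) _        (s≤s p′<) =
  subst₂ R (cong μ (sym (+-identityʳ s))) (cong μ (sym (+-suc s p′))) (seg-All {μ} {R (μ s)} L (suc s) seg r p′ p′<)
seg-pairs {μ} {R} (i ∷ L) s (refl , seg) (r ∷ rs) (suc p) (suc p′) (s≤s p<) (s≤s p′<) =
  subst₂ R (cong μ (sym (+-suc s p))) (cong μ (sym (+-suc s p′))) (seg-pairs L (suc s) seg rs p p′ p< p′<)

range : ℕ → ℕ → List ℕ
range s zero    = []
range s (suc c) = s ∷ range (suc s) c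

seg-range : ∀ {μ} s c → (∀ p → p < s + c → μ p ≡ p) → Seg μ s (range s c)
seg-range s zero    eqs = tt
seg-range s (suc c) eqs = eqs s (m<m+n s (s≤s z≤n)) , seg-range (suc s) c (λ p p< → eqs p (≤-trans p< (≤-reflexive (sym (+-suc s c)))))

length-range : ∀ s c → length (range s c) ≡ c
length-range s zero    = refl
length-range s (suc c) = cong suc (length-range (suc s) c)

range-< : ∀ s c → All (_< s + c) (range s c)
range-< s zero    = []
range-< s (suc c) = m<m+n s (s≤s z≤n) ∷ subst (λ e → All (_< e) (range (suc s) c)) (sym (+-suc s c)) (range-< (suc s) c)

∈-range : ∀ s c {i} → s ≤ i → i < s + c → i ∈ range s c
∈-range s zero    s≤ i< = ⊥-elim (<⇒≱ i< (≤-trans (≤-reflexive (+-identityʳ s)) s≤))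
∈-range s (suc c) s≤ i< with m≤n⇒m<n∨m≡n s≤
... | inj₂ refl = ListAny.here refl
... | inj₁ s<   = ListAny.there (∈-range (suc s) c s< (≤-trans i< (≤-reflexive (+-suc s c))))

Chain : (μ ν : ℕ → ℕ) → ℕ → ℕ → List ℕ → Set
Chain μ ν N c []      = c ≡ 0
Chain μ ν N c (i ∷ L) = (1 ≤ c × c ≤ N) × μ c ≡ i × Chain μ ν N (ν c) L

-- Cells are allocated in increasing order, so writing a new one, beyond `N`, disturbs none of the
-- existing chains.
chain-cong : ∀ {μ ν μ′ ν′ N N′} → N ≤ N′ → (∀ c → c ≤ N → μ′ c ≡ μ c) → (∀ c → c ≤ N → ν′ c ≡ ν c) →
             ∀ L {c} → Chain μ ν N c L → Chain μ′ ν′ N′ c L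
chain-cong N≤ μ≡ ν≡ []      c≡0 = c≡0
chain-cong {μ} {ν} {μ′} {ν′} {N} {N′} N≤ μ≡ ν≡ (i ∷ L) {c} ((1≤c , c≤) , μc≡ , chain) =
  (1≤c , ≤-trans c≤ N≤) , trans (μ≡ c c≤) μc≡ ,
  subst (λ z → Chain μ′ ν′ N′ z L) (sym (ν≡ c c≤)) (chain-cong N≤ μ≡ ν≡ L chain)

-- Radix sort: the program

-- Cells are numbered from 1, as a link 0 ends a list. `collect` clears each head when it takes the
-- list over, so that the next pass finds empty buckets at no further cost. The patterns themselves
-- never move; only their indices are sorted.
distribute pop collect sortDigit sortWord sortAll : Program

distribute =
  load rPat 3 rPos ⨾
  patternWord ⨾
  op shr rR rR rOff ⨾
  op mod rR rR rBase ⨾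
  op add rPos rPos rOne ⨾
  store 4 rPos rPat ⨾
  load rTmp 6 rR ⨾
  store 5 rPos rTmp ⨾
  store 6 rR rPos ⨾
  op sub rCount rCount rOne

pop =
  op sub rLo rLo rOne ⨾
  load rPat 4 rTmp ⨾
  store 3 rLo rPat ⨾
  load rTmp 5 rTmp

collect =
  op sub rStep rStep rOne ⨾
  load rTmp 6 rStep ⨾
  store 6 rStep rZero ⨾
  while rTmp pop

sortDigit =
  op mul rOff rAt rB ⨾
  const rPos 0 ⨾
  op add rCount rK rZero ⨾
  while rCount distribute ⨾
  op add rLo rK rZero ⨾
  op add rStep rBase rZero ⨾
  while rStep collect ⨾
  op add rAt rAt rOne ⨾
  op sub rWord rWord rOne

sortWord =
  op sub rT rT rOne ⨾
  const rAt 0 ⨾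
  op add rWord rDigits rZero ⨾
  while rWord sortDigit

sortAll =
  op add rT rLen rZero ⨾
  while rT sortWord

module _ (I : Instance) where
  open Instance I
  open Values w
  open Ready

  private
    k<2^w′ : k < 2 ^ w
    k<2^w′ = ≤-<-trans (m≤m*n k words) fits

  Listed : State → List ℕ → Set
  Listed τ L = Seg (mem τ 3) 0 L × (∀ v → v < 2 ^ b → mem τ 6 v ≡ 0)

  -- That is, `L` is a permutation of the indices below `k`, in a form that is easily carried
  -- through a pass.
  Complete : List ℕ → Set
  Complete L = length L ≡ k × All (_< k) L × (∀ i → i < k → i ∈ L)

  pop-spec : ∀ l {τ c out acc} → Ready I τ → reg τ rTmp ≡ c → Chain (mem τ 4) (mem τ 5) k c l →
             reg τ rLo ≡ length l + out → length l + out < 2 ^ w → Seg (mem τ 3) (length l + out) acc →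
             HaltsWithin w (while rTmp pop) τ (1 + length l * 5)
               (λ υ → reg υ rLo ≡ out × Seg (mem υ 3) out (l ʳ++ acc))
  pop-spec []      ready c≡ c≡0 lo≡ lo< seg = whileFalse (trans c≡ c≡0) (lo≡ , seg)
  pop-spec (i ∷ l) {τ} {c} {out} {acc} ready c≡ ((1≤c , _) , μc≡ , chain) lo≡ lo< seg =
    whileTrue (λ c≡0 → <⇒≢ 1≤c (sym (trans (sym c≡) c≡0)))
      (opStep (sub-value lo≡ (one≡ ready) (s≤s z≤n) lo<) $
       loadStep (trans (cong (mem τ 4) c≡) μc≡) $
       storeStep (is s) (is i) $
       popped)
      λ { υ (ready′ , c≡′ , chain′ , lo≡′ , seg′) → pop-spec l ready′ c≡′ chain′ lo≡′ (<-trans (n<1+n s) lo<) seg′ }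
    where
    s = length l + out
    σ₁ = setMem 3 s i (setReg rPat i (setReg rLo s τ))
    popped : HaltsWithin w (load rTmp 5 rTmp) σ₁ 1
               (λ υ → Ready I υ × reg υ rTmp ≡ mem τ 5 c × Chain (mem υ 4) (mem υ 5) k (mem τ 5 c) l ×
                      reg υ rLo ≡ s × Seg (mem υ 3) s (i ∷ acc))
    popped = 1 , _ , load , s≤s z≤n ,
      ( keep-setReg I refl (keep-setMem I refl (keep-setReg I refl (keep-setReg I refl ready)))
      , cong (mem τ 5) c≡ , chain , refl , updated (mem τ 3) s i
      , seg-cong acc (λ p s< → not-updated (mem τ 3) i (λ e → <⇒≢ s< (sym e))) seg )

  module _ (t q : ℕ) (t< : t < words) (q< : q < digits) where

    digit : ℕ → ℕ
    digit i = truncate b (rev w (pattern′ D i >> (t * w)) >> (q * b))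

    open Pass digit

    digit-<-base : ∀ i → digit i < 2 ^ b
    digit-<-base i = truncate-< b _

    -- `R` is what remains to be distributed and `acc v` is bucket `v` so far. The last clause says
    -- that pushing `R` will complete the bucket, and becomes the result when `R` is empty.
    DInv : List ℕ → ℕ → State → Set
    DInv L c τ = Σ[ pos ∈ ℕ ] Σ[ R ∈ List ℕ ] Σ[ acc ∈ (ℕ → List ℕ) ] pos + c ≡ k × reg τ rPos ≡ pos × length R ≡ c × All (_< k) R ×
                 Seg (mem τ 3) pos R ×
                 (∀ v → v < 2 ^ b → Chain (mem τ 4) (mem τ 5) pos (mem τ 6 v) (acc v)) ×
                 (∀ v → stack v R (acc v) ≡ stack v L [])

    -- The primed functions are the memory after a pattern word has been read and reversed, which is
    -- known to agree with the earlier one only pointwise.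
    push : ∀ {μ ν f μ′ ν′ f′ : ℕ → ℕ} {pos i d} (acc : ℕ → List ℕ) →
           (∀ a → μ′ a ≡ μ a) → (∀ a → ν′ a ≡ ν a) → (∀ a → f′ a ≡ f a) → ∀ v →
           Chain μ ν pos (f v) (acc v) →
           Chain (μ′ [ suc pos ↦ i ]) (ν′ [ suc pos ↦ f′ d ]) (suc pos) ((f′ [ d ↦ suc pos ]) v)
                 (if d ≡ᵇ v then i ∷ acc v else acc v)
    push {μ} {ν} {f} {μ′} {ν′} {f′} {pos} {i} {d} acc μ≡ ν≡ f≡ v chain = cases (v ≟ d)
      where
      μ″ = μ′ [ suc pos ↦ i ]
      ν″ = ν′ [ suc pos ↦ f′ d ]
      lifted : Chain μ″ ν″ (suc pos) (f v) (acc v)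
      lifted = chain-cong (n≤1+n pos)
        (λ c c≤ → trans (not-updated μ′ i (<⇒≢ (s≤s c≤))) (μ≡ c))
        (λ c c≤ → trans (not-updated ν′ (f′ d) (<⇒≢ (s≤s c≤))) (ν≡ c)) (acc v) chain
      cases : Dec (v ≡ d) → Chain μ″ ν″ (suc pos) ((f′ [ d ↦ suc pos ]) v) (if d ≡ᵇ v then i ∷ acc v else acc v)
      cases (no v≢d) rewrite ≢⇒≡ᵇ-false {d} {v} (v≢d ∘ sym) | not-updated f′ (suc pos) v≢d | f≡ v = lifted
      cases (yes refl) with v ≡ᵇ v | bit-≡ᵇ v v
      ... | false | inj₂ (_ , neq) = ⊥-elim (neq refl)
      ... | true  | _ = (s≤s z≤n , ≤-refl) , updated μ′ (suc pos) i ,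
        subst (λ z → Chain μ″ ν″ (suc pos) z (acc v)) (sym (trans (updated ν′ (suc pos) (f′ v)) (f≡ v))) lifted

    distribute-spec : ∀ {σ L} → Ready I σ → reg σ rT ≡ t → reg σ rOff ≡ q * b → reg σ rPos ≡ 0 → reg σ rCount ≡ k →
                      Listed σ L → Complete L →
                      HaltsWithin w (while rCount distribute) σ (suc (k * suc (12 + revCost I)))
                        (λ τ → ∀ v → v < 2 ^ b → Chain (mem τ 4) (mem τ 5) k (mem τ 6 v) (stack v L []))
    distribute-spec {σ} {L} ready t≡ off≡ pos≡ c≡ (seg , clear) (len , L< , _) =
      finally (countdown (DInv L) step k c≡ (0 , L , (λ (_ : ℕ) → []) , refl , pos≡ , len , L< , seg , clear , λ _ → refl))
        λ { τ (pos , [] , acc , pos≡k , _ , _ , _ , _ , chains , eqs) v v< →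
              subst₂ (λ N l → Chain (mem τ 4) (mem τ 5) N (mem τ 6 v) l) (trans (sym (+-identityʳ pos)) pos≡k) (eqs v) (chains v v<)
          ; τ (pos , i ∷ R , acc , _ , _ , () , _) }
      where
      step : ∀ c τ → Unchanged distribute σ τ → reg τ rCount ≡ suc c → DInv L (suc c) τ →
             HaltsWithin w distribute τ (12 + revCost I) (λ υ → reg υ rCount ≡ c × DInv L c υ)
      step c τ unch c≡ (pos , i ∷ R , acc , pos+c , pos≡ , len , i< ∷ R< , (i≡ , seg) , chains , eqs) =
        within (≤-reflexive (regroup (revCost I))) $
        loadStep (trans (cong (mem τ 3) pos≡) i≡) $
        framed (patternWord-spec I (keep-setReg I refl ready′) (is i) (trans (Unchanged.regs unch rT refl) t≡) i< t<)
        then λ τ₁ (r≡ , u) → pushed τ₁ r≡ u (keep I patternWord refl u (keep-setReg I refl ready′))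
        where
        ready′ = keep I distribute refl unch ready
        regroup : ∀ c → 1 + ((3 + c) + 8) ≡ 12 + c
        regroup = solve-∀
        d = digit i
        pos<k : pos < k
        pos<k = ≤-trans (m<m+n pos (s≤s z≤n)) (≤-reflexive pos+c)
        pushed : ∀ τ₁ → reg τ₁ rR ≡ rev w (pattern′ D i >> (t * w)) → Unchanged patternWord (setReg rPat i τ) τ₁ → Ready I τ₁ →
                 HaltsWithin w (op shr rR rR rOff ⨾ op mod rR rR rBase ⨾ op add rPos rPos rOne ⨾ store 4 rPos rPat ⨾
                                load rTmp 6 rR ⨾ store 5 rPos rTmp ⨾ store 6 rR rPos ⨾ op sub rCount rCount rOne) τ₁ 8
                   (λ υ → reg υ rCount ≡ c × DInv L c υ)
        pushed τ₁ r≡ u ready₁ =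
          opStep (shr-value r≡ (trans (Unchanged.regs u rOff refl) (trans (Unchanged.regs unch rOff refl) off≡))) $
          opStep (mod-value ⦃ 2^≢0 b ⦄ (is (rev w (pattern′ D i >> (t * w)) >> (q * b))) (base≡ ready₁)) $
          opStep (trans (add-value (trans (Unchanged.regs u rPos refl) pos≡) (one≡ ready₁)
                    (≤-<-trans (≤-trans (≤-reflexive (+-comm pos 1)) pos<k) k<2^w′)) (+-comm pos 1)) $
          storeStep (is (suc pos)) (Unchanged.regs u rPat refl) $
          loadStep (is (mem τ₁ 6 d)) $
          storeStep (is (suc pos)) (is (mem τ₁ 6 d)) $
          storeStep (is d) (is (suc pos)) $
          opLast (sub-value (trans (Unchanged.regs u rCount refl) c≡) (one≡ ready₁) (s≤s z≤n)
                   (≤-<-trans (≤-trans (m≤n+m (suc c) pos) (≤-reflexive pos+c)) k<2^w′))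
            ( refl , suc pos , R , (λ v → if d ≡ᵇ v then i ∷ acc v else acc v)
            , trans (sym (+-suc pos c)) pos+c , refl , suc-injective len , R<
            , seg-cong R (λ p _ → Unchanged.mems u 3 refl p) seg
            , (λ v v< → push acc (Unchanged.mems u 4 refl) (Unchanged.mems u 5 refl) (Unchanged.mems u 6 refl) v (chains v v<))
            , eqs )

    -- The output is filled from its end, so `out` is the number of entries in the buckets still to
    -- be emptied. The time is amortized: 5 steps for each bucket and 5 for each entry.
    collect-spec : ∀ v {τ L out acc} → Ready I τ → v ≤ 2 ^ b → reg τ rStep ≡ v → reg τ rLo ≡ out → out ≡ count v L →
                   out ≤ k → Seg (mem τ 3) out acc →
                   (∀ u → u < v → Chain (mem τ 4) (mem τ 5) k (mem τ 6 u) (stack u L [])) →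
                   (∀ u → v ≤ u → u < 2 ^ b → mem τ 6 u ≡ 0) →
                   HaltsWithin w (while rStep collect) τ (1 + (v * 5 + out * 5)) (λ υ → Listed υ (gather v L acc))
    collect-spec zero    {out = out} {acc} ready v≤ v≡ lo≡ out≡ out≤ seg chains clear =
      whileFalse v≡ (subst (λ s → Seg _ s acc) out≡ seg , λ u u< → clear u z≤n u<)
    collect-spec (suc v) {τ} {L} {out} {acc} ready v≤ v≡ lo≡ out≡ out≤ seg chains clear =
      within (≤-reflexive time) $
      whileTrue (λ v≡0 → case trans (sym v≡) v≡0 of λ ())
        (opStep (sub-value v≡ (one≡ ready) (s≤s z≤n) (≤-<-trans v≤ 2^b<2^w)) $
         loadStep (is (mem τ 6 v)) $
         storeStep (is v) (zero≡ ready) $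
         framed (pop-spec l {out = count v L} {acc} ready₁ refl (chains v ≤-refl)
                  (trans lo≡ out≡′) (≤-<-trans (≤-trans (≤-reflexive (sym out≡′)) out≤) k<2^w′)
                  (subst (λ s → Seg (mem τ 3) s acc) out≡′ seg)))
        λ { υ ((lo≡′ , seg′) , u) → collect-spec v (keep I (while rTmp pop) refl u ready₁) (<⇒≤ v≤)
              (Unchanged.regs u rStep refl) lo≡′ refl
              (≤-trans (m≤n+m (count v L) (length l)) (≤-trans (≤-reflexive (sym out≡′)) out≤))
              (subst (Seg (mem υ 3) (count v L)) (stack-ʳ++ v L [] acc) seg′)
              (λ x x< → subst (λ c → Chain (mem υ 4) (mem υ 5) k c (stack x L []))
                (sym (trans (Unchanged.mems u 6 refl x) (not-updated (mem τ 6) 0 (<⇒≢ x<))))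
                (chain-cong ≤-refl (λ c _ → Unchanged.mems u 4 refl c) (λ c _ → Unchanged.mems u 5 refl c) (stack x L [])
                  (chains x (m<n⇒m<1+n x<))))
              (λ x v≤x x< → trans (Unchanged.mems u 6 refl x) (cleared x v≤x x<)) }
      where
      l = stack v L []
      σ₁ = setMem 6 v 0 (setReg rTmp (mem τ 6 v) (setReg rStep v τ))
      ready₁ : Ready I σ₁
      ready₁ = keep-setMem I refl (keep-setReg I refl (keep-setReg I refl ready))
      2^b<2^w : 2 ^ b < 2 ^ w
      2^b<2^w = ^-monoʳ-< 2 (s≤s (s≤s z≤n)) b<w
      out≡′ : out ≡ length l + count v L
      out≡′ = trans out≡ (cong (_+ count v L) (sym (trans (length-stack v L []) (+-identityʳ _))))
      cleared : ∀ x → v ≤ x → x < 2 ^ b → (mem τ 6 [ v ↦ 0 ]) x ≡ 0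
      cleared x v≤x x< with m≤n⇒m<n∨m≡n v≤x
      ... | inj₂ refl = updated (mem τ 6) v 0
      ... | inj₁ v<x  = trans (not-updated (mem τ 6) 0 (λ e → <⇒≢ v<x (sym e))) (clear x v<x x<)
      time : 1 + ((3 + (1 + length l * 5)) + (1 + (v * 5 + count v L * 5))) ≡ 1 + (suc v * 5 + out * 5)
      time = trans (regroup (length l) v (count v L)) (cong (λ z → 1 + (suc v * 5 + z * 5)) (sym out≡′))
        where
        regroup : ∀ l v c → 1 + ((3 + (1 + l * 5)) + (1 + (v * 5 + c * 5))) ≡ 1 + (suc v * 5 + (l + c) * 5)
        regroup = solve-∀

    gather-complete : ∀ {L} → Complete L → Complete (gather (2 ^ b) L [])
    gather-complete {L} (len , L< , L∋) =
      trans (length-gather (2 ^ b) L []) (trans (+-identityʳ _) (trans (count-all L (All.universal digit-<-base L)) len)) ,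
      gather-All (2 ^ b) L< [] , λ i i< → gather-∈ (2 ^ b) (L∋ i i<) (digit-<-base i)

    digitCost : ℕ
    digitCost = 3 + (suc (k * suc (12 + revCost I)) + (2 + ((1 + (2 ^ b * 5 + k * 5)) + 2)))

    sortDigit-spec : ∀ {σ c L} → Ready I σ → reg σ rT ≡ t → reg σ rAt ≡ q → reg σ rWord ≡ suc c → suc c ≤ digits →
                     Listed σ L → Complete L →
                     HaltsWithin w sortDigit σ digitCost (λ τ →
                       reg τ rAt ≡ suc q × reg τ rWord ≡ c × Listed τ (gather (2 ^ b) L []))
    sortDigit-spec {σ} {c} {L} ready t≡ q≡ c≡ c≤ listed complete@(len , _) =
      opStep (mul-value q≡ (b≡ ready) (≤-<-trans (≤-trans (*-monoˡ-≤ b (s≤s⁻¹ q<)) (m/n*n≤m w b ⦃ >-nonZero 1≤b ⦄)) (w<2^w I))) $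
      constStep (truncate-id {w} (1≤2^ w)) $
      opStep (trans (add-value (k≡ ready) (zero≡ ready) k+0<) (+-identityʳ k)) $
      framed (distribute-spec ready₁ t≡ refl refl refl listed complete) then λ τ (chains , u) →
      distributed τ chains u (keep I (while rCount distribute) refl u ready₁)
      where
      k+0< : k + 0 < 2 ^ w
      k+0< = subst (_< 2 ^ w) (sym (+-identityʳ k)) k<2^w′
      σ₁ = setReg rCount k (setReg rPos 0 (setReg rOff (q * b) σ))
      ready₁ : Ready I σ₁
      ready₁ = keep-setReg I refl (keep-setReg I refl (keep-setReg I refl ready))
      count≡k : k ≡ count (2 ^ b) L
      count≡k = sym (trans (count-all L (All.universal digit-<-base L)) len)
      2^b<2^w : 2 ^ b < 2 ^ w
      2^b<2^w = ^-monoʳ-< 2 (s≤s (s≤s z≤n)) b<w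
      digits<2^w : digits < 2 ^ w
      digits<2^w = ≤-<-trans (s≤s (m/n≤m w b ⦃ >-nonZero 1≤b ⦄)) (1+w<2^w I)
      Post : State → Set
      Post τ = reg τ rAt ≡ suc q × reg τ rWord ≡ c × Listed τ (gather (2 ^ b) L [])
      collected : ∀ τ υ → Unchanged (while rCount distribute) σ₁ τ →
                  Unchanged (while rStep collect) (setReg rStep (2 ^ b) (setReg rLo k τ)) υ →
                  Ready I υ → Listed υ (gather (2 ^ b) L []) →
                  HaltsWithin w (op add rAt rAt rOne ⨾ op sub rWord rWord rOne) υ 2 Post
      collected τ υ u u′ ready₃ listed′ =
        opStep (trans (add-value (trans (Unchanged.regs u′ rAt refl) (trans (Unchanged.regs u rAt refl) q≡)) (one≡ ready₃)
                  (≤-<-trans (≤-trans (≤-reflexive (+-comm q 1)) q<) digits<2^w)) (+-comm q 1)) $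
        opLast (sub-value (trans (Unchanged.regs u′ rWord refl) (trans (Unchanged.regs u rWord refl) c≡)) (one≡ ready₃)
                  (s≤s z≤n) (≤-<-trans c≤ digits<2^w))
          (refl , refl , listed′)
      distributed : ∀ τ → (∀ v → v < 2 ^ b → Chain (mem τ 4) (mem τ 5) k (mem τ 6 v) (stack v L [])) →
                    Unchanged (while rCount distribute) σ₁ τ → Ready I τ →
                    HaltsWithin w (op add rLo rK rZero ⨾ op add rStep rBase rZero ⨾ while rStep collect ⨾
                                   op add rAt rAt rOne ⨾ op sub rWord rWord rOne) τ (2 + ((1 + (2 ^ b * 5 + k * 5)) + 2)) Post
      distributed τ chains u ready₂ =
        opStep (trans (add-value (k≡ ready₂) (zero≡ ready₂) k+0<) (+-identityʳ k)) $
        opStep (trans (add-value (base≡ ready₂) (zero≡ ready₂)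
                 (subst (_< 2 ^ w) (sym (+-identityʳ (2 ^ b))) 2^b<2^w)) (+-identityʳ (2 ^ b))) $
        framed (collect-spec (2 ^ b) {L = L} {acc = []} ready₂′ ≤-refl refl refl count≡k ≤-refl tt chains
                 (λ x v≤ x< → ⊥-elim (<⇒≱ x< v≤)))
        then λ υ (listed′ , u′) → collected τ υ u u′ (keep I (while rStep collect) refl u′ ready₂′) listed′
        where
        ready₂′ = keep-setReg I {r = rStep} {x = 2 ^ b} refl (keep-setReg I {r = rLo} {x = k} refl ready₂)

fillOrder sortPatterns : Program

fillOrder =
  op add rCount rK rZero ⨾
  while rCount (op sub rCount rCount rOne ⨾ store 3 rCount rCount)

sortPatterns = fillOrder ⨾ sortAll

-- Radix sort: from digits to words to keys

module _ (I : Instance) where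
  open Instance I
  open Values w
  open Ready

  word : ℕ → ℕ → ℕ
  word t i = rev w (pattern′ D i >> (t * w))

  wordsKey : ℕ → ℕ → ℕ
  wordsKey t i = rev ((words ∸ t) * w) (pattern′ D i >> (t * w))

  wordsKey-split : ∀ {t} → t < words → ∀ i →
                   wordsKey t i ≡ word t i * 2 ^ ((words ∸ suc t) * w) + wordsKey (suc t) i
  wordsKey-split {t} t< i = begin
    rev ((words ∸ t) * w) y                           ≡⟨ cong (λ z → rev (z * w) y) (∸-suc′ t<) ⟩
    rev (w + u) y                                     ≡⟨ rev-+ w u y ⟩
    rev w y * 2 ^ u + rev u (y >> w)
      ≡⟨ cong (λ z → rev w y * 2 ^ u + rev u z)
           (trans (sym (>>-+ (pattern′ D i) (t * w) w)) (cong (pattern′ D i >>_) (+-comm (t * w) w))) ⟩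
    rev w y * 2 ^ u + wordsKey (suc t) i              ∎
    where
    open ≡-Reasoning
    y = pattern′ D i >> (t * w)
    u = (words ∸ suc t) * w
    ∸-suc′ : t < words → words ∸ t ≡ suc (words ∸ suc t)
    ∸-suc′ t< = +-∸-assoc 1 t<

  -- A pattern has no bits beyond `m`, so reversing all its words gives its key times `2 ^ pad`.
  wordsKey-0 : ∀ i j → wordsKey 0 i ≤ wordsKey 0 j → key-of i ≤ key-of j
  wordsKey-0 i j le = *-cancelʳ-≤ (key-of i) (key-of j) (2 ^ pad) ⦃ 2^≢0 pad ⦄ (subst₂ _≤_ (padded i) (padded j) le)
    where
    padded : ∀ i → wordsKey 0 i ≡ key-of i * 2 ^ pad
    padded i = begin
      rev (words * w) (p >> 0)                ≡⟨ cong₂ rev (words*w I) (>>0 p) ⟩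
      rev (m + pad) p                         ≡⟨ rev-+ m pad p ⟩
      rev m p * 2 ^ pad + rev pad (p >> m)
        ≡⟨ cong (λ z → rev m p * 2 ^ pad + rev pad z) (<2^⇒>>≡0 {n = m} (pattern-< D i)) ⟩
      rev m p * 2 ^ pad + rev pad 0           ≡⟨ cong (rev m p * 2 ^ pad +_) (rev-0 pad) ⟩
      rev m p * 2 ^ pad + 0                   ≡⟨ +-identityʳ _ ⟩
      rev m p * 2 ^ pad                       ∎
      where
      open ≡-Reasoning
      p = pattern′ D i

  lowDigits : ℕ → ℕ → ℕ → ℕ
  lowDigits t q i = truncate (q * b) (word t i)

  -- The order reached after `q` passes over word `t`. Passes go from the least significant digit of
  -- the last word upwards, so ties are broken by the later words, sorted before.
  Ordered : ℕ → ℕ → ℕ → ℕ → Set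
  Ordered t q i j = lowDigits t q i < lowDigits t q j ⊎
                    (lowDigits t q i ≡ lowDigits t q j × wordsKey (suc t) i ≤ wordsKey (suc t) j)

  module _ {t q : ℕ} (t< : t < words) (q< : q < digits) where

    open Pass (digit I t q t< q<)

    private
      d = digit I t q t< q<

    lowDigits-suc : ∀ i → lowDigits t (suc q) i ≡ d i * 2 ^ (q * b) + lowDigits t q i
    lowDigits-suc i = begin
      truncate (b + q * b) (word t i)     ≡⟨ cong (λ z → truncate z (word t i)) (+-comm b (q * b)) ⟩
      truncate (q * b + b) (word t i)     ≡⟨ truncate-+ (q * b) b (word t i) ⟩
      lowDigits t q i + 2 ^ (q * b) * d i ≡⟨ trans (+-comm _ (2 ^ (q * b) * d i)) (cong (_+ lowDigits t q i) (*-comm (2 ^ (q * b)) (d i))) ⟩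
      d i * 2 ^ (q * b) + lowDigits t q i ∎
      where open ≡-Reasoning

    refined⇒ordered : ∀ {i j} → Refined (Ordered t q) i j → Ordered t (suc q) i j
    refined⇒ordered {i} {j} refined = subst₂ Goal (sym (lowDigits-suc i)) (sym (lowDigits-suc j)) (goal refined)
      where
      Goal : ℕ → ℕ → Set
      Goal x y = x < y ⊎ (x ≡ y × wordsKey (suc t) i ≤ wordsKey (suc t) j)
      goal : Refined (Ordered t q) i j →
             Goal (d i * 2 ^ (q * b) + lowDigits t q i) (d j * 2 ^ (q * b) + lowDigits t q j)
      goal (inj₁ d<)                   = inj₁ (digit-< {c = lowDigits t q j} d< (truncate-< (q * b) (word t i)))
      goal (inj₂ (d≡ , inj₁ low<))     = inj₁ (≤-trans (+-monoʳ-< (d i * 2 ^ (q * b)) low<)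
        (≤-reflexive (cong (λ z → z * 2 ^ (q * b) + lowDigits t q j) d≡)))
      goal (inj₂ (d≡ , inj₂ (low≡ , le))) = inj₂ (cong₂ (λ x y → x * 2 ^ (q * b) + y) d≡ low≡ , le)

  ordered-0 : ∀ {t i j} → wordsKey (suc t) i ≤ wordsKey (suc t) j → Ordered t 0 i j
  ordered-0 {t} {i} {j} le = inj₂ (trans (n%1≡0 (word t i)) (sym (n%1≡0 (word t j))) , le)

  ordered-digits : ∀ {t i j} → t < words → Ordered t digits i j → wordsKey t i ≤ wordsKey t j
  ordered-digits {t} {i} {j} t< ordered = subst₂ _≤_ (sym (wordsKey-split t< i)) (sym (wordsKey-split t< j)) (goal ordered)
    where
    u = (words ∸ suc t) * w
    all-digits : ∀ i → lowDigits t digits i ≡ word t i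
    all-digits i = truncate-id {digits * b} (<-≤-trans (rev-< w (pattern′ D i >> (t * w))) (^-monoʳ-≤ 2 (<⇒≤ (w<digits*b I))))
    goal : Ordered t digits i j → word t i * 2 ^ u + wordsKey (suc t) i ≤ word t j * 2 ^ u + wordsKey (suc t) j
    goal (inj₁ low<) = <⇒≤ (digit-< {c = wordsKey (suc t) j} (subst₂ _<_ (all-digits i) (all-digits j) low<)
      (rev-< u (pattern′ D i >> (suc t * w))))
    goal (inj₂ (low≡ , le)) = +-mono-≤ (≤-reflexive (cong (_* 2 ^ u) (trans (sym (all-digits i)) (trans low≡ (all-digits j))))) le

  Sorted : (ℕ → ℕ → Set) → State → Set
  Sorted R τ = Σ[ L ∈ List ℕ ] Listed I τ L × Complete I L × AllPairs R L

  wordCost sortCost : ℕ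
  wordCost = 3 + suc (digits * suc (3 + (suc (k * suc (12 + revCost I)) + (2 + ((1 + (2 ^ b * 5 + k * 5)) + 2)))))
  sortCost = (1 + suc (k * 3)) + (1 + suc (words * suc wordCost))

  private
    k<2^w″ : k < 2 ^ w
    k<2^w″ = ≤-<-trans (m≤m*n k words) fits

    words<2^w : words < 2 ^ w
    words<2^w = ≤-<-trans (≤-trans (s≤s (m/n≤m (m ∸ 1) w)) (≤-trans (≤-reflexive (m+[n∸m]≡n 1≤m)) m≤n)) n<

    digits<2^w : digits < 2 ^ w
    digits<2^w = ≤-<-trans (s≤s (m/n≤m w b ⦃ >-nonZero 1≤b ⦄)) (1+w<2^w I)

    no-overflow : ∀ {x} → x < 2 ^ w → x + 0 < 2 ^ w
    no-overflow {x} = subst (_< 2 ^ w) (sym (+-identityʳ x))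

  sortWord-spec : ∀ {σ t} → Ready I σ → reg σ rT ≡ suc t → t < words →
                  Sorted (λ i j → wordsKey (suc t) i ≤ wordsKey (suc t) j) σ →
                  HaltsWithin w sortWord σ wordCost (λ τ → reg τ rT ≡ t × Sorted (λ i j → wordsKey t i ≤ wordsKey t j) τ)
  sortWord-spec {σ} {t} ready t≡ t< (L , listed , complete , pairs) =
    opStep (sub-value t≡ (one≡ ready) (s≤s z≤n) (≤-<-trans t< words<2^w)) $
    constStep (truncate-id {w} (1≤2^ w)) $
    opStep (trans (add-value (digits≡ ready) (zero≡ ready) (no-overflow digits<2^w)) (+-identityʳ digits)) $
    finally (framed (countdown Inv step digits refl
        (0 , refl , refl , L , listed , complete , AllPairs.map (λ {i} {j} → ordered-0 {t} {i} {j}) pairs)))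
      λ { τ ((q , q+0 , _ , L′ , listed′ , complete′ , pairs′) , u) →
          Unchanged.regs u rT refl , L′ , listed′ , complete′ ,
          AllPairs.map (λ {i} {j} o → ordered-digits {t} {i} {j} t< (subst (λ q → Ordered t q i j) (trans (sym (+-identityʳ q)) q+0) o)) pairs′ }
    where
    Inv : ℕ → State → Set
    Inv c τ = ∃[ q ] q + c ≡ digits × reg τ rAt ≡ q × Sorted (Ordered t q) τ
    ready₁ = keep-setReg I {r = rWord} {x = digits} refl (keep-setReg I {r = rAt} {x = 0} refl (keep-setReg I {r = rT} {x = t} refl ready))
    step : ∀ c τ → Unchanged sortDigit _ τ → reg τ rWord ≡ suc c → Inv (suc c) τ →
           HaltsWithin w sortDigit τ _ (λ υ → reg υ rWord ≡ c × Inv c υ)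
    step c τ unch c≡ (q , q+c , q≡ , L , listed , complete , pairs) =
      finally (sortDigit-spec I t q t< q< (keep I sortDigit refl unch ready₁) (Unchanged.regs unch rT refl) q≡ c≡
                (≤-trans (m≤n+m (suc c) q) (≤-reflexive q+c)) listed complete)
        λ { υ (q≡′ , c≡′ , listed′) → c≡′ , suc q , trans (sym (+-suc q c)) q+c , q≡′ , _ , listed′ ,
            gather-complete I t q t< q< complete ,
            AllPairs.map (λ {i} {j} → refined⇒ordered t< q< {i} {j})
              (Pass.gather-sorted (digit I t q t< q<) (Ordered t q) (2 ^ b) pairs [] []) }
      where
      q< : q < digits
      q< = ≤-trans (m<m+n q (s≤s z≤n)) (≤-reflexive q+c)

  sortAll-spec : ∀ {σ} → Ready I σ → Sorted (λ _ _ → ⊤) σ →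
                 HaltsWithin w sortAll σ (1 + suc (words * suc wordCost)) (Sorted (λ i j → wordsKey 0 i ≤ wordsKey 0 j))
  sortAll-spec {σ} ready (L , listed , complete , _) =
    opStep (trans (add-value (words≡ ready) (zero≡ ready) (no-overflow words<2^w)) (+-identityʳ words)) $
    finally (countdown Inv step words refl (≤-refl , L , listed , complete , AllPairs-universal none L)) λ τ → proj₂
    where
    Inv : ℕ → State → Set
    Inv t τ = t ≤ words × Sorted (λ i j → wordsKey t i ≤ wordsKey t j) τ
    -- At `t ≡ words` no word has been looked at and all keys are 0, so any list is in order.
    none : ∀ i j → wordsKey words i ≤ wordsKey words j
    none i j rewrite n∸n≡0 words = z≤n
    step : ∀ t τ → Unchanged sortWord _ τ → reg τ rT ≡ suc t → Inv (suc t) τ →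
           HaltsWithin w sortWord τ wordCost (λ υ → reg υ rT ≡ t × Inv t υ)
    step t τ unch t≡ (t< , sorted) =
      finally (sortWord-spec (keep I sortWord refl unch (keep-setReg I {r = rT} {x = words} refl ready)) t≡ t< sorted)
        λ { υ (t≡′ , sorted′) → t≡′ , <⇒≤ t< , sorted′ }

  SortedOrder : State → Set
  SortedOrder τ = (∀ p → p < k → mem τ 3 p < k) ×
                  (∀ p p′ → p ≤ p′ → p′ < k → key-of (mem τ 3 p) ≤ key-of (mem τ 3 p′)) ×
                  (∀ i → i < k → ∃[ p ] p < k × mem τ 3 p ≡ i)

  sortPatterns-spec : ∀ {σ} → Ready I σ → (∀ v → mem σ 6 v ≡ 0) →
                      HaltsWithin w sortPatterns σ sortCost SortedOrder
  sortPatterns-spec {σ} ready clear =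
    framed (opStep (trans (add-value (k≡ ready) (zero≡ ready) (no-overflow k<2^w″)) (+-identityʳ k))
             (countdown Inv step k refl (≤-refl , λ p k≤p p<k → ⊥-elim (<⇒≱ p<k k≤p))))
    then λ τ ((_ , filled) , u) →
    finally (sortAll-spec (keep I fillOrder refl u ready)
        (range 0 k , (seg-range 0 k (λ p p< → filled p z≤n p<) , λ v _ → trans (Unchanged.mems u 6 refl v) (clear v)) ,
         (length-range 0 k , range-< 0 k , λ i i< → ∈-range 0 k z≤n i<) , AllPairs-universal _ _))
      λ { υ (L , (seg , _) , (len , L< , L∋) , pairs) →
          (λ p p<k → seg-All L 0 seg L< p (subst (p <_) (sym len) p<k)) ,
          (λ p p′ p≤p′ p′<k → in-order υ L seg len pairs p p′ p≤p′ p′<k) ,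
          (λ i i<k → let (p , p< , ≡i) = seg-∈ L 0 seg (L∋ i i<k) in p , subst (p <_) len p< , ≡i) }
    where
    Inv : ℕ → State → Set
    Inv c τ = c ≤ k × (∀ p → c ≤ p → p < k → mem τ 3 p ≡ p)
    step : ∀ c τ → Unchanged (op sub rCount rCount rOne ⨾ store 3 rCount rCount) (setReg rCount k σ) τ →
           reg τ rCount ≡ suc c → Inv (suc c) τ →
           HaltsWithin w (op sub rCount rCount rOne ⨾ store 3 rCount rCount) τ 2 (λ υ → reg υ rCount ≡ c × Inv c υ)
    step c τ unch c≡ (c< , filled) =
      opStep (sub-value c≡ (trans (Unchanged.regs unch rOne refl) (one≡ ready)) (s≤s z≤n) (≤-<-trans c< k<2^w″)) $
      storeLast (is c) (is c) (refl , <⇒≤ c< , fill)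
      where
      fill : ∀ p → c ≤ p → p < k → (mem τ 3 [ c ↦ c ]) p ≡ p
      fill p c≤p p<k with m≤n⇒m<n∨m≡n c≤p
      ... | inj₂ refl = updated (mem τ 3) c c
      ... | inj₁ c<p  = trans (not-updated (mem τ 3) c (λ e → <⇒≢ c<p (sym e))) (filled p c<p p<k)
    in-order : ∀ υ L → Seg (mem υ 3) 0 L → length L ≡ k → AllPairs (λ i j → wordsKey 0 i ≤ wordsKey 0 j) L →
               ∀ p p′ → p ≤ p′ → p′ < k → key-of (mem υ 3 p) ≤ key-of (mem υ 3 p′)
    in-order υ L seg len pairs p p′ p≤p′ p′<k with m≤n⇒m<n∨m≡n p≤p′
    ... | inj₂ refl = ≤-refl
    ... | inj₁ p<p′ = wordsKey-0 (mem υ 3 p) (mem υ 3 p′) (seg-pairs L 0 seg pairs p p′ p<p′ (subst (p′ <_) (sym len) p′<k))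

-- The dictionary matching program

-- `findWordSize` counts how often 1 can be doubled before it becomes 0 modulo `2 ^ w`. `findStride`
-- finds the largest power of two that is at most w. `copyText` puts the text and its length where
-- the relocated preprocessing expects its input.
findWordSize halveChunk findStride tableStep makeTable copyWord copyText params lengths : Program

findWordSize =
  const rTmp 1 ⨾
  while rTmp (op add rTmp rTmp rTmp ⨾ op add rW rW rOne)

halveChunk = op shr rB rB rOne

findStride =
  op add rStride rOne rZero ⨾
  op shr rTmp rW rOne ⨾
  while rTmp (op add rStride rStride rStride ⨾ op shr rTmp rTmp rOne)

params =
  op add rB rB rOne ⨾
  op shl rBase rOne rB ⨾
  op sub rTop rW rB ⨾
  op div rDigits rW rB ⨾
  op add rDigits rDigits rOne ⨾
  findStride

lengths =
  op sub rTmp rM rOne ⨾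
  op div rLen rTmp rW ⨾
  op add rLen rLen rOne ⨾
  op mod rTmp rTmp rW ⨾
  op sub rPad rW rOne ⨾
  op sub rPad rPad rTmp

tableStep =
  op mod rTmp rPos rI ⨾
  op shl rTmp rTmp rX ⨾
  op shr rR rPos rOne ⨾
  load rR 2 rR ⨾
  op shr rR rR rOne ⨾
  op add rTmp rTmp rR ⨾
  store 2 rPos rTmp ⨾
  op add rPos rPos rOne ⨾
  op sub rCount rCount rOne

makeTable =
  const rI 2 ⨾
  op sub rX rB rOne ⨾
  const rPos 0 ⨾
  op add rCount rBase rZero ⨾
  while rCount tableStep

copyWord =
  op sub rCount rCount rOne ⨾
  load rTmp 0 rCount ⨾
  store 8 rCount rTmp

copyText =
  op div rCount rN rW ⨾
  op add rCount rCount rOne ⨾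
  while rCount copyWord ⨾
  op add 48 rN rZero

searchPatterns : Program → Program
searchPatterns p =
  const rLo 0 ⨾
  const rPos 0 ⨾
  op add rCount rK rZero ⨾
  const rFound 0 ⨾
  while rCount (searchOne p) ⨾
  op add 0 rFound rZero

runSolver : DataStructure → Program
runSolver S =
  lengths ⨾
  makeTable ⨾
  copyText ⨾
  shift (preprocess S) ⨾
  sortPatterns ⨾
  searchPatterns (query S)

matcher : ℕ → DataStructure → Program
matcher h S =
  const rOne 1 ⨾
  findWordSize ⨾
  op shr rB rW rOne ⨾
  repeat h halveChunk ⨾
  params ⨾
  op lt rTmp rN rM ⨾
  ifnz rTmp (const 0 0) (runSolver S)

-- Computing the parameters and the table

module _ (w : ℕ) (2≤w : 2 ≤ w) where
  open Values w

  private
    1<2^w : 1 < 2 ^ w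
    1<2^w = <-trans 2≤w (n<2^n w)

  wordSize-loop : ∀ c i {σ} → i + c ≡ w → reg σ rOne ≡ 1 → reg σ rTmp ≡ truncate w (2 ^ i) → reg σ rW ≡ i →
                  HaltsWithin w (while rTmp (op add rTmp rTmp rTmp ⨾ op add rW rW rOne)) σ (1 + c * 3)
                    (λ τ → reg τ rW ≡ w)
  wordSize-loop zero i i+c one≡ p≡ w≡ = whileFalse (trans p≡ overflow) (trans w≡ i≡w)
    where
    i≡w : i ≡ w
    i≡w = trans (sym (+-identityʳ i)) i+c
    overflow : truncate w (2 ^ i) ≡ 0
    overflow = trans (cong (λ z → truncate w (2 ^ z)) i≡w) (n%n≡0 (2 ^ w) ⦃ 2^≢0 w ⦄)
  wordSize-loop (suc c) i {σ} i+c one≡ p≡ w≡ =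
    whileTrue (λ p≡0 → <⇒≢ (1≤2^ i) (trans (sym p≡0) (trans p≡ small)))
      (opStep {v = truncate w (2 ^ suc i)} (trans (cong (λ z → truncate w (z + z)) (trans p≡ small))
                (cong (λ z → truncate w (2 ^ i + z)) (sym (+-identityʳ (2 ^ i))))) $
       opLast {T = 0} {Post = _≡ setReg rW (suc i) (setReg rTmp (truncate w (2 ^ suc i)) σ)}
         (trans (add-value w≡ one≡ (≤-<-trans (≤-trans (≤-reflexive (+-comm i 1)) i<w) (n<2^n w))) (+-comm i 1)) refl)
      λ { _ refl → wordSize-loop c (suc i) (trans (sym (+-suc i c)) i+c) one≡ refl refl }
    where
    i<w : i < w
    i<w = ≤-trans (m<m+n i (s≤s z≤n)) (≤-reflexive i+c)
    small : truncate w (2 ^ i) ≡ 2 ^ i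
    small = truncate-id {w} (^-monoʳ-< 2 (s≤s (s≤s z≤n)) i<w)

  findWordSize-spec : ∀ {σ} → reg σ rOne ≡ 1 → reg σ rW ≡ 0 →
                      HaltsWithin w findWordSize σ (2 + w * 3) (λ τ → reg τ rW ≡ w)
  findWordSize-spec one≡ w≡ = constStep refl (wordSize-loop w 0 refl one≡ refl w≡)

  halve-loop : ∀ h {σ x} → reg σ rOne ≡ 1 → reg σ rB ≡ x →
               HaltsWithin w (repeat h halveChunk) σ h (λ τ → reg τ rB ≡ x >> h)
  halve-loop zero    {x = x} one≡ b≡ = skipped (trans b≡ (sym (>>0 x)))
  halve-loop (suc h) {σ} {x} one≡ b≡ =
    opStep (shr-value b≡ one≡) (finally (halve-loop h one≡ refl) λ τ b≡′ → trans b≡′ (sym (>>-suc x h)))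

  stride-loop : ∀ E c j {σ} → 2 ^ E ≤ w → w < 2 ^ suc E → j + c ≡ E → reg σ rOne ≡ 1 → reg σ rTmp ≡ w >> suc j →
                reg σ rStride ≡ 2 ^ j →
                HaltsWithin w (while rTmp (op add rStride rStride rStride ⨾ op shr rTmp rTmp rOne)) σ (1 + c * 3)
                  (λ τ → reg τ rStride ≡ 2 ^ E)
  stride-loop E zero j E≤ <E j+c one≡ t≡ s≡ = whileFalse (trans t≡ (<2^⇒>>≡0 {n = suc j} (subst (λ e → w < 2 ^ suc e) (sym j≡E) <E)))
      (trans s≡ (cong (2 ^_) j≡E))
    where
    j≡E : j ≡ E
    j≡E = trans (sym (+-identityʳ j)) j+c
  stride-loop E (suc c) j {σ} E≤ <E j+c one≡ t≡ s≡ =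
    whileTrue (λ t≡0 → <⇒≱ (m/n≡0⇒m<n ⦃ 2^≢0 (suc j) ⦄ (trans (sym t≡) t≡0)) 2^≤w)
      (opStep {v = 2 ^ suc j} (trans (add-value s≡ s≡ (≤-<-trans (≤-trans (≤-reflexive double) 2^≤w) (n<2^n w))) double) $
       opLast {T = 0} {Post = _≡ setReg rTmp (w >> suc j >> 1) (setReg rStride (2 ^ suc j) σ)} (shr-value t≡ one≡) refl)
      λ { _ refl → stride-loop E c (suc j) E≤ <E (trans (sym (+-suc j c)) j+c) one≡
            (trans (sym (>>-+ w (suc j) 1)) (cong (w >>_) (+-comm (suc j) 1))) refl }
    where
    double : 2 ^ j + 2 ^ j ≡ 2 ^ suc j
    double = cong (2 ^ j +_) (sym (+-identityʳ (2 ^ j)))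
    2^≤w : 2 ^ suc j ≤ w
    2^≤w = ≤-trans (^-monoʳ-≤ 2 (≤-trans (m<m+n j (s≤s z≤n)) (≤-reflexive j+c))) E≤

  params-spec : ∀ {σ E x} → 2 ^ E ≤ w → w < 2 ^ suc E → reg σ rOne ≡ 1 → reg σ rZero ≡ 0 → reg σ rW ≡ w →
                reg σ rB ≡ x → suc x < w →
                HaltsWithin w params σ (8 + E * 3) (λ τ →
                  reg τ rB ≡ suc x × reg τ rBase ≡ 2 ^ suc x × reg τ rTop ≡ w ∸ suc x ×
                  reg τ rDigits ≡ suc (w / suc x) × reg τ rStride ≡ 2 ^ E)
  params-spec {σ} {E} {x} E≤ <E one≡ zero≡ w≡ x≡ x<w =
    opStep (trans (add-value x≡ one≡ (≤-<-trans (≤-reflexive (+-comm x 1)) (<-trans x<w (n<2^n w)))) (+-comm x 1)) $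
    opStep (trans (shl-value one≡ (is (suc x)) (subst (_< 2 ^ w) (sym (*-identityˡ _)) b<)) (*-identityˡ (2 ^ suc x))) $
    opStep (sub-value w≡ (is (suc x)) (<⇒≤ x<w) (n<2^n w)) $
    opStep (div-value w≡ (is (suc x))) $
    opStep (trans (add-value (is (w / suc x)) one≡ digits<) (+-comm (w / suc x) 1)) $
    opStep (trans (add-value one≡ zero≡ 1<2^w) refl) $
    opStep (shr-value w≡ one≡) $
    finally (framed (stride-loop E E 0 E≤ <E refl one≡ refl refl))
      λ { τ (s≡ , u) → Unchanged.regs u rB refl , Unchanged.regs u rBase refl , Unchanged.regs u rTop refl ,
                       Unchanged.regs u rDigits refl , s≡ }
    where
    b< : 2 ^ suc x < 2 ^ w
    b< = ^-monoʳ-< 2 (s≤s (s≤s z≤n)) x<w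
    digits< : w / suc x + 1 < 2 ^ w
    digits< = ≤-<-trans (≤-trans (≤-reflexive (+-comm (w / suc x) 1)) (s≤s (m/n≤m w (suc x)))) (below w 2≤w)
      where
      below : ∀ w → 2 ≤ w → suc w < 2 ^ w
      below (suc (suc v)) _ = begin-strict
        3 + v               ≤⟨ +-monoʳ-≤ 3 (m≤n+m v v) ⟩
        3 + (v + v)         <⟨ n<1+n _ ⟩
        4 + (v + v)         ≡⟨ regroup v ⟩
        2 * suc (suc v)     ≤⟨ *-monoʳ-≤ 2 (n<2^n (suc v)) ⟩
        2 ^ suc (suc v)     ∎
        where
        open ≤-Reasoning
        regroup : ∀ v → 4 + (v + v) ≡ 2 * suc (suc v)
        regroup = solve-∀
      below (suc zero) (s≤s ())

  makeTable-spec : ∀ {σ b} → suc b < w → reg σ rOne ≡ 1 → reg σ rZero ≡ 0 → reg σ rB ≡ suc b → reg σ rBase ≡ 2 ^ suc b →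
                   (∀ a → mem σ 2 a ≡ 0) →
                   HaltsWithin w makeTable σ (5 + 2 ^ suc b * 10) (λ τ → ∀ x → x < 2 ^ suc b → mem τ 2 x ≡ rev (suc b) x)
  makeTable-spec {σ} {b} b<w one≡ zero≡ b≡ base≡ clear =
    constStep (truncate-id {w} 2<2^w) $
    opStep (sub-value b≡ one≡ (s≤s z≤n) (<-trans b<w (n<2^n w))) $
    constStep (truncate-id {w} (1≤2^ w)) $
    opStep (trans (add-value base≡ zero≡ (subst (_< 2 ^ w) (sym (+-identityʳ (2 ^ suc b))) base<)) (+-identityʳ (2 ^ suc b))) $
    finally (countdown Inv step (2 ^ suc b) refl (0 , refl , refl , (λ _ ()) , (λ a _ → clear a)))
      λ { τ (x , x+0 , _ , table , _) y y< → table y (subst (y <_) (trans (sym x+0) (+-identityʳ x)) y<) }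
    where
    2<2^w : 2 < 2 ^ w
    2<2^w = ≤-<-trans 2≤w (n<2^n w)
    base< : 2 ^ suc b < 2 ^ w
    base< = ^-monoʳ-< 2 (s≤s (s≤s z≤n)) b<w
    Inv : ℕ → State → Set
    Inv c τ = ∃[ x ] x + c ≡ 2 ^ suc b × reg τ rPos ≡ x × (∀ y → y < x → mem τ 2 y ≡ rev (suc b) y) × (∀ y → x ≤ y → mem τ 2 y ≡ 0)
    step : ∀ c τ → Unchanged tableStep _ τ → reg τ rCount ≡ suc c → Inv (suc c) τ →
           HaltsWithin w tableStep τ 9 (λ υ → reg υ rCount ≡ c × Inv c υ)
    step c τ unch c≡ (x , x+c , x≡ , table , clear) =
      opStep (mod-value x≡ (Unchanged.regs unch rI refl)) $
      opStep (shl-value (is (x % 2)) (Unchanged.regs unch rX refl) (≤-<-trans (m≤m+n _ _) sum<)) $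
      opStep (shr-value x≡ one′) $
      loadStep (half x table clear) $
      opStep (shr-value (is (rev (suc b) (x / 2))) one′) $
      opStep (trans (add-value (is (x % 2 * 2 ^ b)) (is (rev (suc b) (x / 2) / 2)) sum<) (sym (rev-half b x x<))) $
      storeStep x≡ (is (rev (suc b) x)) $
      opStep (trans (add-value x≡ one′ (≤-<-trans (≤-trans (≤-reflexive (+-comm x 1)) x<) base<)) (+-comm x 1)) $
      opLast (sub-value c≡ one′ (s≤s z≤n) (≤-<-trans (≤-trans (m≤n+m (suc c) x) (≤-reflexive x+c)) base<))
        (refl , suc x , trans (sym (+-suc x c)) x+c , refl , filled , λ y x<y → trans (not-updated (mem τ 2) (rev (suc b) x) (λ e → <⇒≢ x<y (sym e))) (clear y (<⇒≤ x<y)))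
      where
      one′ : reg τ rOne ≡ 1
      one′ = trans (Unchanged.regs unch rOne refl) one≡
      x< : x < 2 ^ suc b
      x< = ≤-trans (m<m+n x (s≤s z≤n)) (≤-reflexive x+c)
      sum< : x % 2 * 2 ^ b + rev (suc b) (x / 2) / 2 < 2 ^ w
      sum< = <-trans (subst (_< 2 ^ suc b) (rev-half b x x<) (rev-< (suc b) x)) base<
      half : ∀ x → (∀ y → y < x → mem τ 2 y ≡ rev (suc b) y) → (∀ y → x ≤ y → mem τ 2 y ≡ 0) → mem τ 2 (x / 2) ≡ rev (suc b) (x / 2)
      -- For `x ≡ 0` the entry read is the one about to be written. It is still the 0 of the initial
      -- memory, which is its correct value.
      half zero    table clear = trans (clear 0 z≤n) (sym (rev-0 (suc b)))
      half (suc x) table clear = table (suc x / 2) (m/n<m (suc x) 2 (s≤s (s≤s z≤n)))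
      filled : ∀ y → y < suc x → (mem τ 2 [ x ↦ rev (suc b) x ]) y ≡ rev (suc b) y
      filled y (s≤s y≤x) with m≤n⇒m<n∨m≡n y≤x
      ... | inj₂ refl = updated (mem τ 2) x (rev (suc b) x)
      ... | inj₁ y<x  = trans (not-updated (mem τ 2) (rev (suc b) x) (<⇒≢ y<x)) (table y y<x)

avoids-repeat : ∀ {f g} h p → avoids f g p ≡ true → avoids f g (repeat h p) ≡ true
avoids-repeat zero    p a = refl
avoids-repeat (suc h) p a rewrite a = avoids-repeat h p a

-- The run on an input whose patterns fit into the text

module _ (I : Instance) (S : DataStructure) (t q : ℕ)
         (preprocessing : HaltsWithin (Instance.w I) (preprocess S) (textInput (Instance.w I) (Instance.T I)) t (λ _ → ⊤))
         (answers : ∀ σ i → Reachable (Instance.w I) S (Instance.T I) σ → 1 ≤ i → i ≤ Instance.n I →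
                    HaltsWithin (Instance.w I) (query S) (setReg 0 i σ) q (λ τ → IsSA (Instance.T I) i (reg τ 0)))
         where
  open Instance I
  open Values w
  open Ready

  private
    Q = query S
    Alive = Live I S q answers

    no-overflow : ∀ {x} → x < 2 ^ w → x + 0 < 2 ^ w
    no-overflow {x} = subst (_< 2 ^ w) (sym (+-identityʳ x))

    k< : k < 2 ^ w
    k< = k<2^w I S q answers

    1<2^w : 1 < 2 ^ w
    1<2^w = <-trans (s≤s 1≤v) (n<2^n w)

  searchCost : ℕ
  searchCost = 4 + ((1 + (k * suc (oneCost I S q answers) + (n >> E) * (2 + testCost I S q answers))) + 1)

  searchPatterns-spec : ∀ {σ} → Ready I σ → Alive σ → SortedOrder I σ →
                        HaltsWithin w (searchPatterns Q) σ searchCost (CorrectAnswer T D)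
  searchPatterns-spec {σ} ready lv (A< , sorted , A∋) =
    constStep (truncate-id {w} (1≤2^ w)) $
    constStep (truncate-id {w} (1≤2^ w)) $
    opStep (trans (add-value (k≡ ready) (zero≡ ready) (no-overflow k<)) (+-identityʳ k)) $
    constStep (truncate-id {w} (1≤2^ w)) $
    bounded (searchAll-spec I S q answers (mem σ 3) A< sorted k {σ₁} {0} {0} refl ready₁
      (live-setReg I S q answers rFound refl (live-setReg I S q answers rCount refl
        (live-setReg I S q answers rPos refl (live-setReg I S q answers rLo refl lv))))
      refl refl (λ _ _ → refl) refl z≤n (λ _ _ _ _ _ ()) (inj₂ (refl , λ _ ())))
    then λ { τ (found , ready₂) → answer τ found ready₂ }
    where
    σ₁ = setReg rFound 0 (setReg rCount k (setReg rPos 0 (setReg rLo 0 σ)))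
    ready₁ : Ready I σ₁
    ready₁ = keep-setReg I refl (keep-setReg I refl (keep-setReg I refl (keep-setReg I refl ready)))
    FoundAll : ℕ → Set
    FoundAll f = FoundBefore I S q answers (mem σ 3) A< sorted f k
    bounded : ∃[ a ] HaltsWithin w (while rCount (searchOne Q)) σ₁
                (1 + (k * suc (oneCost I S q answers) + a * (2 + testCost I S q answers)))
                (λ τ → FoundAll (reg τ rFound) × a * 2 ^ E ≤ n) →
              HaltsWithin w (while rCount (searchOne Q)) σ₁
                (1 + (k * suc (oneCost I S q answers) + (n >> E) * (2 + testCost I S q answers)))
                (λ τ → FoundAll (reg τ rFound) × Ready I τ)
    bounded (a , u , τ , run , le , found , a*≤) =
      u , τ , run ,
      ≤-trans le (+-monoʳ-≤ 1 (+-monoʳ-≤ (k * suc (oneCost I S q answers)) (*-monoˡ-≤ (2 + testCost I S q answers) a≤))) ,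
      found , keepFixed I (fixed-mono (λ _ p → p) protected⇒own
        (fixed {protectedReg} {ownMem} (while rCount (searchOne Q)) (avoids-searchOne I S q answers) (unchanged run))) ready₁
      where
      instance _ = 2^≢0 E
      a≤ : a ≤ n >> E
      a≤ = ≤-trans (≤-reflexive (sym (m*n/n≡m a (2 ^ E)))) (/-monoˡ-≤ (2 ^ E) a*≤)
    answer : ∀ τ → FoundAll (reg τ rFound) → Ready I τ →
             HaltsWithin w (op add 0 rFound rZero) τ 1 (CorrectAnswer T D)
    answer τ (inj₁ (f≡1 , i , i< , j , match)) ready₂ =
      opLast (add-value f≡1 (zero≡ ready₂) (no-overflow 1<2^w))
        ((λ _ → refl) , λ none → ⊥-elim (none (match⇒any T D i< match)))
    answer τ (inj₂ (f≡0 , none)) ready₂ =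
      opLast (add-value f≡0 (zero≡ ready₂) (no-overflow (1≤2^ w)))
        ((λ any → ⊥-elim (absurd (any⇒match T D any))) , λ _ → refl)
      where
      absurd : ¬ (∃[ i ] i < k × ∃[ j ] Match T D i j)
      absurd (i , i< , j , match) with A∋ i i<
      ... | p , p< , refl = none p p< (j , match)

  sort-and-search : ∀ {σ} → Ready I σ → Alive σ → (∀ v → mem σ 6 v ≡ 0) →
                    HaltsWithin w (sortPatterns ⨾ searchPatterns Q) σ (sortCost I + searchCost) (CorrectAnswer T D)
  sort-and-search ready lv clear =
    framed (sortPatterns-spec I ready clear) then λ { τ (order , u) →
    searchPatterns-spec (keep I sortPatterns refl u ready) (live-run I S q answers sortPatterns refl u lv) order }

  preprocess-onward : ∀ {σ} → Ready I σ → Simulates (textInput w T) σ → (∀ v → mem σ 6 v ≡ 0) →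
                      HaltsWithin w (shift (preprocess S) ⨾ sortPatterns ⨾ searchPatterns Q) σ
                        (t + (sortCost I + searchCost)) (CorrectAnswer T D)
  preprocess-onward {σ} ready sim clear = framed (shifted preprocessing) then λ { τ (lv , u) →
    sort-and-search (keepFixed I (fixed (shift (preprocess S)) (avoids-shift (λ _ → refl) (λ _ → refl) (preprocess S)) u) ready) lv
      (λ v → trans (Unchanged.mems u 6 (shift-writesMem (preprocess S) (<ᵇ⇒< 6 8 tt)) v) (clear v)) }
    where
    shifted : HaltsWithin w (preprocess S) (textInput w T) t (λ _ → ⊤) →
              HaltsWithin w (shift (preprocess S)) σ t Alive
    shifted (u , τ₀ , run , le , _) with shift-run run sim
    ... | τ , run′ , sim′ = u , τ , run′ , le , τ₀ , built run , sim′

  copyCost : ℕ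
  copyCost = 2 + (suc (suc (n / w) * 4) + 1)

  copy-onward : ∀ {σ} → Ready I σ → (∀ r → reg σ (48 + r) ≡ 0) → (∀ c a → mem σ (8 + c) a ≡ 0) → (∀ v → mem σ 6 v ≡ 0) →
                HaltsWithin w (copyText ⨾ shift (preprocess S) ⨾ sortPatterns ⨾ searchPatterns Q) σ
                  (copyCost + (t + (sortCost I + searchCost))) (CorrectAnswer T D)
  copy-onward {σ} ready regs0 mems0 clear =
    framed copied then λ { τ (sim , u) → preprocess-onward (keep I copyText refl u ready) sim
      (λ v → trans (Unchanged.mems u 6 refl v) (clear v)) }
    where
    -- If `w` divides `n` this is one word more than the text has; the extra word is 0 in both
    -- copies.
    c = suc (n / w)
    σ₁ = setReg rCount c (setReg rCount (n / w) σ)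
    ready₁ : Ready I σ₁
    ready₁ = keep-setReg I refl (keep-setReg I refl ready)
    c< : n / w + 1 < 2 ^ w
    c< = ≤-<-trans (≤-trans (≤-reflexive (+-comm (n / w) 1)) (m/n<m n w ⦃ >-nonZero (≤-trans 1≤m m≤n) ⦄ (s≤s 1≤v))) n<
    Inv : ℕ → State → Set
    Inv i τ = i ≤ c × (∀ a → i ≤ a → mem τ 8 a ≡ mem σ 0 a)
    beyond : ∀ a → c ≤ a → mem σ 8 a ≡ mem σ 0 a
    beyond a c≤a = trans (mems0 0 a) (sym (trans (text≡ ready a) (trans (cong (truncate w) none) (m<n⇒m%n≡m ⦃ 2^≢0 w ⦄ (1≤2^ w)))))
      where
      none : value T >> (a * w) ≡ 0
      none = <2^⇒>>≡0 {n = a * w} (<-≤-trans (value-< T) (^-monoʳ-≤ 2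
        (≤-trans (<⇒≤ (≤-trans (s≤s (≤-reflexive (m≡m%n+[m/n]*n n w))) (+-monoˡ-≤ (n / w * w) (m%n<n n w)))) (*-monoˡ-≤ w c≤a))))
    step : ∀ i τ → Unchanged copyWord σ₁ τ → reg τ rCount ≡ suc i → Inv (suc i) τ →
           HaltsWithin w copyWord τ 3 (λ υ → reg υ rCount ≡ i × Inv i υ)
    step i τ unch i≡ (i< , done) =
      opStep (sub-value i≡ (trans (Unchanged.regs unch rOne refl) (one≡ ready₁)) (s≤s z≤n)
               (≤-<-trans (≤-trans i< (≤-reflexive (+-comm 1 (n / w)))) c<)) $
      loadStep (is (mem τ 0 i)) $
      storeLast (is i) (is (mem τ 0 i)) (refl , <⇒≤ i< , filled)
      where
      filled : ∀ a → i ≤ a → (mem τ 8 [ i ↦ mem τ 0 i ]) a ≡ mem σ 0 a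
      filled a i≤a with m≤n⇒m<n∨m≡n i≤a
      ... | inj₂ refl = trans (updated (mem τ 8) i _) (Unchanged.mems unch 0 refl i)
      ... | inj₁ i<a  = trans (not-updated (mem τ 8) (mem τ 0 i) (λ e → <⇒≢ i<a (sym e))) (done a i<a)
    finish : ∀ τ → Unchanged (while rCount copyWord) σ₁ τ → (∀ a → mem τ 8 a ≡ mem σ 0 a) →
             HaltsWithin w (op add 48 rN rZero) τ 1 (Simulates (textInput w T))
    finish τ u done =
      opLast (trans (add-value (trans (Unchanged.regs u rN refl) (n≡ ready)) (trans (Unchanged.regs u rZero refl) (zero≡ ready))
               (no-overflow n<)) (+-identityʳ n))
        record { regs = λ { zero → refl ; (suc r) → trans (Unchanged.regs u (49 + r) refl) (regs0 (suc r)) }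
               ; mems = λ { zero a → trans (done a) (trans (text≡ ready a) (sym (packed-contents v T a)))
                          ; (suc d) a → trans (Unchanged.mems u (9 + d) refl a) (mems0 (suc d) a) } }
    copied : HaltsWithin w copyText σ copyCost (Simulates (textInput w T))
    copied =
      opStep (div-value (n≡ ready) (w≡ ready)) $
      opStep (trans (add-value (is (n / w)) (one≡ ready) c<) (+-comm (n / w) 1)) $
      framed (countdown Inv step c refl (≤-refl , beyond)) then λ { τ ((_ , done) , u) → finish τ u (λ a → done a z≤n) }

  record Prepared (σ : State) : Set where
    field
      n≡      : reg σ rN ≡ n
      k≡      : reg σ rK ≡ k
      m≡      : reg σ rM ≡ m
      one≡    : reg σ rOne ≡ 1
      w≡      : reg σ rW ≡ w
      b≡      : reg σ rB ≡ b
      base≡   : reg σ rBase ≡ 2 ^ b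
      stride≡ : reg σ rStride ≡ 2 ^ E
      top≡    : reg σ rTop ≡ w ∸ b
      zero≡   : reg σ rZero ≡ 0
      digits≡ : reg σ rDigits ≡ digits
      high≡   : ∀ r → reg σ (48 + r) ≡ 0
      mem≡    : ∀ c a → mem σ c a ≡ mem (matchingInput w T D) c a

  tableCost solveCost : ℕ
  tableCost = 5 + 2 ^ b * 10
  solveCost = 6 + (tableCost + (copyCost + (t + (sortCost I + searchCost))))

  solve-spec : ∀ {σ} → Prepared σ → HaltsWithin w (runSolver S) σ solveCost (CorrectAnswer T D)
  solve-spec {σ} prepared =
    lengthsComputed
    then λ { _ refl →
    framed tabled then λ { τ (table , u) → copy-onward (ready τ table u)
      (λ r → trans (Unchanged.regs u (48 + r) refl) (P.high≡ r))
      (λ c a → trans (Unchanged.mems u (8 + c) refl a) (P.mem≡ (8 + c) a))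
      (λ a → trans (Unchanged.mems u 6 refl a) (P.mem≡ 6 a)) } }
    where
    module P = Prepared prepared
    σ₁ = setReg rPad pad (setReg rPad v (setReg rTmp ((m ∸ 1) % w) (setReg rLen words (setReg rLen ((m ∸ 1) / w) (setReg rTmp (m ∸ 1) σ)))))
    m< : m < 2 ^ w
    m< = ≤-<-trans m≤n n<
    words< : (m ∸ 1) / w + 1 < 2 ^ w
    words< = ≤-<-trans (≤-trans (≤-reflexive (+-comm ((m ∸ 1) / w) 1))
      (≤-trans (s≤s (m/n≤m (m ∸ 1) w)) (≤-reflexive (m+[n∸m]≡n 1≤m)))) m<
    lengthsComputed : HaltsWithin w lengths σ 6 (_≡ σ₁)
    lengthsComputed =
      opStep (sub-value P.m≡ P.one≡ 1≤m m<) $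
      opStep (div-value (is (m ∸ 1)) P.w≡) $
      opStep (trans (add-value (is ((m ∸ 1) / w)) P.one≡ words<) (+-comm ((m ∸ 1) / w) 1)) $
      opStep (mod-value (is (m ∸ 1)) P.w≡) $
      opStep (sub-value P.w≡ P.one≡ (s≤s z≤n) (n<2^n w)) $
      opLast (sub-value (is v) (is ((m ∸ 1) % w)) (s≤s⁻¹ (m%n<n (m ∸ 1) w)) (<-trans (n<1+n v) (n<2^n w))) refl
    tabled : HaltsWithin w makeTable σ₁ tableCost (λ τ → ∀ x → x < 2 ^ b → mem τ 2 x ≡ rev b x)
    tabled = go b refl 1≤b
      where
      go : ∀ c → c ≡ b → 1 ≤ c → HaltsWithin w makeTable σ₁ tableCost (λ τ → ∀ x → x < 2 ^ b → mem τ 2 x ≡ rev b x)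
      go (suc c) refl _ = makeTable-spec w (s≤s 1≤v) b<w P.one≡ P.zero≡ P.b≡ P.base≡ (λ a → P.mem≡ 2 a)
    words≡⌈m÷w⌉ : ⌈ m ÷ w ⌉ ≡ words
    words≡⌈m÷w⌉ = begin
      (m + v) / w           ≡⟨ cong (λ z → (z + v) / w) (sym (m+[n∸m]≡n 1≤m)) ⟩
      (suc (m ∸ 1) + v) / w ≡⟨ cong (_/ w) (sym (+-suc (m ∸ 1) v)) ⟩
      (m ∸ 1 + w) / w       ≡⟨ m+n/n (m ∸ 1) ⟩
      (m ∸ 1) / w + 1       ≡⟨ +-comm ((m ∸ 1) / w) 1 ⟩
      words                 ∎
      where
      open ≡-Reasoning
      m+n/n : ∀ x → (x + w) / w ≡ x / w + 1
      m+n/n x = trans (+-distrib-/-∣ʳ x (Data.Nat.Divisibility.∣-refl)) (cong (x / w +_) (n/n≡1 w))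
    ready : ∀ τ → (∀ x → x < 2 ^ b → mem τ 2 x ≡ rev b x) → Unchanged makeTable σ₁ τ → Ready I τ
    ready τ table u = record
      { n≡ = trans (Unchanged.regs u rN refl) P.n≡ ; k≡ = trans (Unchanged.regs u rK refl) P.k≡
      ; m≡ = trans (Unchanged.regs u rM refl) P.m≡ ; one≡ = trans (Unchanged.regs u rOne refl) P.one≡
      ; w≡ = trans (Unchanged.regs u rW refl) P.w≡ ; b≡ = trans (Unchanged.regs u rB refl) P.b≡
      ; base≡ = trans (Unchanged.regs u rBase refl) P.base≡ ; words≡ = Unchanged.regs u rLen refl
      ; pad≡ = Unchanged.regs u rPad refl ; stride≡ = trans (Unchanged.regs u rStride refl) P.stride≡
      ; top≡ = trans (Unchanged.regs u rTop refl) P.top≡ ; zero≡ = trans (Unchanged.regs u rZero refl) P.zero≡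
      ; digits≡ = trans (Unchanged.regs u rDigits refl) P.digits≡
      ; text≡ = λ a → trans (Unchanged.mems u 0 refl a) (trans (P.mem≡ 0 a) (packed-contents v T a))
      ; pats≡ = λ i x x< → trans (Unchanged.mems u 1 refl _) (trans (P.mem≡ 1 _)
          (trans (cong (λ z → contents (concatMap (packed w) (toList D)) (i * z + x)) (sym words≡⌈m÷w⌉))
                 (patterns-contents v D i (subst (x <_) (sym words≡⌈m÷w⌉) x<))))
      ; table≡ = table }

setupReg chunkReg allMem : ℕ → Bool
setupReg r = (r ≤ᵇ 2) ∨ ((r ≡ᵇ rZero) ∨ highReg r)
chunkReg r = Bool.not (r ≡ᵇ rB)
allMem b   = true

module _ (v n k m h E : ℕ) (T : BitString n) (D : Vec (BitString m) k)
         (1≤v : 1 ≤ v) (1≤h : 1 ≤ h) (n<2^w : n < 2 ^ suc v) (1≤m : 1 ≤ m)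
         (km< : k * m < 2 ^ suc v) (2^E≤w : 2 ^ E ≤ suc v) (w<2^E : suc v < 2 ^ suc E) where

  private
    w = suc v
    c = w >> suc h

  open Values w

  -- Since `h` is at least 1, `c` is at most `w / 4`, and `w` is at least 2.
  c<v : suc c < w
  c<v = s≤s (small (w / 4) refl)
    where
    c≤ : c ≤ w / 4
    c≤ = /-monoʳ-≤ w {2 ^ suc h} {4} ⦃ 2^≢0 (suc h) ⦄ (^-monoʳ-≤ 2 (s≤s 1≤h))
    small : ∀ d → d ≡ w / 4 → suc c ≤ v
    small zero    e = ≤-trans (s≤s (≤-trans c≤ (≤-reflexive (sym e)))) 1≤v
    small (suc d) e = ≤-trans (s≤s (≤-trans c≤ (≤-reflexive (sym e)))) (s≤s⁻¹ (begin
      3 + d           ≤⟨ +-monoʳ-≤ 3 (m≤m+n d (3 * d + 1)) ⟩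
      3 + (d + (3 * d + 1)) ≡⟨ regroup d ⟩
      suc d * 4       ≡⟨ cong (_* 4) e ⟩
      w / 4 * 4       ≤⟨ m/n*n≤m w 4 ⟩
      w               ∎))
      where
      open ≤-Reasoning
      regroup : ∀ d → 3 + (d + (3 * d + 1)) ≡ suc d * 4
      regroup = solve-∀

  words≤m : suc ((m ∸ 1) / w) ≤ m
  words≤m = ≤-trans (s≤s (m/n≤m (m ∸ 1) w)) (≤-reflexive (m+[n∸m]≡n 1≤m))

  instanceOf : m ≤ n → Instance
  instanceOf m≤n = record
    { v = v ; n = n ; k = k ; m = m ; b = suc c ; E = E ; T = T ; D = D ; 1≤v = 1≤v ; n< = n<2^w ; 1≤m = 1≤m
    ; m≤n = m≤n ; 1≤b = s≤s z≤n ; b<w = c<v ; 2^E≤w = 2^E≤w ; fits = ≤-<-trans (*-monoʳ-≤ k words≤m) km< }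

  record SetUp (σ : State) : Set where
    field
      one≡    : reg σ rOne ≡ 1
      w≡      : reg σ rW ≡ w
      b≡      : reg σ rB ≡ suc c
      base≡   : reg σ rBase ≡ 2 ^ suc c
      stride≡ : reg σ rStride ≡ 2 ^ E
      top≡    : reg σ rTop ≡ w ∸ suc c
      digits≡ : reg σ rDigits ≡ suc (w / suc c)
      input≡  : Fixed setupReg allMem (matchingInput w T D) σ

  module _ (S : DataStructure) (t q : ℕ)
           (preprocessing : HaltsWithin w (preprocess S) (textInput w T) t (λ _ → ⊤))
           (answers : ∀ σ i → Reachable w S T σ → 1 ≤ i → i ≤ n →
                      HaltsWithin w (query S) (setReg 0 i σ) q (λ τ → IsSA T i (reg τ 0)))
           (cost : ℕ) (1≤cost : 1 ≤ cost)
           (solveCost≤ : (m≤n : m ≤ n) → solveCost (instanceOf m≤n) S t q preprocessing answers ≤ cost) where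

    private
      σ₀ = matchingInput w T D

    -- The constants hidden in m = Θ(log n) allow patterns longer than the text. Then nothing occurs
    -- and NO is answered at once, since an `Instance` asks for `m ≤ n`.
    decide : ∀ {σ} → SetUp σ →
             HaltsWithin w (op lt rTmp rN rM ⨾ ifnz rTmp (const 0 0) (runSolver S)) σ (2 + cost) (CorrectAnswer T D)
    decide {σ} setUp = opStep (lt-value (fixedReg input≡ rN refl) (fixedReg input≡ rM refl)) (branch (bit-<ᵇ n m))
      where
      open SetUp setUp
      branch : ∀ {f} → Decides f (n < m) →
               HaltsWithin w (ifnz rTmp (const 0 0) (runSolver S)) (setReg rTmp f σ) (1 + cost) (CorrectAnswer T D)
      branch (inj₁ (f≡1 , n<m)) = ifTrue (λ f≡0 → case trans (sym f≡1) f≡0 of λ ()) (within 1≤cost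
        (constLast {t = 0} (truncate-id {w} (1≤2^ w)) ((λ any → ⊥-elim (absurd (any⇒match T D any))) , λ _ → refl)))
        where
        absurd : ¬ (∃[ i ] i < k × ∃[ j ] Match T D i j)
        absurd (_ , _ , j , j+m≤n , _) = <⇒≱ n<m (≤-trans (m≤n+m m j) j+m≤n)
      branch {f} (inj₂ (f≡0 , n≮m)) = ifFalse f≡0 (within (solveCost≤ (≮⇒≥ n≮m))
        (solve-spec (instanceOf (≮⇒≥ n≮m)) S t q preprocessing answers record
          { n≡ = fixedReg input≡ rN refl ; k≡ = fixedReg input≡ rK refl ; m≡ = fixedReg input≡ rM refl
          ; one≡ = one≡ ; w≡ = w≡ ; b≡ = b≡ ; base≡ = base≡ ; stride≡ = stride≡ ; top≡ = top≡
          ; zero≡ = fixedReg input≡ rZero refl ; digits≡ = digits≡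
          ; high≡ = λ r → fixedReg input≡ (48 + r) refl ; mem≡ = λ b a → fixedMem input≡ b refl a }))

    paramsThen : ∀ {σ} → reg σ rOne ≡ 1 → reg σ rW ≡ w → reg σ rB ≡ c → Fixed setupReg allMem σ₀ σ →
                 HaltsWithin w (params ⨾ op lt rTmp rN rM ⨾ ifnz rTmp (const 0 0) (runSolver S)) σ
                   ((8 + E * 3) + (2 + cost)) (CorrectAnswer T D)
    paramsThen one≡ w≡ b≡ input≡ =
      framed (params-spec w (s≤s 1≤v) {E = E} 2^E≤w w<2^E one≡ (fixedReg input≡ rZero refl) w≡ b≡ c<v)
      then λ { τ ((b≡′ , base≡ , top≡ , digits≡ , stride≡) , u) → decide record
        { one≡ = trans (Unchanged.regs u rOne refl) one≡ ; w≡ = trans (Unchanged.regs u rW refl) w≡ ; b≡ = b≡′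
        ; base≡ = base≡ ; stride≡ = stride≡ ; top≡ = top≡ ; digits≡ = digits≡
        ; input≡ = fixed-trans input≡ (fixed params refl u) } }

    chunkThen : ∀ {σ} → reg σ rOne ≡ 1 → reg σ rW ≡ w → Fixed setupReg allMem σ₀ σ →
                HaltsWithin w (op shr rB rW rOne ⨾ repeat h halveChunk ⨾ params ⨾ op lt rTmp rN rM ⨾
                               ifnz rTmp (const 0 0) (runSolver S)) σ
                  (1 + (h + ((8 + E * 3) + (2 + cost)))) (CorrectAnswer T D)
    chunkThen {σ} one≡ w≡ input≡ =
      opStep (shr-value w≡ one≡) $
      framed (halve-loop w (s≤s 1≤v) h one≡ refl)
      then λ { τ (b≡ , u) →
        let fx = fixed {chunkReg} {allMem} (repeat h halveChunk) (avoids-repeat h halveChunk refl) u in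
        paramsThen (trans (fixedReg fx rOne refl) one≡) (trans (fixedReg fx rW refl) w≡)
          (trans b≡ (sym (>>-suc w h)))
          (fixed-trans input≡ (fixed-trans (fixed-setReg {r = rB} {x = w >> 1} refl)
            (fixed (repeat h halveChunk) (avoids-repeat h halveChunk refl) u))) }

    matcherCost : ℕ
    matcherCost = 1 + ((2 + w * 3) + (1 + (h + ((8 + E * 3) + (2 + cost)))))

    matcher-spec : HaltsWithin w (matcher h S) σ₀ matcherCost (CorrectAnswer T D)
    matcher-spec =
      constStep (truncate-id {w} (<-trans (s≤s 1≤v) (n<2^n w))) $
      framed (findWordSize-spec w (s≤s 1≤v) refl refl) then λ { τ (w≡ , u) →
        chunkThen (Unchanged.regs u rOne refl) w≡
          (fixed-trans (fixed-setReg {r = rOne} {x = 1} refl) (fixed findWordSize refl u)) }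

-- Real numbers: comparing cuts with rationals

ι : ℕ → ℚ
ι n = ℤ.+ n ℚ./ 1

-- The normal form of `ι n`. The latter is defined through a gcd and is stuck on a variable, whereas
-- here the denominator 1 is visible.
whole : ℕ → ℚ
whole n = mkℚ (ℤ.+ n) 0 (Coprimality.sym (Coprimality.1-coprimeTo n))

ι-mkℚ : ∀ n → ι n ≡ whole n
ι-mkℚ n = ℚ.↥p/↧p≡p (whole n)

ι-mono-≤ : ∀ {a b} → a ≤ b → ι a ℚ.≤ ι b
ι-mono-≤ {a} {b} a≤b rewrite ι-mkℚ a | ι-mkℚ b = ℚ.*≤* (ℤ.*-monoʳ-≤-nonNeg (ℤ.+ 1) (ℤ.+≤+ a≤b))

ι-mono-< : ∀ {a b} → a < b → ι a ℚ.< ι b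
ι-mono-< {a} {b} a<b rewrite ι-mkℚ a | ι-mkℚ b = ℚ.*<* (ℤ.*-monoʳ-<-pos (ℤ.+ 1) (ℤ.+<+ a<b))

ι-cancel-≤ : ∀ {a b} → ι a ℚ.≤ ι b → a ≤ b
ι-cancel-≤ ιa≤ιb = ≮⇒≥ (λ b<a → ℚ.<-irrefl refl (ℚ.<-≤-trans (ι-mono-< b<a) ιa≤ιb))

ι-≥0 : ∀ n → 0ℚ ℚ.≤ ι n
ι-≥0 n = ι-mono-≤ (z≤n {n})

ι-+ : ∀ a b → ι (a + b) ≡ ι a ℚ.+ ι b
ι-+ a b = begin
  (ℤ.+ (a + b)) ℚ./ 1
    ≡⟨ cong (ℚ._/ 1) (cong₂ ℤ._+_ (sym (ℤ.*-identityʳ (ℤ.+ a))) (sym (ℤ.*-identityʳ (ℤ.+ b)))) ⟩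
  whole a ℚ.+ whole b ≡⟨ cong₂ ℚ._+_ (sym (ι-mkℚ a)) (sym (ι-mkℚ b)) ⟩
  ι a ℚ.+ ι b ∎
  where open ≡-Reasoning

ι-* : ∀ a b → ι (a * b) ≡ ι a ℚ.* ι b
ι-* a b = begin
  (ℤ.+ (a * b)) ℚ./ 1                 ≡⟨ cong (ℚ._/ 1) (ℤ.pos-* a b) ⟩
  whole a ℚ.* whole b ≡⟨ cong₂ ℚ._*_ (sym (ι-mkℚ a)) (sym (ι-mkℚ b)) ⟩
  ι a ℚ.* ι b ∎
  where open ≡-Reasoning

*-mono : ∀ {p q r s} → 0ℚ ℚ.≤ r → 0ℚ ℚ.≤ q → p ℚ.≤ q → r ℚ.≤ s → p ℚ.* r ℚ.≤ q ℚ.* s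
*-mono {p} {q} {r} {s} 0≤r 0≤q p≤q r≤s = ℚ.≤-trans
  (ℚ.*-monoʳ-≤-nonNeg r ⦃ ℚ.nonNegative 0≤r ⦄ p≤q) (ℚ.*-monoˡ-≤-nonNeg q ⦃ ℚ.nonNegative 0≤q ⦄ r≤s)

*-≥0 : ∀ {p q} → 0ℚ ℚ.≤ p → 0ℚ ℚ.≤ q → 0ℚ ℚ.≤ p ℚ.* q
*-≥0 {p} {q} 0≤p 0≤q = ℚ.≤-trans (ℚ.≤-reflexive (sym (ℚ.*-zeroˡ q))) (ℚ.*-monoʳ-≤-nonNeg q ⦃ ℚ.nonNegative 0≤q ⦄ 0≤p)

*-≤0 : ∀ {p q} → p ℚ.≤ 0ℚ → 0ℚ ℚ.≤ q → p ℚ.* q ℚ.≤ 0ℚ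
*-≤0 {p} {q} p≤0 0≤q = ℚ.≤-trans (ℚ.*-monoʳ-≤-nonNeg q ⦃ ℚ.nonNegative 0≤q ⦄ p≤0) (ℚ.≤-reflexive (ℚ.*-zeroˡ q))

_^^_ : ℚ → ℕ → ℚ
_^^_ = RawSemiring._^_ ℚ.+-*-rawSemiring

^^-≥0 : ∀ {r} n → 0ℚ ℚ.≤ r → 0ℚ ℚ.≤ r ^^ n
^^-≥0 zero    0≤r = ℚ.<⇒≤ (ℚ.positive⁻¹ 1ℚ)
^^-≥0 (suc n) 0≤r = *-≥0 0≤r (^^-≥0 n 0≤r)

^^-mono : ∀ {r s} n → 0ℚ ℚ.≤ r → r ℚ.≤ s → r ^^ n ℚ.≤ s ^^ n
^^-mono zero    0≤r r≤s = ℚ.≤-refl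
^^-mono (suc n) 0≤r r≤s = *-mono (^^-≥0 n 0≤r) (ℚ.≤-trans 0≤r r≤s) r≤s (^^-mono n 0≤r r≤s)

ι-^ : ∀ a n → ι a ^^ n ≡ ι (a ^ n)
ι-^ a zero    = refl
ι-^ a (suc n) = trans (cong (ι a ℚ.*_) (ι-^ a n)) (sym (ι-* a (a ^ n)))

2^-cancel-≤ : ∀ {a b} → 2 ^ a ≤ 2 ^ b → a ≤ b
2^-cancel-≤ le = ≮⇒≥ (λ b<a → <⇒≱ (^-monoʳ-< 2 (s≤s (s≤s z≤n)) b<a) le)

2^⁺-neg : ∀ p → 2^⁺ (ℤ.- (ℤ.+ p)) ≡ 1ℚ
2^⁺-neg zero    = refl
2^⁺-neg (suc p) = refl

-- For `q = p / d` with `p` nonnegative, the witness `r` gives `2 ^ p ≤ r ^ d ≤ 2 ^ (u * d)`, and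
-- exponents can be compared. A negative `q` is below every natural.
log₂-≤ : ∀ {x u} → (∀ r → Lower x r → r ℚ.≤ ι (2 ^ u)) → ∀ q → Lower (log₂ x) q → q ℚ.≤ ι u
log₂-≤ {x} {u} x≤ (mkℚ (ℤ.+ p) d-1 c) (r , 0≤r , r<x , 2^p≤) rewrite ι-mkℚ u =
  ℚ.*≤* (ℤ.≤-trans (ℤ.≤-reflexive (ℤ.*-identityʳ (ℤ.+ p)))
    (ℤ.≤-trans (ℤ.+≤+ (2^-cancel-≤ (ι-cancel-≤ powers))) (ℤ.≤-reflexive (ℤ.pos-* u (suc d-1)))))
  where
  d = suc d-1
  powers : ι (2 ^ p) ℚ.≤ ι (2 ^ (u * d))
  powers = begin
    ι (2 ^ p)                            ≤⟨ 2^p≤ ⟩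
    (r ^^ d) ℚ.* 2^⁺ (ℤ.- (ℤ.+ p))       ≡⟨ trans (cong ((r ^^ d) ℚ.*_) (2^⁺-neg p)) (ℚ.*-identityʳ (r ^^ d)) ⟩
    r ^^ d                               ≤⟨ ^^-mono d 0≤r (x≤ r r<x) ⟩
    ι (2 ^ u) ^^ d                       ≡⟨ trans (ι-^ (2 ^ u) d) (cong ι (^-*-assoc 2 u d)) ⟩
    ι (2 ^ (u * d))                      ∎
    where open ℚ.≤-Reasoning
log₂-≤ {u = u} x≤ q@(mkℚ -[1+ p ] d-1 c) _ = ℚ.≤-trans (ℚ.<⇒≤ (ℚ.negative⁻¹ q)) (ι-≥0 u)

log₂-≥ : ∀ {x u} → (∀ r → Upper x r → ι (2 ^ u) ℚ.≤ r) → ∀ q → Upper (log₂ x) q → ι u ℚ.≤ q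
log₂-≥ {x} {u} ≤x (mkℚ (ℤ.+ p) d-1 c) (r , x<r , ≤2^p) rewrite ι-mkℚ u =
  ℚ.*≤* (ℤ.≤-trans (ℤ.≤-reflexive (sym (ℤ.pos-* u (suc d-1))))
    (ℤ.≤-trans (ℤ.+≤+ (2^-cancel-≤ (ι-cancel-≤ powers))) (ℤ.≤-reflexive (sym (ℤ.*-identityʳ (ℤ.+ p))))))
  where
  d = suc d-1
  powers : ι (2 ^ (u * d)) ℚ.≤ ι (2 ^ p)
  powers = begin
    ι (2 ^ (u * d))                      ≡⟨ sym (trans (ι-^ (2 ^ u) d) (cong ι (^-*-assoc 2 u d))) ⟩
    ι (2 ^ u) ^^ d                       ≤⟨ ^^-mono d (ι-≥0 (2 ^ u)) (≤x r x<r) ⟩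
    r ^^ d                               ≡⟨ sym (trans (cong ((r ^^ d) ℚ.*_) (2^⁺-neg p)) (ℚ.*-identityʳ (r ^^ d))) ⟩
    (r ^^ d) ℚ.* 2^⁺ (ℤ.- (ℤ.+ p))       ≤⟨ ≤2^p ⟩
    ι (2 ^ p)                            ∎
    where open ℚ.≤-Reasoning
-- No negative rational is above the logarithm, as that would mean `2 ^ (u * d) * 2 ^ suc p ≤ 1`.
log₂-≥ {x} {u} ≤x (mkℚ -[1+ p ] d-1 c) (r , x<r , ≤1) =
  ⊥-elim (<⇒≱ (<-≤-trans (s≤s (s≤s z≤n)) (*-mono-≤ (1≤2^ (u * d)) (^-monoʳ-≤ 2 (s≤s (z≤n {p})))))
             (ι-cancel-≤ {2 ^ (u * d) * 2 ^ suc p} {1} powers))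
  where
  d = suc d-1
  powers : ι (2 ^ (u * d) * 2 ^ suc p) ℚ.≤ ι 1
  powers = begin
    ι (2 ^ (u * d) * 2 ^ suc p)          ≡⟨ ι-* (2 ^ (u * d)) (2 ^ suc p) ⟩
    ι (2 ^ (u * d)) ℚ.* ι (2 ^ suc p)    ≡⟨ cong (ℚ._* ι (2 ^ suc p)) (sym (trans (ι-^ (2 ^ u) d) (cong ι (^-*-assoc 2 u d)))) ⟩
    (ι (2 ^ u) ^^ d) ℚ.* ι (2 ^ suc p)
      ≤⟨ ℚ.*-monoʳ-≤-nonNeg (ι (2 ^ suc p)) ⦃ ℚ.nonNegative (ι-≥0 (2 ^ suc p)) ⦄ (^^-mono d (ι-≥0 (2 ^ u)) (≤x r x<r)) ⟩
    (r ^^ d) ℚ.* ι (2 ^ suc p)           ≤⟨ ≤1 ⟩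
    ι 1                                  ∎
    where open ℚ.≤-Reasoning

log₂-lower : ∀ {x u} → Lower x (ι (2 ^ u)) → Lower (log₂ x) (ι u)
log₂-lower {x} {u} 2^u< = subst (Lower (log₂ x)) (sym (ι-mkℚ u))
  ( ι (2 ^ u) , ι-≥0 (2 ^ u) , 2^u<
  , ℚ.≤-reflexive (sym (trans (cong₂ ℚ._*_ (ℚ.*-identityʳ (ι (2 ^ u))) (2^⁺-neg u)) (ℚ.*-identityʳ (ι (2 ^ u))))) )

log₂-upper : ∀ {x u r} → Upper x r → r ℚ.≤ ι (2 ^ u) → Upper (log₂ x) (ι u)
log₂-upper {x} {u} {r} x<r r≤ = subst (Upper (log₂ x)) (sym (ι-mkℚ u))
  ( r , x<r
  , ℚ.≤-trans (ℚ.≤-reflexive (trans (cong₂ ℚ._*_ (ℚ.*-identityʳ r) (2^⁺-neg u)) (ℚ.*-identityʳ r))) r≤ )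

-- All rationals below x are at most M / h.
Bounded : Cut → ℕ → ℕ → Set
Bounded x M h = ∀ q → Lower x q → q ℚ.* ι h ℚ.≤ ι M

bounded-* : ∀ {x y M N h g} → Bounded x M h → Bounded y N g → Bounded (x *ᴿ y) (M * N) (h * g)
bounded-* {M = M} {N} {h} {g} bx by q (inj₁ q<0) = ℚ.≤-trans (*-≤0 (ℚ.<⇒≤ q<0) (ι-≥0 (h * g))) (ι-≥0 (M * N))
bounded-* {M = M} {N} {h} {g} bx by q (inj₂ (r , s , 0≤r , 0≤s , r< , s< , q≤)) = begin
  q ℚ.* ι (h * g)               ≤⟨ ℚ.*-monoʳ-≤-nonNeg (ι (h * g)) ⦃ ℚ.nonNegative (ι-≥0 (h * g)) ⦄ q≤ ⟩
  (r ℚ.* s) ℚ.* ι (h * g)       ≡⟨ cong ((r ℚ.* s) ℚ.*_) (ι-* h g) ⟩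
  (r ℚ.* s) ℚ.* (ι h ℚ.* ι g)   ≡⟨ interchange r s (ι h) (ι g) ⟩
  (r ℚ.* ι h) ℚ.* (s ℚ.* ι g)   ≤⟨ *-mono (*-≥0 0≤s (ι-≥0 g)) (ι-≥0 M) (bx r r<) (by s s<) ⟩
  ι M ℚ.* ι N                   ≡⟨ sym (ι-* M N) ⟩
  ι (M * N)                     ∎
  where
  open ℚ.≤-Reasoning
  interchange : ∀ r s h g → (r ℚ.* s) ℚ.* (h ℚ.* g) ≡ (r ℚ.* h) ℚ.* (s ℚ.* g)
  interchange = solve 4 (λ r s h g → (r :* s) :* (h :* g) := (r :* h) :* (s :* g)) refl
    where open Data.Rational.Solver.+-*-Solver

bounded-natural : ∀ n → Bounded (natural n) n 1
bounded-natural n q q<n = ℚ.≤-trans (ℚ.≤-reflexive (ℚ.*-identityʳ q)) (ℚ.<⇒≤ q<n)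

-- The premise expresses that `y` is at least h / M.
bounded-inverse : ∀ {y M h} → (∀ u → Upper y u → ι h ℚ.≤ ι M ℚ.* u) → Bounded (inverse y) M h
bounded-inverse {M = M} {h} ≤y q (r , y<r , qr≤1) with ℚ.≤-total q 0ℚ
... | inj₁ q≤0 = ℚ.≤-trans (*-≤0 q≤0 (ι-≥0 h)) (ι-≥0 M)
... | inj₂ 0≤q = begin
  q ℚ.* ι h             ≤⟨ ℚ.*-monoˡ-≤-nonNeg q ⦃ ℚ.nonNegative 0≤q ⦄ (≤y r y<r) ⟩
  q ℚ.* (ι M ℚ.* r)     ≡⟨ solve 3 (λ q m r → q :* (m :* r) := m :* (q :* r)) refl q (ι M) r ⟩
  ι M ℚ.* (q ℚ.* r)     ≤⟨ ℚ.*-monoˡ-≤-nonNeg (ι M) ⦃ ℚ.nonNegative (ι-≥0 M) ⦄ qr≤1 ⟩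
  ι M ℚ.* 1ℚ            ≡⟨ ℚ.*-identityʳ (ι M) ⟩
  ι M                   ∎
  where
  open ℚ.≤-Reasoning
  open Data.Rational.Solver.+-*-Solver

½≥0 : 0ℚ ℚ.≤ ½
½≥0 = ℚ.nonNegative⁻¹ ½

half-< : ∀ {q} → 0ℚ ℚ.< q → q ℚ.* ½ ℚ.< q
half-< {q} 0<q = ℚ.<-≤-trans (ℚ.*-monoʳ-<-pos q ⦃ ℚ.positive 0<q ⦄ {½} {1ℚ} (ℚ.*<* (ℤ.+<+ (s≤s (s≤s z≤n))))) (ℚ.≤-reflexive (ℚ.*-identityʳ q))

natural-half : ∀ n → 1 ≤ n → Lower (natural n) (ι n ℚ.* ½)
natural-half n 1≤n = half-< (ι-mono-< 1≤n)

-- A bound on the naturals below a real loses a factor 2, since a rational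
-- strictly below the natural is needed.
natural-≤ : ∀ {t M h} x → natural t ≤ᴿ x → Bounded x M h → t * h ≤ 2 * M
natural-≤ {zero}  x le b = z≤n
natural-≤ {t@(suc _)} {M} {h} x le b = ι-cancel-≤ (begin
  ι (t * h)                         ≡⟨ ι-* t h ⟩
  ι t ℚ.* ι h                       ≡⟨ solve 2 (λ t h → t :* h := con (ι 2) :* (t :* con ½ :* h)) refl (ι t) (ι h) ⟩
  ι 2 ℚ.* ((ι t ℚ.* ½) ℚ.* ι h)     ≤⟨ ℚ.*-monoˡ-≤-nonNeg (ι 2) (b (ι t ℚ.* ½) (le (ι t ℚ.* ½) (natural-half t (s≤s z≤n)))) ⟩
  ι 2 ℚ.* ι M                       ≡⟨ sym (ι-* 2 M) ⟩
  ι (2 * M)                         ∎)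
  where
  open ℚ.≤-Reasoning
  open Data.Rational.Solver.+-*-Solver

recip : (d : ℕ) .⦃ _ : NonZero d ⦄ → ℚ
recip d = ℤ.+ 1 ℚ./ d

recip-* : ∀ d .⦃ _ : NonZero d ⦄ → recip d ℚ.* ι d ≡ 1ℚ
recip-* (suc d) = ℚ.toℚᵘ-injective (begin
  ℚ.toℚᵘ (recip (suc d) ℚ.* ι (suc d))
    ≈⟨ ℚ.toℚᵘ-homo-* (recip (suc d)) (ι (suc d)) ⟩
  ℚ.toℚᵘ (recip (suc d)) ℚᵘ.* ℚ.toℚᵘ (ι (suc d))
    ≈⟨ ℚᵘ.*-cong (ℚ.toℚᵘ-fromℚᵘ (ℚᵘ.mkℚᵘ (ℤ.+ 1) d)) (ℚ.toℚᵘ-fromℚᵘ (ℚᵘ.mkℚᵘ (ℤ.+ suc d) 0)) ⟩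
  ℚᵘ.mkℚᵘ (ℤ.+ 1) d ℚᵘ.* ℚᵘ.mkℚᵘ (ℤ.+ suc d) 0
    ≈⟨ ℚᵘ.*≡* (cong ℤ.+_ (regroup d)) ⟩
  ℚ.toℚᵘ 1ℚ ∎)
  where
  open ℚᵘ.≃-Reasoning
  regroup : ∀ d → (suc d + 0) * 1 ≡ 1 * (suc d * 1)
  regroup = solve-∀

recip-≥0 : ∀ d .⦃ _ : NonZero d ⦄ → 0ℚ ℚ.≤ recip d
recip-≥0 (suc d) = ℚ.nonNegative⁻¹ (recip (suc d)) ⦃ ℚ.normalize-nonNeg 1 (suc d) ⦄

recip->0 : ∀ d .⦃ _ : NonZero d ⦄ → 0ℚ ℚ.< recip d
recip->0 (suc d) = ℚ.positive⁻¹ (recip (suc d)) ⦃ ℚ.normalize-pos 1 (suc d) ⦄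

bounded-recip : ∀ e .⦃ _ : NonZero e ⦄ → Bounded (rational (recip e)) 1 e
bounded-recip e q q< = ℚ.≤-trans (ℚ.*-monoʳ-≤-nonNeg (ι e) ⦃ ℚ.nonNegative (ι-≥0 e) ⦄ (ℚ.<⇒≤ q<)) (ℚ.≤-reflexive (recip-* e))

-- Integer approximations of logarithms and square roots

-- For n ≥ 2 this is ⌈log n⌉ - 1, the number with `2 ^ lg n < n ≤ 2 ^ suc (lg n)`. The first
-- inequality is strict because membership in a lower cut is, so `lg n` lies in the lower cut of log
-- n.
lg : ℕ → ℕ
lg zero    = 0
lg (suc n) with 2 ^ suc (lg n) <? suc n
... | yes _ = suc (lg n)
... | no  _ = lg n

2^lg<-suc : ∀ n → 2 ^ lg n < suc n → 2 ^ lg (suc n) < suc n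
2^lg<-suc n lower with 2 ^ suc (lg n) <? suc n
... | yes 2^<n = 2^<n
... | no  _    = lower

2^lg< : ∀ n → 2 ≤ n → 2 ^ lg n < n
2^lg< (suc n) (s≤s 1≤n) = go n 1≤n
  where
  go : ∀ n → 1 ≤ n → 2 ^ lg (suc n) < suc n
  go (suc zero)    _ = s≤s (s≤s z≤n)
  go (suc (suc n)) _ = 2^lg<-suc (suc (suc n)) (m<n⇒m<1+n (go (suc n) (s≤s z≤n)))

≤2^lg : ∀ n → n ≤ 2 ^ suc (lg n)
≤2^lg zero    = z≤n
≤2^lg (suc n) with 2 ^ suc (lg n) <? suc n
... | no  n≤ = ≮⇒≥ n≤
... | yes _  = ≤-trans (s≤s (≤2^lg n)) (^-monoʳ-< 2 (s≤s (s≤s z≤n)) (n<1+n (suc (lg n))))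

lg-≥ : ∀ {j n} → 2 ^ j < n → j ≤ lg n
lg-≥ {j} {n} 2^j<n = ≮⇒≥ λ lg<j → <⇒≱ 2^j<n (≤-trans (≤2^lg n) (^-monoʳ-≤ 2 lg<j))

-- The square root rounded up.
rt : ℕ → ℕ
rt zero    = 0
rt (suc v) with suc v ≤? rt v * rt v
... | yes _ = rt v
... | no  _ = suc (rt v)

≤rt² : ∀ v → v ≤ rt v * rt v
≤rt² zero    = z≤n
≤rt² (suc v) with suc v ≤? rt v * rt v
... | yes v< = v<
... | no  _  = s≤s (≤-trans (≤rt² v) (≤-trans (*-monoʳ-≤ (rt v) (n≤1+n (rt v))) (m≤n+m (rt v * suc (rt v)) (rt v))))

rt²≤ : ∀ v → rt v * rt v ≤ 4 * v
rt²≤ zero    = z≤n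
rt²≤ (suc v) with suc v ≤? rt v * rt v
... | yes _  = ≤-trans (rt²≤ v) (*-monoʳ-≤ 4 (n≤1+n v))
... | no  v≮ = begin
  suc r * suc r        ≡⟨ expand r ⟩
  r * r + (2 * r + 1)  ≤⟨ +-mono-≤ r²≤v (+-monoˡ-≤ 1 (*-monoʳ-≤ 2 (≤-trans (r≤r² r) r²≤v))) ⟩
  v + (2 * v + 1)      ≤⟨ m≤m+n _ (v + 3) ⟩
  v + (2 * v + 1) + (v + 3) ≡⟨ collapse v ⟩
  4 * suc v            ∎
  where
  open ≤-Reasoning
  r = rt v
  r²≤v : r * r ≤ v
  r²≤v = s≤s⁻¹ (≰⇒> v≮)
  r≤r² : ∀ r → r ≤ r * r
  r≤r² zero    = z≤n
  r≤r² (suc r) = m≤m+n (suc r) (r * suc r)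
  expand : ∀ r → suc r * suc r ≡ r * r + (2 * r + 1)
  expand = solve-∀
  collapse : ∀ v → v + (2 * v + 1) + (v + 3) ≡ 4 * suc v
  collapse = solve-∀

-- When n is a power of two, log n equals `suc (lg n)`. So `2 + lg n` is the least natural that is
-- certain to be in the upper cut of log n, and with it `root n` is in that of √log n.
root : ℕ → ℕ
root n = rt (2 + lg n)

²-cancel-≤ : ∀ {a b} → a * a ≤ b * b → a ≤ b
²-cancel-≤ a²≤b² = ≮⇒≥ λ b<a → <⇒≱ (*-mono-< b<a b<a) a²≤b²

²-cancel-≤ℚ : ∀ {a b} → 0ℚ ℚ.≤ b → a ℚ.* a ℚ.≤ b ℚ.* b → a ℚ.≤ b
²-cancel-≤ℚ {a} {b} 0≤b a²≤b² = ℚ.≮⇒≥ λ b<a → ℚ.<-irrefl refl (begin-strict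
  b ℚ.* b ≤⟨ ℚ.*-monoˡ-≤-nonNeg b ⦃ ℚ.nonNegative 0≤b ⦄ (ℚ.<⇒≤ b<a) ⟩
  b ℚ.* a <⟨ ℚ.*-monoˡ-<-pos a ⦃ ℚ.positive (ℚ.≤-<-trans 0≤b b<a) ⦄ b<a ⟩
  a ℚ.* a ≤⟨ a²≤b² ⟩
  b ℚ.* b ∎)
  where open ℚ.≤-Reasoning

module _ {n : ℕ} (2≤n : 2 ≤ n) where

  private
    L = lg n
    ρ = root n

  log-≤ : ∀ q → Lower (log n) q → q ℚ.≤ ι (suc L)
  log-≤ = log₂-≤ {natural n} {suc L} (λ r r<n → ℚ.≤-trans (ℚ.<⇒≤ r<n) (ι-mono-≤ (≤2^lg n)))

  log-≥ : ∀ q → Upper (log n) q → ι L ℚ.≤ q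
  log-≥ = log₂-≥ {natural n} {L} (λ r n<r → ℚ.≤-trans (ι-mono-≤ (<⇒≤ (2^lg< n 2≤n))) (ℚ.<⇒≤ n<r))

  log-lower : ∀ {j} → 2 ^ j < n → Lower (log n) (ι j)
  log-lower {j} 2^j<n = log₂-lower {natural n} {j} (ι-mono-< 2^j<n)

  log-upper : ∀ {j} → 2 + L ≤ j → Upper (log n) (ι j)
  log-upper {j} L<j = log₂-upper {natural n} {j} {ι (2 ^ j)} (ι-mono-< (≤-<-trans (≤2^lg n) (^-monoʳ-< 2 (s≤s (s≤s z≤n)) L<j))) ℚ.≤-refl

  bounded-log : Bounded (log n) (suc L) 1
  bounded-log q q< = ℚ.≤-trans (ℚ.≤-reflexive (ℚ.*-identityʳ q)) (log-≤ q q<)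

  bounded-√log : Bounded (√ log n) ρ 1
  bounded-√log q q< = ℚ.≤-trans (ℚ.≤-reflexive (ℚ.*-identityʳ q)) (q≤ q<)
    where
    q≤ : Lower (√ log n) q → q ℚ.≤ ι ρ
    q≤ (inj₁ q<0)  = ℚ.≤-trans (ℚ.<⇒≤ q<0) (ι-≥0 ρ)
    q≤ (inj₂ q²<)  = ²-cancel-≤ℚ (ι-≥0 ρ) (ℚ.≤-trans (log-≤ (q ℚ.* q) q²<)
      (ℚ.≤-trans (ι-mono-≤ (≤-trans (n≤1+n (suc L)) (≤rt² (2 + L)))) (ℚ.≤-reflexive (ι-* ρ ρ))))

  -- The 4 comes from `ρ * ρ ≤ 4 * (2 + L) ≤ 16 * L`: one factor 4 is lost in rounding the root up,
  -- the other in replacing `2 + L` by `L`.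
  √log-≥ : 1 ≤ L → ∀ u → Upper (√ log n) u → ι ρ ℚ.≤ ι 4 ℚ.* u
  √log-≥ 1≤L u (0<u , <u²) = ²-cancel-≤ℚ (*-≥0 (ι-≥0 4) (ℚ.<⇒≤ 0<u)) (begin
    ι ρ ℚ.* ι ρ                   ≡⟨ sym (ι-* ρ ρ) ⟩
    ι (ρ * ρ)                     ≤⟨ ι-mono-≤ ρ²≤ ⟩
    ι (16 * L)                    ≡⟨ ι-* 16 L ⟩
    ι 16 ℚ.* ι L                  ≤⟨ ℚ.*-monoˡ-≤-nonNeg (ι 16) (log-≥ (u ℚ.* u) <u²) ⟩
    ι 16 ℚ.* (u ℚ.* u)            ≡⟨ solve 1 (λ u → con (ι 16) :* (u :* u) := (con (ι 4) :* u) :* (con (ι 4) :* u)) refl u ⟩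
    (ι 4 ℚ.* u) ℚ.* (ι 4 ℚ.* u)   ∎)
    where
    open ℚ.≤-Reasoning
    open Data.Rational.Solver.+-*-Solver
    ρ²≤ : ρ * ρ ≤ 16 * L
    ρ²≤ = ≤-trans (rt²≤ (2 + L)) (≤-trans (*-monoʳ-≤ 4 (≤-trans (+-monoˡ-≤ L (*-monoʳ-≤ 2 1≤L)) (≤-trans (+-monoʳ-≤ (2 * L) (m≤m+n L L)) (≤-reflexive (four L)))))
      (≤-reflexive (sym (*-assoc 4 4 L))))
      where
      four : ∀ L → 2 * L + (L + L) ≡ 4 * L
      four = solve-∀

  1≤root : 1 ≤ ρ
  1≤root = ≮⇒≥ λ ρ<1 → <⇒≱ (s≤s (z≤n {suc L})) (≤-trans (≤rt² (2 + L)) (≤-reflexive (cong (λ z → z * z) (n<1⇒n≡0 ρ<1))))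

  √log-upper : Upper (√ log n) (ι ρ)
  √log-upper = ι-mono-< 1≤root , subst (Upper (log n)) (ι-* ρ ρ) (log-upper {ρ * ρ} (≤rt² (2 + L)))

  bounded-goal : 1 ≤ L → ∀ e .⦃ _ : NonZero e ⦄ →
                 Bounded (rational (recip e) *ᴿ (natural n /ᴿ (√ log n))) (1 * (n * 4)) (e * (1 * ρ))
  bounded-goal 1≤L e = bounded-* {rational (recip e)} {natural n /ᴿ (√ log n)} {1} {n * 4} {e} {1 * ρ} (bounded-recip e)
    (bounded-* {natural n} {inverse (√ log n)} {n} {4} {1} {ρ} (bounded-natural n)
      (bounded-inverse {√ log n} {4} {ρ} (√log-≥ 1≤L)))

  module _ (2≤L : 2 ≤ L) where

    private
      ℓ = lg L

    loglog-lower : Lower (loglog n) (ι ℓ)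
    loglog-lower = log₂-lower {log n} {ℓ} (log-lower {2 ^ ℓ} (≤-<-trans (^-monoʳ-≤ 2 (<⇒≤ (2^lg< L 2≤L))) (2^lg< n 2≤n)))

    loglog-≥ : ∀ q → Upper (loglog n) q → ι ℓ ℚ.≤ q
    loglog-≥ = log₂-≥ {log n} {ℓ} (λ r <r → ℚ.≤-trans (ι-mono-≤ (<⇒≤ (2^lg< L 2≤L))) (log-≥ r <r))

    1+loglog-≥ : ∀ u → Upper (natural 1 +ᴿ loglog n) u → ι (suc ℓ) ℚ.≤ ι 1 ℚ.* u
    1+loglog-≥ u (r , s , 1<r , <s , r+s≤u) = begin
      ι (suc ℓ)          ≡⟨ ι-+ 1 ℓ ⟩
      ι 1 ℚ.+ ι ℓ        ≤⟨ ℚ.+-mono-≤ (ℚ.<⇒≤ 1<r) (loglog-≥ s <s) ⟩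
      r ℚ.+ s            ≤⟨ r+s≤u ⟩
      u                  ≡⟨ sym (ℚ.*-identityˡ u) ⟩
      ι 1 ℚ.* u          ∎
      where open ℚ.≤-Reasoning

    bounded-ratio : ∀ e .⦃ _ : NonZero e ⦄ →
                    Bounded (rational (recip e) *ᴿ ((√ log n) /ᴿ (natural 1 +ᴿ loglog n))) (1 * (ρ * 1)) (e * (1 * suc ℓ))
    bounded-ratio e = bounded-* {rational (recip e)} {(√ log n) /ᴿ (natural 1 +ᴿ loglog n)} {1} {ρ * 1} {e} {1 * suc ℓ} (bounded-recip e)
      (bounded-* {√ log n} {inverse (natural 1 +ᴿ loglog n)} {ρ} {1} {1} {suc ℓ} bounded-√log
        (bounded-inverse {natural 1 +ᴿ loglog n} {1} {suc ℓ} 1+loglog-≥))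

-- The assumptions to be refuted, as inequalities between naturals

goal : ℕ → Cut
goal n = natural n /ᴿ (√ log n)

target : (ℕ → ℕ) → (ℕ → ℕ) → ℕ → Cut
target P Q n = natural (P n) +ᴿ natural n *ᴿ (natural 1 +ᴿ loglog n) /ᴿ log n *ᴿ (natural (Q n) +ᴿ natural 1)

-- Both hypotheses of the corollary amount to this.
Small : (P Q : ℕ → ℕ) → Set
Small P Q = ∀ e → ∃[ N ] ∀ n → N ≤ n →
  e * root n * P n ≤ n × e * root n * (suc (lg (lg n)) * suc (Q n)) ≤ suc (lg n)

3≤lg : ∀ {n} → 9 ≤ n → 3 ≤ lg n
3≤lg 9≤n = lg-≥ 9≤n

1≤lg : ∀ {L} → 3 ≤ L → 1 ≤ lg L
1≤lg 3≤L = lg-≥ 3≤L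

2+≤ : ∀ L → 1 ≤ L → 2 + L ≤ 2 * suc L
2+≤ L 1≤L = ≤-trans (+-monoʳ-≤ 2 (m≤m+n L L)) (≤-reflexive (double L))
  where
  double : ∀ L → 2 + (L + L) ≡ 2 * suc L
  double = solve-∀

module _ (P Q : ℕ → ℕ) {n : ℕ} (9≤n : 9 ≤ n) where

  private
    L = lg n
    ℓ = lg L
    ρ = root n
    2≤n : 2 ≤ n
    2≤n = ≤-trans (s≤s (s≤s z≤n)) 9≤n
    3≤L : 3 ≤ L
    3≤L = 3≤lg 9≤n
    2≤L : 2 ≤ L
    2≤L = ≤-trans (s≤s (s≤s z≤n)) 3≤L
    1≤ℓ : 1 ≤ ℓ
    1≤ℓ = 1≤lg 3≤L

  -- A rational in the lower cut of the second summand of `target`. The factors ½ provide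
  -- strictness. Of 1 + log log n only `ℓ` is used, which is enough because `ℓ` is at least 1 and so
  -- `suc ℓ` at most twice as large.
  searches : ℚ
  searches = ((ι n ℚ.* ½) ℚ.* ι ℓ) ℚ.* recip (2 + L) ℚ.* (ι (suc (Q n)) ℚ.* ½)

  private
    half-≥0 : ∀ a → 0ℚ ℚ.≤ ι a ℚ.* ½
    half-≥0 a = *-≥0 (ι-≥0 a) ½≥0

    queries-lower : Lower (natural (Q n) +ᴿ natural 1) (ι (suc (Q n)) ℚ.* ½)
    queries-lower = go (Q n)
      where
      go : ∀ x → Lower (natural x +ᴿ natural 1) (ι (suc x) ℚ.* ½)
      -- Only negative rationals lie below 0, so ½ is written as -¼ + ¾.
      go zero = ℚ.- (½ ℚ.* ½) , ½ ℚ.+ ½ ℚ.* ½ ,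
        ℚ.*<* ℤ.-<+ , ℚ.*<* (ℤ.+<+ (s≤s (s≤s (s≤s (s≤s z≤n))))) , ℚ.≤-refl
      go x@(suc _) = ι x ℚ.* ½ , ½ , natural-half x (s≤s z≤n) , ℚ.*<* (ℤ.+<+ (s≤s (s≤s z≤n))) ,
        ℚ.≤-reflexive (trans (cong (ℚ._* ½) (trans (cong ι (+-comm 1 x)) (ι-+ x 1))) (ℚ.*-distribʳ-+ ½ (ι x) 1ℚ))

  searches-≥0 : 0ℚ ℚ.≤ searches
  searches-≥0 = *-≥0 (*-≥0 (*-≥0 (half-≥0 n) (ι-≥0 ℓ)) (recip-≥0 (2 + L))) (half-≥0 (suc (Q n)))

  searches->0 : 0ℚ ℚ.< searches
  searches->0 = *->0 (*->0 (*->0 (*->0 (ι-mono-< (≤-trans (s≤s z≤n) 2≤n)) ½>0) (ι-mono-< 1≤ℓ)) (recip->0 (2 + L)))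
                     (*->0 (ι-mono-< {0} {suc (Q n)} (s≤s z≤n)) ½>0)
    where
    ½>0 : 0ℚ ℚ.< ½
    ½>0 = ℚ.positive⁻¹ ½
    *->0 : ∀ {p q} → 0ℚ ℚ.< p → 0ℚ ℚ.< q → 0ℚ ℚ.< p ℚ.* q
    *->0 {p} {q} 0<p 0<q = ℚ.≤-<-trans (ℚ.≤-reflexive (sym (ℚ.*-zeroˡ q))) (ℚ.*-monoˡ-<-pos q ⦃ ℚ.positive 0<q ⦄ 0<p)

  searches-lower : Lower (natural n *ᴿ (natural 1 +ᴿ loglog n) /ᴿ log n *ᴿ (natural (Q n) +ᴿ natural 1)) searches
  searches-lower = inj₂
    ( ((ι n ℚ.* ½) ℚ.* ι ℓ) ℚ.* recip (2 + L) , ι (suc (Q n)) ℚ.* ½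
    , *-≥0 (*-≥0 (half-≥0 n) (ι-≥0 ℓ)) (recip-≥0 (2 + L)) , half-≥0 (suc (Q n))
    , inj₂ ( (ι n ℚ.* ½) ℚ.* ι ℓ , recip (2 + L) , *-≥0 (half-≥0 n) (ι-≥0 ℓ) , recip-≥0 (2 + L)
           , inj₂ ( ι n ℚ.* ½ , ι ℓ , half-≥0 n , ι-≥0 ℓ , natural-half n (≤-trans (s≤s z≤n) 2≤n)
                  , (0ℚ , ι ℓ , ι-mono-< {0} {1} (s≤s z≤n) , loglog-lower 2≤n 2≤L , ℚ.≤-reflexive (sym (ℚ.+-identityˡ (ι ℓ))))
                  , ℚ.≤-refl )
           , (ι (2 + L) , log-upper 2≤n {2 + L} ≤-refl , ℚ.≤-reflexive (recip-* (2 + L)))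
           , ℚ.≤-refl )
    , queries-lower , ℚ.≤-refl )

  preprocessing-≤ : natural (P n) ≤ᴿ target P Q n
  preprocessing-≤ q q<P = q , searches , q<P , searches-lower ,
    ℚ.≤-trans (ℚ.≤-reflexive (sym (ℚ.+-identityʳ q))) (ℚ.+-monoʳ-≤ q searches-≥0)

  -- `P n` may be 0, with only negative rationals below it. Half of `searches` is sacrificed to
  -- offer -s/2 for the first summand.
  half-searches : Lower (target P Q n) (searches ℚ.* ½)
  half-searches = ℚ.- (searches ℚ.* ½) , searches ,
    ℚ.<-≤-trans (ℚ.neg-antimono-< (ℚ.≤-<-trans (ℚ.≤-reflexive (sym (ℚ.*-zeroˡ ½))) (ℚ.*-monoˡ-<-pos ½ searches->0))) (ι-≥0 (P n)) ,
    searches-lower ,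
    ℚ.≤-reflexive (solve 1 (λ s → s :* con ½ := :- (s :* con ½) :+ s) refl searches)
    where open Data.Rational.Solver.+-*-Solver

  -- The 8 is the 4 of `√log-≥` times the 2 lost in `natural-≤`. In 32 the same 4 meets the three
  -- factors ½ in `searches ℚ.* ½`.
  target-small : ∀ e .⦃ _ : NonZero e ⦄ → target P Q n ≤ᴿ rational (recip e) *ᴿ goal n →
                 P n * (e * ρ) ≤ 8 * n × ℓ * suc (Q n) * (e * ρ) ≤ 32 * (2 + L)
  target-small e le = first , *-cancelˡ-≤ n ⦃ >-nonZero (≤-trans (s≤s z≤n) 2≤n) ⦄ (ι-cancel-≤ second)
    where
    bounded : Bounded (rational (recip e) *ᴿ goal n) (1 * (n * 4)) (e * (1 * ρ))
    bounded = bounded-goal 2≤n (≤-trans (s≤s z≤n) 2≤L) e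
    first : P n * (e * ρ) ≤ 8 * n
    first = subst₂ _≤_ (cong (λ z → P n * (e * z)) (*-identityˡ ρ)) (eight n)
      (natural-≤ {P n} {1 * (n * 4)} {e * (1 * ρ)} (rational (recip e) *ᴿ goal n) (λ q q< → le q (preprocessing-≤ q q<)) bounded)
      where
      eight : ∀ n → 2 * (1 * (n * 4)) ≡ 8 * n
      eight = solve-∀
    second : ι (n * (ℓ * suc (Q n) * (e * ρ))) ℚ.≤ ι (n * (32 * (2 + L)))
    second = begin
      ι (n * (ℓ * suc (Q n) * (e * ρ)))
        ≡⟨ trans (ι-* n _) (cong (ι n ℚ.*_) (trans (ι-* (ℓ * suc (Q n)) (e * ρ)) (cong (ℚ._* ι (e * ρ)) (ι-* ℓ (suc (Q n)))))) ⟩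
      ι n ℚ.* ((ι ℓ ℚ.* ι (suc (Q n))) ℚ.* ι (e * ρ))
        ≡⟨ sym (ℚ.*-identityʳ _) ⟩
      ι n ℚ.* ((ι ℓ ℚ.* ι (suc (Q n))) ℚ.* ι (e * ρ)) ℚ.* 1ℚ
        ≡⟨ cong (ι n ℚ.* ((ι ℓ ℚ.* ι (suc (Q n))) ℚ.* ι (e * ρ)) ℚ.*_) (sym (recip-* (2 + L))) ⟩
      ι n ℚ.* ((ι ℓ ℚ.* ι (suc (Q n))) ℚ.* ι (e * ρ)) ℚ.* (recip (2 + L) ℚ.* ι (2 + L))
        ≡⟨ solve 6 (λ n ℓ q e r l → n :* ((ℓ :* q) :* e) :* (r :* l) :=
                     (n :* con ½ :* ℓ :* r :* (q :* con ½) :* con ½ :* e) :* (con (ι 8) :* l)) refl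
             (ι n) (ι ℓ) (ι (suc (Q n))) (ι (e * ρ)) (recip (2 + L)) (ι (2 + L)) ⟩
      ((searches ℚ.* ½) ℚ.* ι (e * ρ)) ℚ.* (ι 8 ℚ.* ι (2 + L))
        ≤⟨ ℚ.*-monoʳ-≤-nonNeg (ι 8 ℚ.* ι (2 + L)) ⦃ ℚ.nonNegative (*-≥0 (ι-≥0 8) (ι-≥0 (2 + L))) ⦄
             (subst (λ z → (searches ℚ.* ½) ℚ.* ι (e * z) ℚ.≤ ι (1 * (n * 4))) (*-identityˡ ρ)
               (bounded (searches ℚ.* ½) (le (searches ℚ.* ½) half-searches))) ⟩
      ι (1 * (n * 4)) ℚ.* (ι 8 ℚ.* ι (2 + L))
        ≡⟨ trans (cong (ι (1 * (n * 4)) ℚ.*_) (sym (ι-* 8 (2 + L)))) (sym (ι-* (1 * (n * 4)) (8 * (2 + L)))) ⟩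
      ι (1 * (n * 4) * (8 * (2 + L)))   ≡⟨ cong ι (regroup n (2 + L)) ⟩
      ι (n * (32 * (2 + L)))            ∎
      where
      open ℚ.≤-Reasoning
      open Data.Rational.Solver.+-*-Solver
      regroup : ∀ n l → 1 * (n * 4) * (8 * l) ≡ n * (32 * l)
      regroup = solve-∀

-- Since `e` is arbitrary, it can absorb the constant `c`. The premise speaks of `suc e` because its
-- instances come from a rational 1 / (e + 1).
small-up-to : ∀ c .⦃ _ : NonZero c ⦄ P Q →
              (∀ e → ∃[ N ] ∀ n → N ≤ n →
                suc e * root n * P n ≤ c * n × suc e * root n * (suc (lg (lg n)) * suc (Q n)) ≤ c * suc (lg n)) →
              Small P Q
small-up-to c P Q small e with small (c * e)
... | N , bounds = N , λ n N≤n → scale (proj₁ (bounds n N≤n)) , scale (proj₂ (bounds n N≤n))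
  where
  scale : ∀ {ρ x y} → suc (c * e) * ρ * x ≤ c * y → e * ρ * x ≤ y
  scale {ρ} {x} {y} le = *-cancelˡ-≤ c (begin
    c * (e * ρ * x)         ≤⟨ m≤n+m _ (ρ * x) ⟩
    ρ * x + c * (e * ρ * x) ≡⟨ regroup c e ρ x ⟩
    suc (c * e) * ρ * x     ≤⟨ le ⟩
    c * y                   ∎)
    where
    open ≤-Reasoning
    regroup : ∀ c e ρ x → ρ * x + c * (e * ρ * x) ≡ suc (c * e) * ρ * x
    regroup = solve-∀

small-if-target : ∀ P Q → target P Q ∈o goal → Small P Q
-- 128 = 2 * 32 * 2, where the outer factors pay for replacing `ℓ` by `suc ℓ` and `2 + L` by
-- `suc L`. The first inequality has 8 and fits in as well.
small-if-target P Q f∈o = small-up-to 128 P Q λ e → start e (f∈o (recip (suc e)) (recip->0 (suc e)))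
  where
  bounds : ∀ e n → 9 ≤ n → target P Q n ≤ᴿ rational (recip (suc e)) *ᴿ goal n →
           suc e * root n * P n ≤ 128 * n × suc e * root n * (suc (lg (lg n)) * suc (Q n)) ≤ 128 * suc (lg n)
  bounds e n 9≤n le =
    (begin
      suc e * ρ * P n        ≡⟨ *-comm (suc e * ρ) (P n) ⟩
      P n * (suc e * ρ)      ≤⟨ proj₁ (target-small P Q 9≤n (suc e) le) ⟩
      8 * n                  ≤⟨ *-monoˡ-≤ n (≤ᵇ⇒≤ 8 128 tt) ⟩
      128 * n                ∎) ,
    (begin
      suc e * ρ * (suc ℓ * suc (Q n))         ≤⟨ *-monoʳ-≤ (suc e * ρ) (*-monoˡ-≤ (suc (Q n)) (+-monoˡ-≤ ℓ (1≤lg (3≤lg 9≤n)))) ⟩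
      suc e * ρ * ((ℓ + ℓ) * suc (Q n))       ≡⟨ regroup₂ (suc e * ρ) ℓ (suc (Q n)) ⟩
      2 * (ℓ * suc (Q n) * (suc e * ρ))       ≤⟨ *-monoʳ-≤ 2 (proj₂ (target-small P Q 9≤n (suc e) le)) ⟩
      2 * (32 * (2 + lg n))                   ≤⟨ *-monoʳ-≤ 2 (*-monoʳ-≤ 32 (2+≤ (lg n) (≤-trans (s≤s z≤n) (3≤lg 9≤n)))) ⟩
      2 * (32 * (2 * suc (lg n)))             ≡⟨ trans (cong (2 *_) (sym (*-assoc 32 2 (suc (lg n))))) (sym (*-assoc 2 64 (suc (lg n)))) ⟩
      128 * suc (lg n)                        ∎)
    where
    open ≤-Reasoning
    ρ = root n
    ℓ = lg (lg n)
    regroup₂ : ∀ x ℓ q → x * ((ℓ + ℓ) * q) ≡ 2 * (ℓ * q * x)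
    regroup₂ = solve-∀
  start : ∀ e → ∃[ N ] (∀ n → N ≤ n → target P Q n ≤ᴿ rational (recip (suc e)) *ᴿ goal n) →
          ∃[ N ] ∀ n → N ≤ n →
            suc e * root n * P n ≤ 128 * n × suc e * root n * (suc (lg (lg n)) * suc (Q n)) ≤ 128 * suc (lg n)
  start e (N , small) = N ⊔ 9 , λ n N≤n → bounds e n (≤-trans (m≤n⊔m N 9) N≤n) (small n (≤-trans (m≤m⊔n N 9) N≤n))

-- With `y = ℓ / 4`, two of the four factors `2 ^ y` contained in `2 ^ ℓ` dominate the square up to
-- 16, and the other two dominate `16 * c`, as `64 * c ≤ ℓ` makes `y` at least that large.
2^-dominates-squares : ∀ c ℓ → 64 * c ≤ ℓ → c * (suc ℓ * suc ℓ) ≤ 2 ^ ℓ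
2^-dominates-squares c ℓ 64c≤ℓ = begin
  c * (suc ℓ * suc ℓ)                        ≤⟨ *-monoʳ-≤ c (*-mono-≤ 1+ℓ≤ 1+ℓ≤) ⟩
  c * ((4 * 2 ^ y) * (4 * 2 ^ y))            ≡⟨ regroup c (2 ^ y) ⟩
  (16 * c) * (2 ^ y * 2 ^ y)                 ≤⟨ *-monoˡ-≤ (2 ^ y * 2 ^ y) 16c≤ ⟩
  (2 ^ y * 2 ^ y) * (2 ^ y * 2 ^ y)          ≡⟨ powers ⟩
  2 ^ (y * 4)                                ≤⟨ ^-monoʳ-≤ 2 (m/n*n≤m ℓ 4) ⟩
  2 ^ ℓ                                      ∎
  where
  open ≤-Reasoning
  y = ℓ / 4
  regroup : ∀ c p → c * ((4 * p) * (4 * p)) ≡ (16 * c) * (p * p)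
  regroup = solve-∀
  1+ℓ≤ : suc ℓ ≤ 4 * 2 ^ y
  1+ℓ≤ = ≤-trans (≤-trans (s≤s (≤-reflexive (m≡m%n+[m/n]*n ℓ 4))) (+-monoˡ-≤ (y * 4) (m%n<n ℓ 4)))
    (≤-trans (≤-reflexive (*-comm (suc y) 4)) (*-monoʳ-≤ 4 (n<2^n y)))
  16c≤ : 16 * c ≤ 2 ^ y * 2 ^ y
  16c≤ = ≤-trans (≤-trans (≤-reflexive (sym (trans (cong (_/ 4) (trans (*-assoc 4 16 c) (*-comm 4 (16 * c)))) (m*n/n≡m (16 * c) 4))))
      (/-monoˡ-≤ 4 64c≤ℓ))
    (≤-trans (<⇒≤ (n<2^n y)) (≤-trans (≤-reflexive (sym (*-identityʳ (2 ^ y)))) (*-monoʳ-≤ (2 ^ y) (1≤2^ y))))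
  powers : (2 ^ y * 2 ^ y) * (2 ^ y * 2 ^ y) ≡ 2 ^ (y * 4)
  powers = trans (four (2 ^ y)) (^-*-assoc 2 y 4)
    where
    four : ∀ p → (p * p) * (p * p) ≡ p * (p * (p * (p * 1)))
    four = solve-∀

-- (1 + log log n) / √ log n tends to 0.
loglog-small : ∀ e → ∃[ N ] ∀ n → N ≤ n → e * root n * suc (lg (lg n)) ≤ suc (lg n)
loglog-small e = 9 ⊔ N , λ n N≤n →
  bound n (≤-trans (m≤m⊔n 9 N) N≤n) (≤-trans (m≤n⊔m 9 N) N≤n)
  where
  c = 8 * (e * e)
  ℓ₀ = 64 * c
  -- Two applications of `lg-≥` turn this into `ℓ₀ ≤ lg (lg n)`. Each needs a strict inequality,
  -- hence the two `suc`.
  N = suc (2 ^ suc (2 ^ ℓ₀))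
  bound : ∀ n → 9 ≤ n → 2 ^ suc (2 ^ ℓ₀) < n → e * root n * suc (lg (lg n)) ≤ suc (lg n)
  bound n 9≤n <n = ²-cancel-≤ (begin
    (e * ρ * suc ℓ) * (e * ρ * suc ℓ)          ≡⟨ regroup e ρ (suc ℓ) ⟩
    e * e * (suc ℓ * suc ℓ) * (ρ * ρ)          ≤⟨ *-monoʳ-≤ (e * e * (suc ℓ * suc ℓ)) (≤-trans (rt²≤ (2 + L)) (*-monoʳ-≤ 4 (2+≤ L 1≤L))) ⟩
    e * e * (suc ℓ * suc ℓ) * (4 * (2 * suc L)) ≡⟨ regroup′ (e * e) (suc ℓ * suc ℓ) (suc L) ⟩
    8 * (e * e) * (suc ℓ * suc ℓ) * suc L      ≤⟨ *-monoˡ-≤ (suc L) (2^-dominates-squares c ℓ ℓ₀≤ℓ) ⟩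
    2 ^ ℓ * suc L                              ≤⟨ *-monoˡ-≤ (suc L) (≤-trans (<⇒≤ (2^lg< L 2≤L)) (n≤1+n L)) ⟩
    suc L * suc L                              ∎)
    where
    open ≤-Reasoning
    L = lg n
    ℓ = lg L
    ρ = root n
    2≤L : 2 ≤ L
    2≤L = ≤-trans (s≤s (s≤s z≤n)) (3≤lg 9≤n)
    1≤L : 1 ≤ L
    1≤L = ≤-trans (s≤s z≤n) 2≤L
    ℓ₀≤ℓ : ℓ₀ ≤ ℓ
    ℓ₀≤ℓ = lg-≥ (lg-≥ <n)
    regroup : ∀ e ρ s → (e * ρ * s) * (e * ρ * s) ≡ e * e * (s * s) * (ρ * ρ)
    regroup = solve-∀
    regroup′ : ∀ a b l → a * b * (4 * (2 * l)) ≡ 8 * a * b * l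
    regroup′ = solve-∀

-- `Small` involves `Q n + 1`, and the assumption on `Q` says nothing of the 1, whose share is
-- bounded by `loglog-small`.
small-if-parts : ∀ P Q → (λ n → natural (P n)) ∈o goal →
                 (λ n → natural (Q n)) ∈o (λ n → (√ log n) /ᴿ (natural 1 +ᴿ loglog n)) → Small P Q
-- 17 = 16 + 1: the share of `Q n` is at most 2 ρ² ≤ 2 * 4 * 2 (1 + L), and that of the added 1 is
-- at most 1 + L.
small-if-parts P Q p∈o q∈o = small-up-to 17 P Q λ e →
  start e (p∈o (recip (suc e)) (recip->0 (suc e))) (q∈o (recip (suc e)) (recip->0 (suc e))) (loglog-small (suc e))
  where
  bounds : ∀ e n → 9 ≤ n → natural (P n) ≤ᴿ rational (recip (suc e)) *ᴿ goal n →
           natural (Q n) ≤ᴿ rational (recip (suc e)) *ᴿ ((√ log n) /ᴿ (natural 1 +ᴿ loglog n)) →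
           suc e * root n * suc (lg (lg n)) ≤ suc (lg n) →
           suc e * root n * P n ≤ 17 * n × suc e * root n * (suc (lg (lg n)) * suc (Q n)) ≤ 17 * suc (lg n)
  bounds e n 9≤n p≤ q≤ small =
    (begin
      suc e * ρ * P n         ≡⟨ regroup₁ (suc e) ρ (P n) ⟩
      P n * (suc e * (1 * ρ)) ≤⟨ natural-≤ {P n} {1 * (n * 4)} {suc e * (1 * ρ)} (rational (recip (suc e)) *ᴿ goal n) p≤
                                   (bounded-goal 2≤n (≤-trans (s≤s z≤n) 2≤L) (suc e)) ⟩
      2 * (1 * (n * 4))       ≤⟨ m≤m+n _ (9 * n) ⟩
      2 * (1 * (n * 4)) + 9 * n ≡⟨ regroup₂ n ⟩
      17 * n                  ∎) ,
    (begin
      suc e * ρ * (suc ℓ * suc (Q n))   ≡⟨ regroup₃ (suc e) ρ (suc ℓ) (Q n) ⟩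
      Q n * (suc e * (1 * suc ℓ)) * ρ + suc e * ρ * suc ℓ
        ≤⟨ +-mono-≤ (*-monoˡ-≤ ρ (natural-≤ {Q n} {1 * (ρ * 1)} {suc e * (1 * suc ℓ)}
             (rational (recip (suc e)) *ᴿ ((√ log n) /ᴿ (natural 1 +ᴿ loglog n))) q≤ (bounded-ratio 2≤n 2≤L (suc e)))) small ⟩
      2 * (1 * (ρ * 1)) * ρ + suc L     ≡⟨ cong (_+ suc L) (regroup₄ ρ) ⟩
      2 * (ρ * ρ) + suc L               ≤⟨ +-monoˡ-≤ (suc L) (*-monoʳ-≤ 2 (≤-trans (rt²≤ (2 + L)) (*-monoʳ-≤ 4 (2+≤ L (≤-trans (s≤s z≤n) 2≤L))))) ⟩
      2 * (4 * (2 * suc L)) + suc L     ≡⟨ regroup₅ (suc L) ⟩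
      17 * suc L                        ∎)
    where
    open ≤-Reasoning
    L = lg n
    ℓ = lg L
    ρ = root n
    2≤n : 2 ≤ n
    2≤n = ≤-trans (s≤s (s≤s z≤n)) 9≤n
    2≤L : 2 ≤ L
    2≤L = ≤-trans (s≤s (s≤s z≤n)) (3≤lg 9≤n)
    regroup₁ : ∀ e ρ p → e * ρ * p ≡ p * (e * (1 * ρ))
    regroup₁ = solve-∀
    regroup₂ : ∀ n → 2 * (1 * (n * 4)) + 9 * n ≡ 17 * n
    regroup₂ = solve-∀
    regroup₃ : ∀ e ρ s q → e * ρ * (s * suc q) ≡ q * (e * (1 * s)) * ρ + e * ρ * s
    regroup₃ = solve-∀
    regroup₄ : ∀ ρ → 2 * (1 * (ρ * 1)) * ρ ≡ 2 * (ρ * ρ)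
    regroup₄ = solve-∀
    regroup₅ : ∀ l → 2 * (4 * (2 * l)) + l ≡ 17 * l
    regroup₅ = solve-∀
  start : ∀ e →
          ∃[ N ] (∀ n → N ≤ n → natural (P n) ≤ᴿ rational (recip (suc e)) *ᴿ goal n) →
          ∃[ N ] (∀ n → N ≤ n → natural (Q n) ≤ᴿ rational (recip (suc e)) *ᴿ ((√ log n) /ᴿ (natural 1 +ᴿ loglog n))) →
          ∃[ N ] (∀ n → N ≤ n → suc e * root n * suc (lg (lg n)) ≤ suc (lg n)) →
          ∃[ N ] ∀ n → N ≤ n →
            suc e * root n * P n ≤ 17 * n × suc e * root n * (suc (lg (lg n)) * suc (Q n)) ≤ 17 * suc (lg n)
  start e (N₁ , p≤) (N₂ , q≤) (N₃ , small) = 9 ⊔ (N₁ ⊔ (N₂ ⊔ N₃)) , λ n N≤n →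
    let N′≤n = ≤-trans (m≤n⊔m 9 (N₁ ⊔ (N₂ ⊔ N₃))) N≤n
        N″≤n = ≤-trans (m≤n⊔m N₁ (N₂ ⊔ N₃)) N′≤n
    in bounds e n (≤-trans (m≤m⊔n 9 (N₁ ⊔ (N₂ ⊔ N₃))) N≤n)
         (p≤ n (≤-trans (m≤m⊔n N₁ (N₂ ⊔ N₃)) N′≤n))
         (q≤ n (≤-trans (m≤m⊔n N₂ N₃) N″≤n)) (small n (≤-trans (m≤n⊔m N₂ N₃) N″≤n))

-- Here a natural has to be exhibited below a product of cuts, so each factor needs a rational
-- strictly below it: `ε` and `n` are halved, which the 4 pays for, and for the inverse of √log n
-- the reciprocal of `root n` serves.
goal-lower : ∀ {n} → 2 ≤ n → ∀ t ε → 0ℚ ℚ.< ε → ∀ d → 1ℚ ℚ.≤ ε ℚ.* ι d → 4 * d * root n * t ≤ n →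
             natural t ≤ᴿ rational ε *ᴿ goal n
goal-lower {n} 2≤n t ε 0<ε d 1≤εd le q q<t = inj₂
  ( ε ℚ.* ½ , (ι n ℚ.* ½) ℚ.* recip ρ , 0≤ε½ , 0≤s , half-< 0<ε
  , inj₂ (ι n ℚ.* ½ , recip ρ , *-≥0 (ι-≥0 n) ½≥0 , recip-≥0 ρ , natural-half n (≤-trans (s≤s z≤n) 2≤n)
         , (ι ρ , √log-upper 2≤n , ℚ.≤-reflexive (recip-* ρ)) , ℚ.≤-refl)
  , ℚ.≤-trans (ℚ.<⇒≤ q<t) (begin
      ι t                                            ≡⟨ sym (ℚ.*-identityˡ (ι t)) ⟩
      1ℚ ℚ.* ι t                                     ≤⟨ ℚ.*-monoʳ-≤-nonNeg (ι t) ⦃ ℚ.nonNegative (ι-≥0 t) ⦄ 1≤εd ⟩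
      (ε ℚ.* ι d) ℚ.* ι t                            ≡⟨ sym (ℚ.*-identityʳ _) ⟩
      ((ε ℚ.* ι d) ℚ.* ι t) ℚ.* 1ℚ                   ≡⟨ cong (((ε ℚ.* ι d) ℚ.* ι t) ℚ.*_) (sym (recip-* ρ)) ⟩
      ((ε ℚ.* ι d) ℚ.* ι t) ℚ.* (recip ρ ℚ.* ι ρ)
        ≡⟨ solve 5 (λ ε d t r ρ → ((ε :* d) :* t) :* (r :* ρ) := ((ε :* con ½) :* (con ½ :* r)) :* (con (ι 4) :* d :* ρ :* t)) refl
             ε (ι d) (ι t) (recip ρ) (ι ρ) ⟩
      ((ε ℚ.* ½) ℚ.* (½ ℚ.* recip ρ)) ℚ.* (ι 4 ℚ.* ι d ℚ.* ι ρ ℚ.* ι t)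
        ≡⟨ cong (((ε ℚ.* ½) ℚ.* (½ ℚ.* recip ρ)) ℚ.*_)
             (sym (trans (ι-* (4 * d * ρ) t) (cong (ℚ._* ι t) (trans (ι-* (4 * d) ρ) (cong (ℚ._* ι ρ) (ι-* 4 d)))))) ⟩
      ((ε ℚ.* ½) ℚ.* (½ ℚ.* recip ρ)) ℚ.* ι (4 * d * ρ * t)
        ≤⟨ ℚ.*-monoˡ-≤-nonNeg ((ε ℚ.* ½) ℚ.* (½ ℚ.* recip ρ)) ⦃ ℚ.nonNegative (*-≥0 0≤ε½ (*-≥0 ½≥0 (recip-≥0 ρ))) ⦄ (ι-mono-≤ le) ⟩
      ((ε ℚ.* ½) ℚ.* (½ ℚ.* recip ρ)) ℚ.* ι n
        ≡⟨ solve 3 (λ ε r n → ((ε :* con ½) :* (con ½ :* r)) :* n := (ε :* con ½) :* ((n :* con ½) :* r)) refl ε (recip ρ) (ι n) ⟩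
      (ε ℚ.* ½) ℚ.* ((ι n ℚ.* ½) ℚ.* recip ρ)        ∎) )
  where
  open ℚ.≤-Reasoning
  open Data.Rational.Solver.+-*-Solver
  ρ = root n
  instance _ = >-nonZero (1≤root 2≤n)
  0≤ε½ : 0ℚ ℚ.≤ ε ℚ.* ½
  0≤ε½ = *-≥0 (ℚ.<⇒≤ 0<ε) ½≥0
  0≤s : 0ℚ ℚ.≤ (ι n ℚ.* ½) ℚ.* recip ρ
  0≤s = *-≥0 (*-≥0 (ι-≥0 n) ½≥0) (recip-≥0 ρ)

-- The product is the numerator of `ε`, a positive integer.
denominator-clears : ∀ ε → 0ℚ ℚ.< ε → 1ℚ ℚ.≤ ε ℚ.* ι (↧ₙ ε)
denominator-clears ε@(mkℚ (ℤ.+ suc p) d-1 c) _ = ℚ.≤-trans (ι-mono-≤ {1} {suc p} (s≤s z≤n)) (ℚ.≤-reflexive (sym cleared))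
  where
  open ℚᵘ.≃-Reasoning
  cleared : ε ℚ.* ι (suc d-1) ≡ ι (suc p)
  cleared = ℚ.toℚᵘ-injective (begin
    ℚ.toℚᵘ (ε ℚ.* ι (suc d-1))                                    ≈⟨ ℚ.toℚᵘ-homo-* ε (ι (suc d-1)) ⟩
    ℚ.toℚᵘ ε ℚᵘ.* ℚ.toℚᵘ (ι (suc d-1))                            ≈⟨ ℚᵘ.*-congˡ {ℚ.toℚᵘ ε} (ℚ.toℚᵘ-fromℚᵘ (ℚᵘ.mkℚᵘ (ℤ.+ suc d-1) 0)) ⟩
    ℚᵘ.mkℚᵘ (ℤ.+ suc p) d-1 ℚᵘ.* ℚᵘ.mkℚᵘ (ℤ.+ suc d-1) 0          ≈⟨ ℚᵘ.*≡* (cong ℤ.+_ (regroup p d-1)) ⟩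
    ℚᵘ.mkℚᵘ (ℤ.+ suc p) 0                                         ≈⟨ ℚᵘ.≃-sym (ℚ.toℚᵘ-fromℚᵘ (ℚᵘ.mkℚᵘ (ℤ.+ suc p) 0)) ⟩
    ℚ.toℚᵘ (ι (suc p))                                            ∎)
    where
    regroup : ∀ p d → suc p * suc d * 1 ≡ suc p * (suc d * 1)
    regroup = solve-∀
denominator-clears (mkℚ (ℤ.+ zero) d-1 c) (ℚ.*<* (ℤ.+<+ ()))
denominator-clears (mkℚ -[1+ p ] d-1 c) (ℚ.*<* ())

goal-if-small : ∀ (t : ℕ → ℕ) → (∀ e → ∃[ N ] ∀ n → N ≤ n → e * root n * t n ≤ n) → (λ n → natural (t n)) ∈o goal
goal-if-small t small ε 0<ε with small (4 * ↧ₙ ε)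
... | N , bound = N ⊔ 2 , λ n N≤n →
  goal-lower (≤-trans (m≤n⊔m N 2) N≤n) (t n) ε 0<ε (↧ₙ ε) (denominator-clears ε 0<ε) (bound n (≤-trans (m≤m⊔n N 2) N≤n))

runtime : ℕ → (P Q : ℕ → ℕ) → ℕ → ℕ
runtime K P Q n = P n + K * (n / suc (lg n) * (suc (lg (lg n)) * suc (Q n)))

runtime-small : ∀ K P Q → Small P Q → (λ n → natural (runtime K P Q n)) ∈o goal
-- The 2 lets each of the two summands use up half of `n`. `suc K` absorbs the overhead and stays
-- positive, as the summand `P n` requires.
runtime-small K P Q small = goal-if-small (runtime K P Q) λ e → start e (small (2 * (e * suc K)))
  where
  bound : ∀ e n → let E = 2 * (e * suc K) in
          E * root n * P n ≤ n → E * root n * (suc (lg (lg n)) * suc (Q n)) ≤ suc (lg n) →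
          e * root n * runtime K P Q n ≤ n
  bound e n p≤ q≤ = *-cancelˡ-≤ 2 (begin
    2 * (e * ρ * (P n + K * (z * x)))                        ≡⟨ regroup e ρ (P n) K z x ⟩
    2 * e * ρ * P n + z * (2 * (e * K) * ρ * x)
      ≤⟨ +-mono-≤ (*-monoˡ-≤ (P n) (*-monoˡ-≤ ρ (*-monoʳ-≤ 2 (m≤m*n e (suc K)))))
           (*-monoʳ-≤ z (*-monoˡ-≤ x (*-monoˡ-≤ ρ (*-monoʳ-≤ 2 (*-monoʳ-≤ e (n≤1+n K)))))) ⟩
    2 * (e * suc K) * ρ * P n + z * (2 * (e * suc K) * ρ * x) ≤⟨ +-mono-≤ p≤ (≤-trans (*-monoʳ-≤ z q≤) (m/n*n≤m n (suc (lg n)))) ⟩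
    n + n                                                    ≡⟨ cong (λ y → n + y) (sym (+-identityʳ n)) ⟩
    2 * n                                                    ∎)
    where
    open ≤-Reasoning
    ρ = root n
    z = n / suc (lg n)
    x = suc (lg (lg n)) * suc (Q n)
    regroup : ∀ e ρ p K z x → 2 * (e * ρ * (p + K * (z * x))) ≡ 2 * e * ρ * p + z * (2 * (e * K) * ρ * x)
    regroup = solve-∀
  start : ∀ e → ∃[ N ] (∀ n → N ≤ n → 2 * (e * suc K) * root n * P n ≤ n ×
            2 * (e * suc K) * root n * (suc (lg (lg n)) * suc (Q n)) ≤ suc (lg n)) →
          ∃[ N ] ∀ n → N ≤ n → e * root n * runtime K P Q n ≤ n
  start e (N , bounds) = N , λ n N≤n → bound e n (proj₁ (bounds n N≤n)) (proj₂ (bounds n N≤n))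

-- Bounding the running time

module _ {U : ℕ} where

  dom-+ : ∀ {x y} K K′ → x ≤ K * U → y ≤ K′ * U → x + y ≤ (K + K′) * U
  dom-+ K K′ x≤ y≤ = ≤-trans (+-mono-≤ x≤ y≤) (≤-reflexive (sym (*-distribʳ-+ U K K′)))

  dom-const : ∀ {x} K → 1 ≤ U → x ≤ K → x ≤ K * U
  dom-const K 1≤U x≤ = ≤-trans x≤ (≤-trans (≤-reflexive (sym (*-identityʳ K))) (*-monoʳ-≤ K 1≤U))

  dom-scale : ∀ {x y} K K′ → x ≤ K → y ≤ K′ * U → x * y ≤ (K * K′) * U
  dom-scale K K′ x≤ y≤ = ≤-trans (*-mono-≤ x≤ y≤) (≤-reflexive (sym (*-assoc K K′ U)))

  dom-* : ∀ {U′ x y} K K′ → x ≤ K * U′ → y ≤ K′ * U → x * y ≤ (K * K′) * (U′ * U)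
  dom-* {U′} K K′ x≤ y≤ = ≤-trans (*-mono-≤ x≤ y≤) (≤-reflexive (interchange K K′ U′ U))
    where
    interchange : ∀ a b c d → (a * c) * (b * d) ≡ (a * b) * (c * d)
    interchange = solve-∀

  dom-lift : ∀ {U′ x} K → U ≤ U′ → x ≤ K * U → x ≤ K * U′
  dom-lift K U≤ x≤ = ≤-trans x≤ (*-monoʳ-≤ K U≤)

-- Costs, as functions of the words per pattern W, the digits per word d, the
-- query time q, the logarithm of the stride E, the patterns k, the strides in the
-- suffix array s, the base B and the words of the text l.  As their coefficients
-- are natural, multiples of units bounding the arguments give a bound on the cost,
-- namely its value at the multipliers times a unit.

revC : ℕ → ℕ
revC d = 3 + d * 9

cmpC : (W d : ℕ) → ℕ
cmpC W d = 9 + W * (19 + (revC d + revC d))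

locateC testC checkC : (W d q : ℕ) → ℕ
locateC W d q = 1 + (q + (1 + cmpC W d))
testC W d q   = 2 + (1 + (1 + locateC W d q))
checkC W d q  = 1 + (1 + (locateC W d q + (1 + (3 + (1 + 1)))))

oneC : (W d q E : ℕ) → ℕ
oneC W d q E = 2 + (testC W d q + (1 + (1 + ((1 + E * (4 + testC W d q)) + (checkC W d q + 2)))))

searchC : (W d q E k s : ℕ) → ℕ
searchC W d q E k s = 4 + ((1 + (k * (1 + oneC W d q E) + s * (2 + testC W d q))) + 1)

wordC : (d k B : ℕ) → ℕ
wordC d k B = 3 + (1 + d * (1 + (3 + ((1 + k * (1 + (12 + revC d))) + (2 + ((1 + (B * 5 + k * 5)) + 2))))))

sortC : (W d k B : ℕ) → ℕ
sortC W d k B = (1 + (1 + k * 3)) + (1 + (1 + W * (1 + wordC d k B)))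

inputC : (B l : ℕ) → ℕ
inputC B l = 6 + ((5 + B * 10) + (2 + ((1 + (1 + l) * 4) + 1)))

costC : (W d q E k s B l : ℕ) → ℕ
costC W d q E k s B l = inputC B l + (sortC W d k B + searchC W d q E k s)

module _ {W d q E k s B l ℓ z : ℕ} (M G η κ : ℕ)
         (W≤ : W ≤ M) (d≤ : d ≤ G) (E≤ : E ≤ η * suc ℓ) (k≤ : k ≤ κ * z) (s≤ : s ≤ 4 * z) (B≤ : B ≤ 32 * z) (l≤ : l ≤ z)
         (1≤z : 1 ≤ z) where

  private
    -- `S` is the unit for one test, `Y` for the search of one pattern and `z * Y` for the whole
    -- run.
    S = suc q
    Y = suc ℓ * S
    1≤S : 1 ≤ S
    1≤S = s≤s z≤n
    S≤Y : S ≤ Y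
    S≤Y = m≤m+n S (ℓ * S)
    1≤Y : 1 ≤ Y
    1≤Y = ≤-trans 1≤S S≤Y
    z≤zY : z ≤ z * Y
    z≤zY = m≤m*n z Y ⦃ >-nonZero 1≤Y ⦄

    rev≤ : revC d ≤ revC G
    rev≤ = +-monoʳ-≤ 3 (*-monoˡ-≤ 9 d≤)

    cmp≤ : cmpC W d ≤ cmpC M G
    cmp≤ = +-monoʳ-≤ 9 (*-mono-≤ W≤ (+-monoʳ-≤ 19 (+-mono-≤ rev≤ rev≤)))

    locate≤ : locateC W d q ≤ locateC M G 1 * S
    locate≤ = dom-+ {S} 1 (1 + (1 + cmpC M G)) (dom-const {S} 1 1≤S ≤-refl)
      (dom-+ {S} 1 (1 + cmpC M G) (≤-trans (n≤1+n q) (≤-reflexive (sym (*-identityˡ S))))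
        (dom-const {S} (1 + cmpC M G) 1≤S (s≤s cmp≤)))

    test≤ : testC W d q ≤ testC M G 1 * S
    test≤ = dom-+ {S} 2 (2 + locateC M G 1) (dom-const {S} 2 1≤S ≤-refl)
      (dom-+ {S} 2 (locateC M G 1) (dom-const {S} 2 1≤S ≤-refl) locate≤)

    check≤ : checkC W d q ≤ checkC M G 1 * S
    check≤ = dom-+ {S} 2 (locateC M G 1 + 6) (dom-const {S} 2 1≤S ≤-refl) (dom-+ {S} (locateC M G 1) 6 locate≤ (dom-const {S} 6 1≤S ≤-refl))

    one≤ : oneC W d q E ≤ oneC M G 1 η * Y
    one≤ = dom-+ {Y} 2 (testC M G 1 + (1 + (1 + ((1 + η * (4 + testC M G 1)) + (checkC M G 1 + 2))))) (dom-const {Y} 2 1≤Y ≤-refl)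
      (dom-+ {Y} (testC M G 1) (2 + ((1 + η * (4 + testC M G 1)) + (checkC M G 1 + 2))) (dom-lift (testC M G 1) S≤Y test≤)
      (dom-+ {Y} 2 ((1 + η * (4 + testC M G 1)) + (checkC M G 1 + 2)) (dom-const {Y} 2 1≤Y ≤-refl)
      (dom-+ {Y} (1 + η * (4 + testC M G 1)) (checkC M G 1 + 2)
        (dom-+ {Y} 1 (η * (4 + testC M G 1)) (dom-const {Y} 1 1≤Y ≤-refl)
          (dom-* {S} {suc ℓ} η (4 + testC M G 1) E≤ (dom-+ {S} 4 (testC M G 1) (dom-const {S} 4 1≤S ≤-refl) test≤)))
        (dom-+ {Y} (checkC M G 1) 2 (dom-lift (checkC M G 1) S≤Y check≤) (dom-const {Y} 2 1≤Y ≤-refl)))))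

    1≤U : 1 ≤ z * Y
    1≤U = ≤-trans 1≤z z≤zY

  search-dominated : searchC W d q E k s ≤ searchC M G 1 η κ 4 * (z * Y)
  search-dominated = dom-+ {z * Y} 4 ((1 + (κ * (1 + oneC M G 1 η) + 4 * (2 + testC M G 1))) + 1) (dom-const {z * Y} 4 1≤U ≤-refl)
    (dom-+ {z * Y} (1 + (κ * (1 + oneC M G 1 η) + 4 * (2 + testC M G 1))) 1
      (dom-+ {z * Y} 1 (κ * (1 + oneC M G 1 η) + 4 * (2 + testC M G 1)) (dom-const {z * Y} 1 1≤U ≤-refl)
        (dom-+ {z * Y} (κ * (1 + oneC M G 1 η)) (4 * (2 + testC M G 1))
          (dom-* {Y} {z} κ (1 + oneC M G 1 η) k≤ (dom-+ {Y} 1 (oneC M G 1 η) (dom-const {Y} 1 1≤Y ≤-refl) one≤))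
          (dom-* {Y} {z} 4 (2 + testC M G 1) s≤ (dom-lift (2 + testC M G 1) S≤Y (dom-+ {S} 2 (testC M G 1) (dom-const {S} 2 1≤S ≤-refl) test≤)))))
      (dom-const {z * Y} 1 1≤U ≤-refl))

  private
    k≤z*c : ∀ {x} c → x ≤ c → k * x ≤ (κ * c) * z
    k≤z*c c x≤ = ≤-trans (*-mono-≤ k≤ x≤) (≤-reflexive (swap κ z c))
      where
      swap : ∀ a b c → a * b * c ≡ a * c * b
      swap = solve-∀

    B≤z*c : ∀ c → B * c ≤ (32 * c) * z
    B≤z*c c = ≤-trans (*-monoˡ-≤ c B≤) (≤-reflexive (swap 32 z c))
      where
      swap : ∀ a b c → a * b * c ≡ a * c * b
      swap = solve-∀

    word≤ : wordC d k B ≤ wordC G κ 32 * z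
    word≤ = dom-+ {z} 4 (G * (1 + (3 + ((1 + κ * (1 + (12 + revC G))) + (2 + ((1 + (32 * 5 + κ * 5)) + 2)))))) (dom-const {z} 4 1≤z ≤-refl)
      (dom-scale {z} G (1 + (3 + ((1 + κ * (1 + (12 + revC G))) + (2 + ((1 + (32 * 5 + κ * 5)) + 2))))) d≤
      (dom-+ {z} 4 ((1 + κ * (1 + (12 + revC G))) + (2 + ((1 + (32 * 5 + κ * 5)) + 2))) (dom-const {z} 4 1≤z ≤-refl)
      (dom-+ {z} (1 + κ * (1 + (12 + revC G))) (2 + ((1 + (32 * 5 + κ * 5)) + 2))
        (dom-+ {z} 1 (κ * (1 + (12 + revC G))) (dom-const {z} 1 1≤z ≤-refl) (k≤z*c (1 + (12 + revC G)) (+-monoʳ-≤ 13 rev≤)))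
      (dom-+ {z} 2 ((1 + (32 * 5 + κ * 5)) + 2) (dom-const {z} 2 1≤z ≤-refl)
      (dom-+ {z} (1 + (32 * 5 + κ * 5)) 2
        (dom-+ {z} 1 (32 * 5 + κ * 5) (dom-const {z} 1 1≤z ≤-refl) (dom-+ {z} (32 * 5) (κ * 5) (B≤z*c 5) (k≤z*c 5 ≤-refl)))
        (dom-const {z} 2 1≤z ≤-refl))))))

  sort-dominated : sortC W d k B ≤ sortC M G κ 32 * (z * Y)
  sort-dominated = dom-lift (sortC M G κ 32) z≤zY
    (dom-+ {z} (2 + κ * 3) (2 + M * (1 + wordC G κ 32))
      (dom-+ {z} 2 (κ * 3) (dom-const {z} 2 1≤z ≤-refl) (k≤z*c 3 ≤-refl))
      (dom-+ {z} 2 (M * (1 + wordC G κ 32)) (dom-const {z} 2 1≤z ≤-refl)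
        (dom-scale {z} M (1 + wordC G κ 32) W≤ (dom-+ {z} 1 (wordC G κ 32) (dom-const {z} 1 1≤z ≤-refl) word≤))))

  input-dominated : inputC B l ≤ inputC 32 1 * (z * Y)
  input-dominated = dom-lift (inputC 32 1) z≤zY
    (dom-+ {z} 6 ((5 + 32 * 10) + (2 + ((1 + (1 + 1) * 4) + 1))) (dom-const {z} 6 1≤z ≤-refl)
    (dom-+ {z} (5 + 32 * 10) (2 + ((1 + (1 + 1) * 4) + 1)) (dom-+ {z} 5 (32 * 10) (dom-const {z} 5 1≤z ≤-refl) (B≤z*c 10))
    (dom-+ {z} 2 ((1 + (1 + 1) * 4) + 1) (dom-const {z} 2 1≤z ≤-refl)
    (dom-+ {z} (1 + (1 + 1) * 4) 1
      (dom-+ {z} 1 ((1 + 1) * 4) (dom-const {z} 1 1≤z ≤-refl)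
        (≤-trans (*-monoˡ-≤ 4 (dom-+ {z} 1 1 (dom-const {z} 1 1≤z ≤-refl) (≤-trans l≤ (≤-reflexive (sym (*-identityˡ z))))))
          (≤-reflexive (swap (1 + 1) z 4))))
      (dom-const {z} 1 1≤z ≤-refl)))))
    where
    swap : ∀ a b c → a * b * c ≡ a * c * b
    swap = solve-∀

  cost-dominated : costC W d q E k s B l ≤ costC M G 1 η κ 4 32 1 * (z * Y)
  cost-dominated = dom-+ {z * Y} (inputC 32 1) (sortC M G κ 32 + searchC M G 1 η κ 4) input-dominated
    (dom-+ {z * Y} (sortC M G κ 32) (searchC M G 1 η κ 4) sort-dominated search-dominated)

module _ (I : Instance) (S : DataStructure) (t q : ℕ)
         (preprocessing : HaltsWithin (Instance.w I) (preprocess S) (textInput (Instance.w I) (Instance.T I)) t (λ _ → ⊤))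
         (answers : ∀ σ i → Reachable (Instance.w I) S (Instance.T I) σ → 1 ≤ i → i ≤ Instance.n I →
                    HaltsWithin (Instance.w I) (query S) (setReg 0 i σ) q (λ τ → IsSA (Instance.T I) i (reg τ 0)))
         where
  open Instance I

  -- Preprocessing is set apart because it enters with coefficient 1; all else is estimated by
  -- `cost-dominated`.
  solveCost-split : solveCost I S t q preprocessing answers ≡
                    t + costC words digits q E k (n >> E) (2 ^ b) (n / w)
  solveCost-split = regroup (2 ^ b) (suc (suc (n / w) * 4) + 1) t (sortC words digits k (2 ^ b) + searchC words digits q E k (n >> E))
    where
    regroup : ∀ B c t x → 6 + ((5 + B * 10) + ((2 + c) + (t + x))) ≡ t + ((6 + ((5 + B * 10) + (2 + c))) + x)
    regroup = solve-∀

-- The parameters of an input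

ι-cancel-< : ∀ {a b} → ι a ℚ.< ι b → a < b
ι-cancel-< ιa<ιb = ≰⇒> (λ b≤a → ℚ.<-irrefl refl (ℚ.<-≤-trans ιa<ιb (ι-mono-≤ b≤a)))

-- For the smallest n, `lg` is too coarse to bound the word size from below. Here the reason is that
-- 2^3 ≤ 1.9^4, and in the next lemma that 2^3 ≤ 2.9^2.
log-2-lower : Lower (log 2) (ℤ.+ 3 ℚ./ 4)
log-2-lower = ℤ.+ 19 ℚ./ 10 , toWitness {a? = 0ℚ ℚ.≤? (ℤ.+ 19 ℚ./ 10)} tt , toWitness {a? = (ℤ.+ 19 ℚ./ 10) ℚ.<? ι 2} tt ,
  toWitness {a? = 2^⁺ (ℤ.+ 3) ℚ.≤? ((ℤ.+ 19 ℚ./ 10) ^^ 4) ℚ.* 1ℚ} tt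

log-3-lower : ∀ {n} → 3 ≤ n → Lower (log n) (ℤ.+ 3 ℚ./ 2)
log-3-lower 3≤n = ℤ.+ 29 ℚ./ 10 , toWitness {a? = 0ℚ ℚ.≤? (ℤ.+ 29 ℚ./ 10)} tt ,
  ℚ.<-≤-trans (toWitness {a? = (ℤ.+ 29 ℚ./ 10) ℚ.<? ι 3} tt) (ι-mono-≤ 3≤n) ,
  toWitness {a? = 2^⁺ (ℤ.+ 3) ℚ.≤? ((ℤ.+ 29 ℚ./ 10) ^^ 2) ℚ.* 1ℚ} tt

module _ {c : Cut} (2≤c : natural 2 ≤ᴿ c) {w : ℕ → ℕ} (isWordSize : IsWordSize c w) {n : ℕ} (2≤n : 2 ≤ n) where

  private
    L = lg n

  wordSize-above : ∀ j r s → 0ℚ ℚ.≤ r → 0ℚ ℚ.≤ s → r ℚ.< ι 2 → Lower (log n) s → ι j ℚ.≤ r ℚ.* s → j < w n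
  wordSize-above j r s 0≤r 0≤s r<2 s<log j≤rs =
    ι-cancel-< (proj₁ (isWordSize n 2≤n) (ι j) (inj₂ (r , s , 0≤r , 0≤s , 2≤c r r<2 , s<log , j≤rs)))

  2lg≤wordSize : 1 ≤ L → 2 * L ≤ w n
  2lg≤wordSize 1≤L = ≤-trans (≤-reflexive (sym 1+j≡)) (wordSize-above j r (ι L) 0≤r (ι-≥0 L) r<2 (log-lower 2≤n {L} (2^lg< n 2≤n))
    (ℚ.≤-reflexive (sym rL≡)))
    where
    instance _ = >-nonZero 1≤L
    -- A rational strictly below 2 must multiply `L`, so 2L - 1 is written as (2 - 1/L) L. As
    -- `wordSize-above` yields `j < w n`, nothing is lost by the rounding.
    j = 2 * L ∸ 1
    1+j≡ : suc j ≡ 2 * L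
    1+j≡ = m+[n∸m]≡n (≤-trans 1≤L (m≤n*m L 2))
    r = ι j ℚ.* recip L
    0≤r : 0ℚ ℚ.≤ r
    0≤r = *-≥0 (ι-≥0 j) (recip-≥0 L)
    rL≡ : r ℚ.* ι L ≡ ι j
    rL≡ = trans (ℚ.*-assoc (ι j) (recip L) (ι L)) (trans (cong (ι j ℚ.*_) (recip-* L)) (ℚ.*-identityʳ (ι j)))
    r<2 : r ℚ.< ι 2
    r<2 = ℚ.*-cancelʳ-<-nonNeg (ι L) ⦃ ℚ.nonNegative (ι-≥0 L) ⦄
      (ℚ.≤-<-trans (ℚ.≤-reflexive rL≡) (ℚ.<-≤-trans (ι-mono-< {j} {2 * L} (≤-reflexive 1+j≡)) (ℚ.≤-reflexive (ι-* 2 L))))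

  -- If `L` is at least 2, then `2 * L` is at least `2 + L`, which suffices. This leaves n = 2 and,
  -- with `L ≡ 1`, n = 3 and n = 4, where the sharper logarithms give 2 ≤ w and 3 ≤ w.
  wordSize-large : 2 ≤ w n × n < 2 ^ w n × suc L ≤ w n
  wordSize-large with n ≟ 2
  ... | yes refl = 2≤w , ≤-trans (s≤s (s≤s (s≤s z≤n))) (^-monoʳ-≤ 2 2≤w) , ≤-trans (s≤s z≤n) 2≤w
    where
    2≤w : 2 ≤ w 2
    2≤w = wordSize-above 1 (ℤ.+ 3 ℚ./ 2) (ℤ.+ 3 ℚ./ 4) (toWitness {a? = 0ℚ ℚ.≤? (ℤ.+ 3 ℚ./ 2)} tt)
      (toWitness {a? = 0ℚ ℚ.≤? (ℤ.+ 3 ℚ./ 4)} tt) (toWitness {a? = (ℤ.+ 3 ℚ./ 2) ℚ.<? ι 2} tt) log-2-lower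
      (toWitness {a? = ι 1 ℚ.≤? (ℤ.+ 3 ℚ./ 2) ℚ.* (ℤ.+ 3 ℚ./ 4)} tt)
  ... | no n≢2 = go (2 ≤? L)
    where
    3≤w : 3 ≤ w n
    3≤w = wordSize-above 2 (ℤ.+ 3 ℚ./ 2) (ℤ.+ 3 ℚ./ 2) (toWitness {a? = 0ℚ ℚ.≤? (ℤ.+ 3 ℚ./ 2)} tt)
      (toWitness {a? = 0ℚ ℚ.≤? (ℤ.+ 3 ℚ./ 2)} tt) (toWitness {a? = (ℤ.+ 3 ℚ./ 2) ℚ.<? ι 2} tt)
      (log-3-lower (≤∧≢⇒< 2≤n (n≢2 ∘ sym)))
      (toWitness {a? = ι 2 ℚ.≤? (ℤ.+ 3 ℚ./ 2) ℚ.* (ℤ.+ 3 ℚ./ 2)} tt)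
    go : Dec (2 ≤ L) → 2 ≤ w n × n < 2 ^ w n × suc L ≤ w n
    go (no L<2) = <⇒≤ 3≤w , ≤-<-trans (≤2^lg n) (^-monoʳ-< 2 (s≤s (s≤s z≤n)) (<-≤-trans (s≤s (≰⇒> L<2)) 3≤w)) ,
      ≤-trans (≰⇒> L<2) (<⇒≤ 3≤w)
    go (yes 2≤L) = <⇒≤ 3≤w , ≤-<-trans (≤2^lg n) (^-monoʳ-< 2 (s≤s (s≤s z≤n)) 2+L≤w) , <⇒≤ 2+L≤w
      where
      2+L≤w : 2 + L ≤ w n
      2+L≤w = ≤-trans (+-monoˡ-≤ L 2≤L) (≤-trans (≤-reflexive (cong (L +_) (sym (+-identityʳ L)))) (2lg≤wordSize (<⇒≤ 2≤L)))

  -- `w n` is the least natural that is at least c log n, and `C * suc L` is one because c < C and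
  -- log n ≤ `suc L`.
  wordSize-≤ : IsReal c → ∀ C → Upper c (ι C) → w n ≤ C * suc L
  wordSize-≤ isReal C c<C = proj₂ (isWordSize n 2≤n) (C * suc L) below
    where
    below-C : ∀ {r} → Lower c r → r ℚ.< ι C
    below-C {r} r<c = ℚ.≰⇒> λ C≤r → IsReal.disjoint isReal (r<c , IsReal.upper-up isReal C≤r c<C)
    below : c *ᴿ log n ≤ᴿ natural (C * suc L)
    below q (inj₁ q<0) = ℚ.<-≤-trans q<0 (ι-≥0 (C * suc L))
    below q (inj₂ (r , s , 0≤r , 0≤s , r<c , s<log , q≤rs)) = begin-strict
      q                      ≤⟨ q≤rs ⟩
      r ℚ.* s                ≤⟨ ℚ.*-monoˡ-≤-nonNeg r ⦃ ℚ.nonNegative 0≤r ⦄ (log-≤ 2≤n s s<log) ⟩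
      r ℚ.* ι (suc L)        <⟨ ℚ.*-monoˡ-<-pos (ι (suc L)) ⦃ ℚ.positive (ι-mono-< {0} {suc L} (s≤s z≤n)) ⦄ (below-C r<c) ⟩
      ι C ℚ.* ι (suc L)      ≡⟨ sym (ι-* C (suc L)) ⟩
      ι (C * suc L)          ∎
      where open ℚ.≤-Reasoning

natural-above : ∀ {c} → IsReal c → ∃[ C ] Upper c (ι C)
natural-above isReal with IsReal.upper-inhabited isReal
... | q , c<q = ℤ.∣ ↥ q ∣ , IsReal.upper-up isReal (q≤ q) c<q
  where
  q≤ : ∀ q → q ℚ.≤ ι ℤ.∣ ↥ q ∣
  q≤ (mkℚ (ℤ.+ p) d-1 c) rewrite ι-mkℚ p = ℚ.*≤* (ℤ.≤-trans (ℤ.≤-reflexive (ℤ.*-identityʳ (ℤ.+ p)))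
    (ℤ.≤-trans (ℤ.+≤+ (m≤m*n p (suc d-1))) (ℤ.≤-reflexive (ℤ.pos-* p (suc d-1)))))
  q≤ q@(mkℚ -[1+ p ] d-1 c) = ℚ.≤-trans (ℚ.<⇒≤ (ℚ.negative⁻¹ q)) (ι-≥0 (suc p))

module _ {n : ℕ} (2≤n : 2 ≤ n) where

  private
    L = lg n

  blocks : ℕ
  blocks = n / suc L

  1+lg≤n : suc L ≤ n
  1+lg≤n = ≤-trans (s≤s (<⇒≤ (n<2^n L))) (2^lg< n 2≤n)

  1≤blocks : 1 ≤ blocks
  1≤blocks = ≤-trans (≤-reflexive (sym (n/n≡1 (suc L)))) (/-monoˡ-≤ (suc L) 1+lg≤n)

  n≤blocks : n ≤ 2 * (blocks * suc L)
  n≤blocks = begin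
    n                                   ≡⟨ m≡m%n+[m/n]*n n (suc L) ⟩
    n % suc L + blocks * suc L          ≤⟨ +-monoˡ-≤ (blocks * suc L) (<⇒≤ (m%n<n n (suc L))) ⟩
    suc L + blocks * suc L              ≤⟨ +-monoˡ-≤ (blocks * suc L) (m≤n*m (suc L) blocks ⦃ >-nonZero 1≤blocks ⦄) ⟩
    blocks * suc L + blocks * suc L     ≡⟨ cong (λ y → blocks * suc L + y) (sym (+-identityʳ (blocks * suc L))) ⟩
    2 * (blocks * suc L)                ∎
    where open ≤-Reasoning

  ≤blocks : ∀ {x} c → x * suc L ≤ c * n → x ≤ (2 * c) * blocks
  ≤blocks {x} c x≤ = *-cancelʳ-≤ x ((2 * c) * blocks) (suc L) (begin
    x * suc L                       ≤⟨ x≤ ⟩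
    c * n                           ≤⟨ *-monoʳ-≤ c n≤blocks ⟩
    c * (2 * (blocks * suc L))      ≡⟨ regroup c blocks (suc L) ⟩
    (2 * c) * blocks * suc L        ∎)
    where
    open ≤-Reasoning
    regroup : ∀ c z l → c * (2 * (z * l)) ≡ (2 * c) * z * l
    regroup = solve-∀

  private
    quarter = suc L / 4

  -- The power is roughly n^(1/4), so a logarithmic factor is affordable: `suc L ≤ 4 * 2 ^ quarter`
  -- bounds the product with `suc L` by `4 * 2 ^ suc L`, hence by `8 * n`.
  2^quarter≤ : 2 ^ quarter ≤ 16 * blocks
  2^quarter≤ = ≤blocks 8 (begin
    2 ^ quarter * suc L                 ≤⟨ *-monoʳ-≤ (2 ^ quarter) 1+L≤ ⟩
    2 ^ quarter * (4 * 2 ^ quarter)     ≡⟨ regroup (2 ^ quarter) ⟩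
    4 * (2 ^ quarter * 2 ^ quarter)     ≡⟨ cong (4 *_) (sym (^-distribˡ-+-* 2 quarter quarter)) ⟩
    4 * 2 ^ (quarter + quarter)         ≤⟨ *-monoʳ-≤ 4 (^-monoʳ-≤ 2 two-quarters) ⟩
    4 * 2 ^ suc L                       ≡⟨ sym (*-assoc 4 2 (2 ^ L)) ⟩
    8 * 2 ^ L                           ≤⟨ *-monoʳ-≤ 8 (<⇒≤ (2^lg< n 2≤n)) ⟩
    8 * n                               ∎)
    where
    open ≤-Reasoning
    regroup : ∀ p → p * (4 * p) ≡ 4 * (p * p)
    regroup = solve-∀
    1+L≤ : suc L ≤ 4 * 2 ^ quarter
    1+L≤ = ≤-trans (≤-trans (≤-reflexive (m≡m%n+[m/n]*n (suc L) 4)) (+-monoˡ-≤ (quarter * 4) (<⇒≤ (m%n<n (suc L) 4))))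
      (≤-trans (≤-reflexive (*-comm (suc quarter) 4)) (*-monoʳ-≤ 4 (n<2^n quarter)))
    two-quarters : quarter + quarter ≤ suc L
    two-quarters = ≤-trans (+-monoʳ-≤ quarter (m≤n*m quarter 3)) (≤-trans (≤-reflexive (*-comm 4 quarter)) (m/n*n≤m (suc L) 4))

  1+lg≤blocks : suc L ≤ 64 * blocks
  1+lg≤blocks = begin
    suc L                    ≡⟨ m≡m%n+[m/n]*n (suc L) 4 ⟩
    suc L % 4 + quarter * 4  ≤⟨ +-monoˡ-≤ (quarter * 4) (<⇒≤ (m%n<n (suc L) 4)) ⟩
    suc quarter * 4          ≡⟨ *-comm (suc quarter) 4 ⟩
    4 * suc quarter          ≤⟨ *-monoʳ-≤ 4 (≤-trans (n<2^n quarter) 2^quarter≤) ⟩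
    4 * (16 * blocks)        ≡⟨ sym (*-assoc 4 16 blocks) ⟩
    64 * blocks              ∎
    where open ≤-Reasoning

  -- The origin of the digit length: shifting by `C` cancels the factor `C < 2 ^ C` in the bound on
  -- the word size, and shifting by 2 more leaves at most a quarter of `suc L`.
  base-≤ : ∀ {w} C → w ≤ C * suc L → 2 ^ suc (w >> (2 + C)) ≤ 32 * blocks
  base-≤ {w} C w≤ = begin
    2 * 2 ^ (w >> (2 + C))   ≤⟨ *-monoʳ-≤ 2 (^-monoʳ-≤ 2 chunk≤) ⟩
    2 * 2 ^ quarter          ≤⟨ *-monoʳ-≤ 2 2^quarter≤ ⟩
    2 * (16 * blocks)        ≡⟨ sym (*-assoc 2 16 blocks) ⟩
    32 * blocks              ∎
    where
    open ≤-Reasoning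
    instance
      _ = 2^≢0 C
      _ = 2^≢0 (2 + C)
    chunk≤ : w >> (2 + C) ≤ quarter
    chunk≤ = begin
      w >> (2 + C)           ≡⟨ trans (cong (w >>_) (+-comm 2 C)) (>>-+ w C 2) ⟩
      w / 2 ^ C / 4          ≤⟨ /-monoˡ-≤ 4 (≤-trans (/-monoˡ-≤ (2 ^ C) (≤-trans w≤ (≤-trans (*-monoˡ-≤ (suc L) (<⇒≤ (n<2^n C)))
                                  (≤-reflexive (*-comm (2 ^ C) (suc L)))))) (≤-reflexive (m*n/n≡m (suc L) (2 ^ C)))) ⟩
      suc L / 4              ∎

  patterns-≤ : ∀ a {k} → natural k ≤ᴿ natural a *ᴿ (natural n /ᴿ log n) → k ≤ (2 * (4 * a)) * blocks
  patterns-≤ a {k} k≤ = ≤blocks (4 * a) (begin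
    k * suc L                       ≤⟨ *-monoʳ-≤ k (half L) ⟩
    k * (2 * (1 * (1 * (L ⊔ 1))))   ≡⟨ regroup k (1 * (1 * (L ⊔ 1))) ⟩
    2 * (k * (1 * (1 * (L ⊔ 1))))   ≤⟨ *-monoʳ-≤ 2 (natural-≤ {k} {a * (n * 1)} {1 * (1 * (L ⊔ 1))} (natural a *ᴿ (natural n /ᴿ log n)) k≤ bounded) ⟩
    2 * (2 * (a * (n * 1)))         ≡⟨ regroup′ a n ⟩
    4 * a * n                       ∎)
    where
    open ≤-Reasoning
    regroup : ∀ k x → k * (2 * x) ≡ 2 * (k * x)
    regroup = solve-∀
    regroup′ : ∀ a n → 2 * (2 * (a * (n * 1))) ≡ 4 * a * n
    regroup′ = solve-∀
    half : ∀ L → suc L ≤ 2 * (1 * (1 * (L ⊔ 1)))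
    half zero    = s≤s z≤n
    half (suc l) = ≤-trans (s≤s (s≤s (≤-trans (m≤n+m l l) (≤-reflexive (sym (cong (l +_) (+-identityʳ l)))))))
      (≤-reflexive (trans (double l) (cong (λ z → 2 * (1 * (1 * suc z))) (sym (⊔-identityʳ l)))))
      where
      double : ∀ l → 2 + (l + (l + 0)) ≡ 2 * (1 * (1 * suc l))
      double = solve-∀
    -- As `lg 2` is 0, it gives no bound on the inverse of log n; for n = 2 the bound 1 ≤ log n is
    -- used.
    log-≥′ : ∀ u → Upper (log n) u → ι (L ⊔ 1) ℚ.≤ ι 1 ℚ.* u
    log-≥′ u <u with ⊔-sel L 1
    ... | inj₁ max≡ rewrite max≡ = ℚ.≤-trans (log-≥ 2≤n u <u) (ℚ.≤-reflexive (sym (ℚ.*-identityˡ u)))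
    ... | inj₂ max≡ rewrite max≡ = ℚ.≤-trans
      (log₂-≥ {natural n} {1} (λ r n<r → ℚ.≤-trans (ι-mono-≤ 2≤n) (ℚ.<⇒≤ n<r)) u <u) (ℚ.≤-reflexive (sym (ℚ.*-identityˡ u)))
    bounded : Bounded (natural a *ᴿ (natural n /ᴿ log n)) (a * (n * 1)) (1 * (1 * (L ⊔ 1)))
    bounded = bounded-* {natural a} {natural n /ᴿ log n} {a} {n * 1} {1} {1 * (L ⊔ 1)} (bounded-natural a)
      (bounded-* {natural n} {inverse (log n)} {n} {1} {1} {L ⊔ 1} (bounded-natural n)
        (bounded-inverse {log n} {1} {L ⊔ 1} log-≥′))

  words-≤ : ∀ a {m w} .⦃ _ : NonZero w ⦄ → natural m ≤ᴿ natural a *ᴿ log n → suc L ≤ w → suc ((m ∸ 1) / w) ≤ suc (2 * a)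
  words-≤ a {m} {w} m≤ L<w = s≤s (≤-trans (/-monoˡ-≤ w (≤-trans (m∸n≤m m 1) m≤2aw)) (≤-reflexive (m*n/n≡m (2 * a) w)))
    where
    open ≤-Reasoning
    m≤2aw : m ≤ 2 * a * w
    m≤2aw = begin
      m                     ≡⟨ sym (*-identityʳ m) ⟩
      m * (1 * 1)           ≤⟨ natural-≤ {m} {a * suc L} {1 * 1} (natural a *ᴿ log n) m≤
                                 (bounded-* {natural a} {log n} {a} {suc L} {1} {1} (bounded-natural a) (bounded-log 2≤n)) ⟩
      2 * (a * suc L)       ≤⟨ *-monoʳ-≤ 2 (*-monoʳ-≤ a L<w) ⟩
      2 * (a * w)           ≡⟨ sym (*-assoc 2 a w) ⟩
      2 * a * w             ∎

  text-words-≤ : ∀ {w} .⦃ _ : NonZero w ⦄ → suc L ≤ w → n / w ≤ blocks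
  text-words-≤ {w} L<w = /-monoʳ-≤ n {w} {suc L} L<w

  strides-≤ : ∀ {w E} → suc L ≤ w → w < 2 ^ suc E → n >> E ≤ 4 * blocks
  strides-≤ {w} {E} L<w w< = *-cancelʳ-≤ (n >> E) (4 * blocks) (2 ^ E) (begin
    (n >> E) * 2 ^ E               ≤⟨ m/n*n≤m n (2 ^ E) ⟩
    n                              ≤⟨ n≤blocks ⟩
    2 * (blocks * suc L)           ≤⟨ *-monoʳ-≤ 2 (*-monoʳ-≤ blocks (≤-trans L<w (<⇒≤ w<))) ⟩
    2 * (blocks * (2 * 2 ^ E))     ≡⟨ regroup blocks (2 ^ E) ⟩
    4 * blocks * 2 ^ E             ∎)
    where
    open ≤-Reasoning
    instance _ = 2^≢0 E
    regroup : ∀ z p → 2 * (z * (2 * p)) ≡ 4 * z * p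
    regroup = solve-∀

  stride-log-≤ : ∀ {w E} C → w ≤ C * suc L → 2 ^ E ≤ w → E ≤ (2 + C) * suc (lg L)
  stride-log-≤ {w} {E} C w≤ ≤w = ≤-trans (2^-cancel-≤ (begin
    2 ^ E                        ≤⟨ ≤-trans ≤w w≤ ⟩
    C * suc L                    ≤⟨ *-mono-≤ (<⇒≤ (n<2^n C)) (≤-trans (s≤s (≤2^lg L)) (^-monoʳ-< 2 (s≤s (s≤s z≤n)) (n<1+n (suc (lg L))))) ⟩
    2 ^ C * 2 ^ (2 + lg L)       ≡⟨ sym (^-distribˡ-+-* 2 C (2 + lg L)) ⟩
    2 ^ (C + (2 + lg L))         ∎))
    (begin
      C + (2 + lg L)             ≡⟨ regroup C (lg L) ⟩
      (2 + C) + lg L             ≤⟨ +-monoʳ-≤ (2 + C) (m≤n*m (lg L) (2 + C)) ⟩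
      (2 + C) + (2 + C) * lg L   ≡⟨ sym (*-suc (2 + C) (lg L)) ⟩
      (2 + C) * suc (lg L)       ∎)
    where
    open ≤-Reasoning
    regroup : ∀ c l → c + (2 + l) ≡ 2 + c + l
    regroup = solve-∀

digits-≤ : ∀ w h → suc (w / suc (w >> h)) ≤ suc (2 ^ h)
digits-≤ w h = s≤s (≤-trans (/-monoˡ-≤ b w≤) (≤-reflexive (m*n/n≡m (2 ^ h) b)))
  where
  instance _ = 2^≢0 h
  b = suc (w >> h)
  w≤ : w ≤ 2 ^ h * b
  w≤ = ≤-trans (≤-reflexive (m≡m%n+[m/n]*n w (2 ^ h)))
    (≤-trans (+-monoˡ-≤ ((w >> h) * 2 ^ h) (<⇒≤ (m%n<n w (2 ^ h)))) (≤-reflexive (*-comm b (2 ^ h))))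

-- The reduction

module _ (S : DataStructure) (C : ℕ) where

  -- The first line is the value of `costC` at the multipliers. The second pays for the setup, in
  -- which finding the word size takes 3w steps, with w at most 64 C times the number of blocks, and
  -- finding the stride 3E steps.
  overhead : ℕ → ℕ
  overhead a = costC (suc (2 * a)) (suc (2 ^ (2 + C))) 1 (2 + C) (2 * (4 * a)) 4 32 1 +
               ((14 + suc C) + (C * 64 * 3 + (2 + C) * 3))

  reduction-spec : ∀ a {n k m} p q → 2 ≤ n → 1 ≤ m →
    natural k ≤ᴿ natural a *ᴿ (natural n /ᴿ log n) → natural m ≤ᴿ natural a *ᴿ log n →
    (T : BitString n) (D : Vec (BitString m) k) →
    ∀ w → 2 ≤ w × n < 2 ^ w × suc (lg n) ≤ w → w ≤ C * suc (lg n) → k * m < 2 ^ w →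
    HaltsWithin w (preprocess S) (textInput w T) p (λ _ → ⊤) →
    (∀ σ i → Reachable w S T σ → 1 ≤ i → i ≤ n → HaltsWithin w (query S) (setReg 0 i σ) q (λ τ → IsSA T i (reg τ 0))) →
    HaltsWithin w (matcher (suc C) S) (matchingInput w T D)
      (p + overhead a * (n / suc (lg n) * (suc (lg (lg n)) * suc q))) (CorrectAnswer T D)
  reduction-spec a p q 2≤n 1≤m k≤ m≤ T D zero (() , _) w≤ km< preprocessing answers
  reduction-spec a {n} {k} {m} p q 2≤n 1≤m k≤ m≤ T D w@(suc v) (2≤w , n<2^w , L<w) w≤ km< preprocessing answers =
    within total (matcher-spec v n k m (suc C) E T D (s≤s⁻¹ 2≤w) (s≤s z≤n) n<2^w 1≤m km< 2^E≤w w<2^E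
      S p q preprocessing answers cost 1≤cost solving)
    where
    L = lg n
    -- At `suc w` the strict and the weak bound of `lg` turn into `2 ^ E ≤ w < 2 ^ suc E`.
    E = lg (suc w)
    z = blocks 2≤n
    U = z * (suc (lg L) * suc q)
    K = costC (suc (2 * a)) (suc (2 ^ (2 + C))) 1 (2 + C) (2 * (4 * a)) 4 32 1
    cost = p + K * U
    2^E≤w : 2 ^ E ≤ w
    2^E≤w = s≤s⁻¹ (2^lg< (suc w) (s≤s (s≤s z≤n)))
    w<2^E : w < 2 ^ suc E
    w<2^E = ≤2^lg (suc w)
    z≤U : z ≤ U
    z≤U = m≤m*n z (suc (lg L) * suc q)
    1≤U : 1 ≤ U
    1≤U = ≤-trans (1≤blocks 2≤n) z≤U
    1≤cost : 1 ≤ cost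
    1≤cost = ≤-trans (*-mono-≤ {1} {K} (s≤s z≤n) 1≤U) (m≤n+m (K * U) p)
    solving : (m≤n : m ≤ n) →
              solveCost (instanceOf v n k m (suc C) E T D (s≤s⁻¹ 2≤w) (s≤s z≤n) n<2^w 1≤m km< 2^E≤w w<2^E m≤n) S p q preprocessing answers ≤ cost
    solving m≤n = ≤-trans
      (≤-reflexive (solveCost-split (instanceOf v n k m (suc C) E T D (s≤s⁻¹ 2≤w) (s≤s z≤n) n<2^w 1≤m km< 2^E≤w w<2^E m≤n) S p q preprocessing answers))
      (+-monoʳ-≤ p (cost-dominated {suc ((m ∸ 1) / w)} {suc (w / suc (w >> (2 + C)))} {q} {E} {k} {n >> E} {2 ^ suc (w >> (2 + C))} {n / w} {lg L} {z}
        (suc (2 * a)) (suc (2 ^ (2 + C))) (2 + C) (2 * (4 * a))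
        (words-≤ 2≤n a {m} {w} m≤ L<w) (digits-≤ w (2 + C)) (stride-log-≤ 2≤n {w} {E} C w≤ 2^E≤w) (patterns-≤ 2≤n a k≤)
        (strides-≤ 2≤n {w} {E} L<w w<2^E) (base-≤ 2≤n {w} C w≤) (text-words-≤ 2≤n {w} L<w) (1≤blocks 2≤n)))
    total : 1 + ((2 + w * 3) + (1 + (suc C + ((8 + E * 3) + (2 + cost))))) ≤ p + overhead a * U
    total = begin
      1 + ((2 + w * 3) + (1 + (suc C + ((8 + E * 3) + (2 + cost)))))   ≡⟨ regroup w C E p (K * U) ⟩
      p + (K * U + ((14 + suc C) + (w * 3 + E * 3)))
        ≤⟨ +-monoʳ-≤ p (dom-+ {U} K ((14 + suc C) + (C * 64 * 3 + (2 + C) * 3)) ≤-refl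
             (dom-+ {U} (14 + suc C) (C * 64 * 3 + (2 + C) * 3) (dom-const {U} (14 + suc C) 1≤U ≤-refl)
             (dom-+ {U} (C * 64 * 3) ((2 + C) * 3) w*3≤ E*3≤))) ⟩
      p + overhead a * U ∎
      where
      open ≤-Reasoning
      regroup : ∀ w C E p x → 1 + ((2 + w * 3) + (1 + (suc C + ((8 + E * 3) + (2 + (p + x)))))) ≡
                              p + (x + ((14 + suc C) + (w * 3 + E * 3)))
      regroup = solve-∀
      swap : ∀ x y → x * y * 3 ≡ x * 3 * y
      swap = solve-∀
      w*3≤ : w * 3 ≤ C * 64 * 3 * U
      w*3≤ = ≤-trans (*-monoˡ-≤ 3 (≤-trans w≤ (≤-trans (*-monoʳ-≤ C (≤-trans (1+lg≤blocks 2≤n) (*-monoʳ-≤ 64 z≤U)))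
        (≤-reflexive (sym (*-assoc C 64 U)))))) (≤-reflexive (swap (C * 64) U))
      E*3≤ : E * 3 ≤ (2 + C) * 3 * U
      E*3≤ = ≤-trans (*-monoˡ-≤ 3 (≤-trans (stride-log-≤ 2≤n {w} {E} C w≤ 2^E≤w) (*-monoʳ-≤ (2 + C) V≤U)))
        (≤-reflexive (swap (2 + C) U))
        where
        V≤U : suc (lg L) ≤ U
        V≤U = ≤-trans (m≤m*n (suc (lg L)) (suc q)) (m≤n*m (suc (lg L) * suc q) z ⦃ >-nonZero (1≤blocks 2≤n) ⦄)

-- The program depends on c only through `C`, and not at all on `a`, which enters the running time
-- alone; so one program serves all constants hidden in k and m.
reduction : ∀ {c w} → IsReal c → natural 2 ≤ᴿ c → IsWordSize c w → ∀ S P Q → AnswersSuffixArrayQueries w S P Q →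
            Small P Q → ∃[ A ] SolvesDictionaryMatchingIn-o w A goal
reduction {c} {w} isReal 2≤c isWordSize S P Q answers small with natural-above isReal
... | C , c<C = matcher (suc C) S , λ a → runtime (overhead S C a) P Q , runtime-small (overhead S C a) P Q small ,
  λ n k m 2≤n 1≤k 1≤m k-within m-within km< T D →
    reduction-spec S C a (P n) (Q n) 2≤n 1≤m (proj₁ k-within) (proj₁ m-within) T D (w n)
      (wordSize-large {c} 2≤c {w} isWordSize {n} 2≤n) (wordSize-≤ {c} 2≤c {w} isWordSize {n} 2≤n isReal C c<C) km<
      (proj₁ (answers n 2≤n T)) (proj₂ (answers n 2≤n T))

corollary8p6 : (c : Cut) → IsReal c → natural 2 ≤ᴿ c →
    (w : ℕ → ℕ) → IsWordSize c w →
    ¬ (∃[ A ] SolvesDictionaryMatchingIn-o w A (λ n → natural n /ᴿ (√ log n))) →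
    (S : DataStructure) (P Q : ℕ → ℕ) → AnswersSuffixArrayQueries w S P Q →
    ¬ ((λ n → natural (P n) +ᴿ
    natural n *ᴿ (natural 1 +ᴿ loglog n) /ᴿ log n *ᴿ (natural (Q n) +ᴿ natural 1))
    ∈o (λ n → natural n /ᴿ (√ log n)))
    × ¬ ((λ n → natural (P n)) ∈o (λ n → natural n /ᴿ (√ log n))
    × (λ n → natural (Q n)) ∈o (λ n → (√ log n) /ᴿ (natural 1 +ᴿ loglog n)))
corollary8p6 c isReal 2≤c w isWordSize hard S P Q answers =
  (λ f∈o → hard (reduction isReal 2≤c isWordSize S P Q answers (small-if-target P Q f∈o))) ,
  (λ (p∈o , q∈o) → hard (reduction isReal 2≤c isWordSize S P Q answers (small-if-parts P Q p∈o q∈o)))
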